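{- For all integers $n\ge 0$ and $\alpha\ge 1$, $$PDN1\left(5^{2\alpha}n+\frac{23\cdot 5^{2\alpha}+1}{24}\right)\equiv 0 \pmod{5^{\alpha}},$$ and, for each $r\in\{71,119\}$, $$PDN1\left(5^{2\alpha+1}n+\frac{r\cdot 5^{2\alpha}+1}{24}\right)\equiv 0 \pmod{5^{\alpha+1}}.$$
   Context: $PDN1(N)$ is Andrews and Paule's function counting partition diamonds with $(n+1)$ copies of $n$ in which the parts at the links sum to $N$. Its generating function is $$\sum_{n\ge 0}PDN1(n)q^n=\frac{J_2^2}{J_1^5},\qquad J_k:=\prod_{m\ge1}(1-q^{km}),$$ and this identity may be taken as the definition of $PDN1(n)$. -}

module Defs where

import Data.Vec

open import Data.Nat using (ℕ; zero; suc; _∸_; _*_; _≡ᵇ_)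
open import Data.Bool using (if_then_else_)
open import Data.Integer using (ℤ; +_; -_; _+_; _*_)

Series : Set
Series = ℕ → ℤ

sumTo : ℕ → (ℕ → ℤ) → ℤ
sumTo zero    f = f 0
sumTo (suc n) f = sumTo n f + f (suc n)

infixl 7 _⋆_
_⋆_ : Series → Series → Series
(a ⋆ b) n = sumTo n (λ i → a i Data.Integer.* b (n ∸ i))

one : Series
one zero    = + 1
one (suc _) = + 0

-- the polynomial 1 − q^j  (used with j ≥ 1)
oneMinusQ^ : ℕ → Series
oneMinusQ^ j zero    = + 1
oneMinusQ^ j (suc n) = if suc n ≡ᵇ j then - (+ 1) else + 0

Jtrunc : ℕ → ℕ → Series
Jtrunc k zero    = one
Jtrunc k (suc M) = Jtrunc k M ⋆ oneMinusQ^ (k Data.Nat.* suc M)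

-- J_k = ∏_{m≥1} (1 − q^{km}); for k ≥ 1 its coefficient of q^n is
-- already determined by the factors with m ≤ n.
J : ℕ → Series
J k n = Jtrunc k n n

-- power series inverse of a series with constant term 1:
-- b 0 = 1,  b n = − Σ_{i=1}^{n} a i · b (n − i).
-- Computed by course-of-values recursion via the list of earlier coefficients.
private
  open import Data.Vec using (Vec; []; _∷_)

  -- invVec a n = (b n , b (n−1) , … , b 0)
  invVec : Series → (n : ℕ) → Vec ℤ (suc n)
  invVec a zero    = + 1 ∷ []
  invVec a (suc n) = next ∷ prev
    where
      prev : Vec ℤ (suc n)
      prev = invVec a n
      -- prev at position j (0-based) is b (n − j); we need
      -- Σ_{i=1}^{n+1} a i · b (n+1−i) = Σ_{j=0}^{n} a (j+1)·b(n−j)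
      go : (m : ℕ) → Vec ℤ m → ℕ → ℤ
      go zero    []       _ = + 0
      go (suc m) (x ∷ xs) j = a (suc j) Data.Integer.* x + go m xs (suc j)
      next : ℤ
      next = - go (suc n) prev 0

inv : Series → Series
inv a n = Data.Vec.head (invVec a n)

PDN1-series : Series
PDN1-series = (J 2 ⋆ J 2) ⋆ inv (J 1 ⋆ J 1 ⋆ J 1 ⋆ J 1 ⋆ J 1)

PDN1 : ℕ → ℤ
PDN1 n = PDN1-series n

{-# OPTIONS --safe #-}
-- Write U for the operator Σ a(n) qⁿ ↦ Σ a(5n) qⁿ. Shanks' finite identities give Euler's pentagonal series for J₁ and
-- Gauss' series ψ = J₂²/J₁; splitting these into residue classes modulo 5 yields the dissections
-- J₁/J₂₅ = 1/R − q − q² R and J₂/J₅₀ = 1/S − q² − q⁴ S, and comparing the dissections of J₁ ψ = J₂² yields Ramanujan's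
-- relation between R and S. From it everything is expressed by the level-10 function y with 1/y = ψ²/(q ψ(q⁵)²) − 5:
-- y satisfies a quintic over ℤ[y(q⁵)], and U maps the relevant series to polynomials in y divided by powers of κ = 1 + 5y.
--
-- Apart from a fixed factor, the generating functions Σ PDN1(25^α n + δ) qⁿ⁺¹ lie in the lattice of series Σ c_m y^{m+1}
-- with 5^{α + ⌊m/2⌋} ∣ c_m: of the two operators that lead from α to α + 1 the first preserves the lattice and the
-- second gains a factor 5. By the quintic recurrence both claims reduce to five rows each, which are computed.
-- For the second family only the terms y and y² matter modulo 5, and there they contribute no exponents ≡ 0, 3 (mod 5).

module Submission where

open import Defs
open import Data.Nat using (ℕ; suc; _+_; _*_; _^_; _/_)
open import Data.Integer using (+_)
open import Data.Integer.Divisibility using (_∣_)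
open import Data.Product using (_×_)
open import Data.Nat as ℕ using (zero; _∸_; _≤_; _<_; z≤n; s≤s; _%_; NonZero; _≡ᵇ_; ⌊_/2⌋; ⌈_/2⌉)
import Data.Nat.Properties as ℕₚ
import Data.Nat.DivMod as ℕₚ
import Data.Nat.Divisibility as ℕₚ
import Data.Nat.Tactic.RingSolver as ℕSolver
open import Data.Integer using (ℤ; -_; -[1+_]; 0ℤ; 1ℤ; ∣_∣) renaming (_+_ to _+ℤ_; _*_ to _*ℤ_; _-_ to _-ℤ_; _≤_ to _≤ℤ_)
import Data.Integer.Properties as ℤₚ
open import Data.Integer.Tactic.RingSolver using (solve-∀)
open import Data.Integer.Divisibility.Signed as Signed using (divides; ∣m∣n⇒∣m+n; ∣n⇒∣m*n; ∣ᵤ⇒∣; ∣⇒∣ᵤ; ∣-trans)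
open import Data.Bool using (Bool; true; false; _∧_; if_then_else_; T)
open import Data.Empty using (⊥-elim)
open import Data.Fin using (Fin; zero; suc)
open import Data.List using (List; []; _∷_)
open import Data.Product using (_,_; Σ; proj₁; proj₂)
open import Data.Unit using (tt)
open import Data.Vec using (Vec; []; _∷_; lookup; map)
open import Data.Vec.Properties using (lookup-map)
open import Function using (_∘_; flip)
open import Level using (0ℓ)
open import Relation.Nullary using (yes; no)
open import Relation.Nullary.Decidable using (toWitness)
open import Relation.Binary.Bundles using (Setoid)
open import Relation.Binary.PropositionalEquality hiding (J)
import Relation.Binary.Reasoning.Setoid as SetoidReasoning
open import Algebra.Bundles using (CommutativeRing)
open import Algebra.Structures using (IsCommutativeRing)

-- Finite sums

-- The fixed factor is A κν or A(q⁵) κν, where A = Σ PDN1(n) qⁿ and κν = (1 + 5y)(1 + 4y); `V₀` and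
-- `V₁` are what U induces on the remaining factor. With J₁ = J₂₅ â, J₂ = J₅₀ b̂, a = â/q and b =
-- b̂/q², the quotient q A / A(q²⁵) is Φ = b²/a⁵. Put y₅ = y(q⁵), ã = y₅ a and τ = y₅/y. Up to
-- factors that are series in q⁵, Φ is ã τ⁴ y⁶ and ν = 1 + 4y is ã² τ⁴ y⁶, so U is needed only on ã
-- τ⁴ yⁿ and ã² τ⁴ yⁿ. The quintic reduces these to n ≤ 4, that is to ã τʲ and ã² τʲ with j ≤ 4;
-- those come from monomials in a and b, on which U can be read off the dissections. The exponent
-- ⌊m/2⌋ gives y the 5-adic size of 5^(-1/2). In this weighting the quintic is balanced: its
-- coefficient of y₅ˡ yⁱ is divisible by 5^⌈(l + i - 5)/2⌉ whenever l + i > 5. Dividing by powers of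
-- κ produces infinite series in y. It keeps the lattice because the 5 in 1 + 5y more than pays for
-- one factor y; the infinite sums are the reason for describing the lattice by truncations modulo
-- powers of q.

sum-cong : ∀ n {f g : ℕ → ℤ} → (∀ i → i ≤ n → f i ≡ g i) → sumTo n f ≡ sumTo n g
sum-cong zero    h = h 0 z≤n
sum-cong (suc n) h = cong₂ _+ℤ_ (sum-cong n (λ i i≤n → h i (ℕₚ.m≤n⇒m≤1+n i≤n))) (h (suc n) ℕₚ.≤-refl)

sum-ext : ∀ n {f g : ℕ → ℤ} → (∀ i → f i ≡ g i) → sumTo n f ≡ sumTo n g
sum-ext n h = sum-cong n (λ i _ → h i)

interchangeℤ : ∀ a b c d → (a +ℤ b) +ℤ (c +ℤ d) ≡ (a +ℤ c) +ℤ (b +ℤ d)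
interchangeℤ = solve-∀

sum-+ : ∀ n (f g : ℕ → ℤ) → sumTo n (λ i → f i +ℤ g i) ≡ sumTo n f +ℤ sumTo n g
sum-+ zero    f g = refl
sum-+ (suc n) f g = trans (cong (_+ℤ (f (suc n) +ℤ g (suc n))) (sum-+ n f g))
                          (interchangeℤ (sumTo n f) (sumTo n g) (f (suc n)) (g (suc n)))

sum-*ˡ : ∀ n c (f : ℕ → ℤ) → sumTo n (λ i → c *ℤ f i) ≡ c *ℤ sumTo n f
sum-*ˡ zero    c f = refl
sum-*ˡ (suc n) c f = trans (cong (_+ℤ (c *ℤ f (suc n))) (sum-*ˡ n c f)) (sym (ℤₚ.*-distribˡ-+ c _ _))

sum-0 : ∀ n {f : ℕ → ℤ} → (∀ i → i ≤ n → f i ≡ 0ℤ) → sumTo n f ≡ 0ℤ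
sum-0 zero    h = h 0 z≤n
sum-0 (suc n) h = cong₂ _+ℤ_ (sum-0 n (λ i i≤n → h i (ℕₚ.m≤n⇒m≤1+n i≤n))) (h (suc n) ℕₚ.≤-refl)

sum-head : ∀ n (f : ℕ → ℤ) → sumTo (suc n) f ≡ f 0 +ℤ sumTo n (f ∘ suc)
sum-head zero    f = refl
sum-head (suc n) f = trans (cong (_+ℤ f (suc (suc n))) (sum-head n f)) (ℤₚ.+-assoc (f 0) _ _)

sum-reverse : ∀ n (f : ℕ → ℤ) → sumTo n f ≡ sumTo n (λ i → f (n ∸ i))
sum-reverse zero    f = refl
sum-reverse (suc n) f =
  trans (cong (_+ℤ f (suc n)) (sum-reverse n f))
  (trans (ℤₚ.+-comm _ (f (suc n))) (sym (sum-head n (λ i → f (suc n ∸ i)))))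

-- The ring of power series

-- A record rather than a function type, so that unification can recover f and g.
infix 4 _≈_
record _≈_ (f g : Series) : Set where
  constructor ext
  field coeff : ∀ n → f n ≡ g n
open _≈_ public

infixl 6 _⊞_
infix 8 ⊟_

_⊞_ : Series → Series → Series
(f ⊞ g) n = f n +ℤ g n

⊟_ : Series → Series
(⊟ f) n = - f n

constant : ℤ → Series
constant z zero    = z
constant z (suc _) = 0ℤ

0S : Series
0S _ = 0ℤ

shift : Series → Series
shift f n = f (suc n)

≈-refl : ∀ {f} → f ≈ f
≈-refl = ext λ n → refl

≈-sym : ∀ {f g} → f ≈ g → g ≈ f
≈-sym h = ext λ n → sym (coeff h n)

≈-trans : ∀ {f g h} → f ≈ g → g ≈ h → f ≈ h
≈-trans p r = ext λ n → trans (coeff p n) (coeff r n)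

≈-setoid : Setoid 0ℓ 0ℓ
≈-setoid = record { Carrier = Series ; _≈_ = _≈_
                  ; isEquivalence = record { refl = ≈-refl ; sym = ≈-sym ; trans = ≈-trans } }

⊞-cong : ∀ {f f' g g'} → f ≈ f' → g ≈ g' → f ⊞ g ≈ f' ⊞ g'
⊞-cong p r = ext λ n → cong₂ _+ℤ_ (coeff p n) (coeff r n)

⊟-cong : ∀ {f f'} → f ≈ f' → ⊟ f ≈ ⊟ f'
⊟-cong p = ext λ n → cong -_ (coeff p n)

⋆-cong : ∀ {f f' g g'} → f ≈ f' → g ≈ g' → f ⋆ g ≈ f' ⋆ g'
⋆-cong p r = ext λ n → sum-ext n (λ i → cong₂ _*ℤ_ (coeff p i) (coeff r (n ∸ i)))

-- Peeling off the constant term of the left factor permits induction on the exponent, with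
-- `shift f` in the place of f.
⋆-suc : ∀ f g n → (f ⋆ g) (suc n) ≡ f 0 *ℤ g (suc n) +ℤ (shift f ⋆ g) n
⋆-suc f g n = sum-head n _

⋆-comm : ∀ f g → f ⋆ g ≈ g ⋆ f
⋆-comm f g = ext λ n → trans (sum-reverse n _) (sum-cong n λ i i≤n →
  trans (cong (λ z → f (n ∸ i) *ℤ g z) (ℕₚ.m∸[m∸n]≡n i≤n)) (ℤₚ.*-comm (f (n ∸ i)) (g i)))

⋆-distribʳ : ∀ f g h → (f ⊞ g) ⋆ h ≈ f ⋆ h ⊞ g ⋆ h
⋆-distribʳ f g h = ext λ n → trans (sum-ext n (λ i → ℤₚ.*-distribʳ-+ (h (n ∸ i)) (f i) (g i))) (sum-+ n _ _)

⋆-distribˡ : ∀ f g h → f ⋆ (g ⊞ h) ≈ f ⋆ g ⊞ f ⋆ h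
⋆-distribˡ f g h = ≈-trans (⋆-comm f (g ⊞ h))
  (≈-trans (⋆-distribʳ g h f) (⊞-cong (⋆-comm g f) (⋆-comm h f)))

-- Induction on the exponent with f varying: `⋆-suc` reduces the claim to `shift f`, so that no
-- double sum has to be reindexed.
⋆-assoc-coeff : ∀ f g h n → ((f ⋆ g) ⋆ h) n ≡ (f ⋆ (g ⋆ h)) n
⋆-assoc-coeff f g h zero    = ℤₚ.*-assoc (f 0) (g 0) (h 0)
⋆-assoc-coeff f g h (suc n) = begin
  ((f ⋆ g) ⋆ h) (suc n)
    ≡⟨ ⋆-suc (f ⋆ g) h n ⟩
  f 0 *ℤ g 0 *ℤ h (suc n) +ℤ (shift (f ⋆ g) ⋆ h) n
    ≡⟨ cong₂ _+ℤ_ (ℤₚ.*-assoc (f 0) (g 0) (h (suc n)))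
         (trans (coeff (⋆-cong {shift (f ⋆ g)} {(λ m → f 0 *ℤ shift g m) ⊞ shift f ⋆ g} {h} (ext (⋆-suc f g)) ≈-refl) n)
         (trans (coeff (⋆-distribʳ (λ m → f 0 *ℤ shift g m) (shift f ⋆ g) h) n)
         (cong₂ _+ℤ_
           (trans (sum-ext n (λ i → ℤₚ.*-assoc (f 0) (g (suc i)) (h (n ∸ i)))) (sum-*ˡ n (f 0) _))
           (⋆-assoc-coeff (shift f) g h n)))) ⟩
  f 0 *ℤ (g 0 *ℤ h (suc n)) +ℤ (f 0 *ℤ (shift g ⋆ h) n +ℤ (shift f ⋆ (g ⋆ h)) n)
    ≡⟨ sym (ℤₚ.+-assoc (f 0 *ℤ (g 0 *ℤ h (suc n))) _ _) ⟩
  f 0 *ℤ (g 0 *ℤ h (suc n)) +ℤ f 0 *ℤ (shift g ⋆ h) n +ℤ (shift f ⋆ (g ⋆ h)) n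
    ≡⟨ cong (_+ℤ (shift f ⋆ (g ⋆ h)) n) (sym (ℤₚ.*-distribˡ-+ (f 0) _ _)) ⟩
  f 0 *ℤ (g 0 *ℤ h (suc n) +ℤ (shift g ⋆ h) n) +ℤ (shift f ⋆ (g ⋆ h)) n
    ≡⟨ cong (λ z → f 0 *ℤ z +ℤ (shift f ⋆ (g ⋆ h)) n) (sym (⋆-suc g h n)) ⟩
  f 0 *ℤ (g ⋆ h) (suc n) +ℤ (shift f ⋆ (g ⋆ h)) n
    ≡⟨ sym (⋆-suc f (g ⋆ h) n) ⟩
  (f ⋆ (g ⋆ h)) (suc n) ∎
  where open ≡-Reasoning

⋆-assoc : ∀ f g h → (f ⋆ g) ⋆ h ≈ f ⋆ (g ⋆ h)
⋆-assoc f g h = ext (⋆-assoc-coeff f g h)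

constant-⋆ : ∀ z f n → (constant z ⋆ f) n ≡ z *ℤ f n
constant-⋆ z f zero    = refl
constant-⋆ z f (suc n) = trans (⋆-suc (constant z) f n)
  (trans (cong (z *ℤ f (suc n) +ℤ_) (sum-0 n (λ _ _ → refl))) (ℤₚ.+-identityʳ _))

one≈constant : one ≈ constant (+ 1)
one≈constant = ext λ { zero → refl ; (suc n) → refl }

⋆-identityˡ : ∀ f → one ⋆ f ≈ f
⋆-identityˡ f = ≈-trans (⋆-cong {one} {constant (+ 1)} {f} {f} one≈constant ≈-refl)
  (ext λ n → trans (constant-⋆ (+ 1) f n) (ℤₚ.*-identityˡ (f n)))

⋆-identityʳ : ∀ f → f ⋆ one ≈ f
⋆-identityʳ f = ≈-trans (⋆-comm f one) (⋆-identityˡ f)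

-- The ring operations are opaque: equality of functions would otherwise be tested by
-- unfolding them, and implicit arguments of type Series could not be inferred.
infixl 6 _⊕_ _⊖_
infixl 7 _·_
infix 8 ⊝_

opaque
  _⊕_ : Series → Series → Series
  _⊕_ = _⊞_

  ⊝_ : Series → Series
  ⊝_ = ⊟_

  _·_ : Series → Series → Series
  _·_ = _⋆_

  Series-isCommutativeRing : IsCommutativeRing _≈_ _⊕_ _·_ ⊝_ 0S one
  Series-isCommutativeRing = record
    { isRing = record
      { +-isAbelianGroup = record
        { isGroup = record
          { isMonoid = record
            { isSemigroup = record
              { isMagma = record { isEquivalence = Setoid.isEquivalence ≈-setoid ; ∙-cong = ⊞-cong }
              ; assoc = λ f g h → ext λ n → ℤₚ.+-assoc (f n) (g n) (h n) }
            ; identity = (λ f → ext λ n → ℤₚ.+-identityˡ (f n)) , (λ f → ext λ n → ℤₚ.+-identityʳ (f n)) }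
          ; inverse = (λ f → ext λ n → ℤₚ.+-inverseˡ (f n)) , (λ f → ext λ n → ℤₚ.+-inverseʳ (f n))
          ; ⁻¹-cong = ⊟-cong }
        ; comm = λ f g → ext λ n → ℤₚ.+-comm (f n) (g n) }
      ; *-cong = ⋆-cong
      ; *-assoc = ⋆-assoc
      ; *-identity = ⋆-identityˡ , ⋆-identityʳ
      ; distrib = ⋆-distribˡ , (λ f g h → ⋆-distribʳ g h f) }
    ; *-comm = ⋆-comm }

  ⊕-coeff : ∀ f g n → (f ⊕ g) n ≡ f n +ℤ g n
  ⊕-coeff f g n = refl

  ⊝-coeff : ∀ f n → (⊝ f) n ≡ - f n
  ⊝-coeff f n = refl

  ·-coeff : ∀ f g n → (f · g) n ≡ (f ⋆ g) n
  ·-coeff f g n = refl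

_⊖_ : Series → Series → Series
f ⊖ g = f ⊕ ⊝ g

⊖-coeff : ∀ f g n → (f ⊖ g) n ≡ f n -ℤ g n
⊖-coeff f g n = trans (⊕-coeff f (⊝ g) n) (cong (f n +ℤ_) (⊝-coeff g n))

·≈⋆ : ∀ f g → f · g ≈ f ⋆ g
·≈⋆ f g = ext (·-coeff f g)

·-suc : ∀ f g n → (f · g) (suc n) ≡ f 0 *ℤ g (suc n) +ℤ (shift f · g) n
·-suc f g n = trans (·-coeff f g (suc n)) (trans (⋆-suc f g n) (cong (f 0 *ℤ g (suc n) +ℤ_) (sym (·-coeff (shift f) g n))))

constant-· : ∀ z f n → (constant z · f) n ≡ z *ℤ f n
constant-· z f n = trans (·-coeff (constant z) f n) (constant-⋆ z f n)

Series-commutativeRing : CommutativeRing 0ℓ 0ℓ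
Series-commutativeRing = record { isCommutativeRing = Series-isCommutativeRing }

open CommutativeRing Series-commutativeRing public using ()
  renaming ( +-cong to ⊕-cong; -‿cong to ⊝-cong; *-cong to ·-cong; +-assoc to ⊕-assoc; +-comm to ⊕-comm
           ; +-identityˡ to ⊕-identityˡ; +-identityʳ to ⊕-identityʳ; *-assoc to ·-assoc; *-comm to ·-comm
           ; *-identityˡ to ·-identityˡ; *-identityʳ to ·-identityʳ; zeroˡ to ·-zeroˡ; zeroʳ to ·-zeroʳ
           ; distribˡ to ·-distribˡ; distribʳ to ·-distribʳ)

⊖-cong : ∀ {f f' g g'} → f ≈ f' → g ≈ g' → f ⊖ g ≈ f' ⊖ g'
⊖-cong p r = ⊕-cong p (⊝-cong r)

·-congˡ : ∀ {f g h} → g ≈ h → f · g ≈ f · h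
·-congˡ p = ·-cong ≈-refl p

·-congʳ : ∀ {f g h} → g ≈ h → g · f ≈ h · f
·-congʳ p = ·-cong p ≈-refl

open import Algebra.Properties.CommutativeSemigroup (CommutativeRing.+-commutativeSemigroup Series-commutativeRing) using () renaming (interchange to ⊕-interchange)
open import Algebra.Properties.Ring (CommutativeRing.ring Series-commutativeRing) using (-‿distribˡ-*; -‿distribʳ-*; -‿+-comm; -0#≈0#)

module ≈-Reasoning = SetoidReasoning ≈-setoid

infixr 9 _^S_
_^S_ : Series → ℕ → Series
f ^S zero  = one
f ^S suc n = f · f ^S n

^S-cong : ∀ n {f g} → f ≈ g → f ^S n ≈ g ^S n
^S-cong zero    h = ≈-refl
^S-cong (suc n) h = ·-cong h (^S-cong n h)

constant-0 : constant 0ℤ ≈ 0S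
constant-0 = ext λ { zero → refl ; (suc _) → refl }

constant-+ : ∀ x y → constant (x +ℤ y) ≈ constant x ⊕ constant y
constant-+ x y = ext λ { zero → sym (⊕-coeff _ _ 0) ; (suc n) → sym (⊕-coeff _ _ (suc n)) }

constant-neg : ∀ x → constant (- x) ≈ ⊝ constant x
constant-neg x = ext λ { zero → sym (⊝-coeff _ 0) ; (suc n) → sym (⊝-coeff _ (suc n)) }

constant-* : ∀ x y → constant (x *ℤ y) ≈ constant x · constant y
constant-* x y = ext λ { zero → sym (constant-· x (constant y) 0)
                       ; (suc n) → sym (trans (constant-· x (constant y) (suc n)) (ℤₚ.*-zeroʳ x)) }

-- Multivariate integer polynomials in Horner form, used to decide identities between series.

Poly : ℕ → Set
Poly zero    = ℤ
Poly (suc n) = List (Poly n)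

⟦_⟧ : ∀ {n} → Poly n → Vec Series n → Series
⟦_⟧ {zero}  z        []      = constant z
⟦_⟧ {suc n} []       (x ∷ ρ) = 0S
⟦_⟧ {suc n} (p ∷ ps) (x ∷ ρ) = ⟦ p ⟧ ρ ⊕ x · ⟦ ps ⟧ (x ∷ ρ)

conP : ∀ {n} → ℤ → Poly n
conP {zero}  z = z
conP {suc n} z = conP z ∷ []

varP : ∀ {n} → Fin n → Poly n
varP {suc n} zero    = conP 0ℤ ∷ conP 1ℤ ∷ []
varP {suc n} (suc i) = varP i ∷ []

infixl 6 _+P_
infixl 7 _*P_

_+P_ : ∀ {n} → Poly n → Poly n → Poly n
_+P_ {zero}  x y = x +ℤ y
_+P_ {suc n} []       qs       = qs
_+P_ {suc n} (p ∷ ps) []       = p ∷ ps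
_+P_ {suc n} (p ∷ ps) (q ∷ qs) = (p +P q) ∷ (ps +P qs)

-P_ : ∀ {n} → Poly n → Poly n
-P_ {zero}  x        = - x
-P_ {suc n} []       = []
-P_ {suc n} (p ∷ ps) = (-P p) ∷ (-P ps)

mutual
  _*P_ : ∀ {n} → Poly n → Poly n → Poly n
  _*P_ {zero}  x y = x *ℤ y
  _*P_ {suc n} []       qs = []
  _*P_ {suc n} (p ∷ ps) qs = scaleP p qs +P (conP 0ℤ ∷ (ps *P qs))

  scaleP : ∀ {n} → Poly n → Poly (suc n) → Poly (suc n)
  scaleP p []       = []
  scaleP p (q ∷ qs) = (p *P q) ∷ scaleP p qs

-- The arithmetic never trims trailing zeros, so zero has many representations; hence a test of all
-- coefficients.
isZero : ∀ {n} → Poly n → Bool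
isZero {zero}  (+ zero) = true
isZero {zero}  _        = false
isZero {suc n} []       = true
isZero {suc n} (p ∷ ps) = isZero p ∧ isZero ps

conP-sound : ∀ {n} z (ρ : Vec Series n) → ⟦ conP z ⟧ ρ ≈ constant z
conP-sound z []      = ≈-refl
conP-sound z (x ∷ ρ) = ≈-trans (⊕-cong (conP-sound z ρ) (·-zeroʳ x)) (⊕-identityʳ _)

varP-sound : ∀ {n} (i : Fin n) (ρ : Vec Series n) → ⟦ varP i ⟧ ρ ≈ lookup ρ i
varP-sound zero    (x ∷ ρ) = begin
  ⟦ conP 0ℤ ⟧ ρ ⊕ x · (⟦ conP 1ℤ ⟧ ρ ⊕ x · 0S)
    ≈⟨ ⊕-cong (≈-trans (conP-sound 0ℤ ρ) constant-0)
         (·-cong ≈-refl (≈-trans (⊕-cong (≈-trans (conP-sound 1ℤ ρ) (≈-sym one≈constant)) (·-zeroʳ x)) (⊕-identityʳ one))) ⟩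
  0S ⊕ x · one ≈⟨ ⊕-identityˡ _ ⟩
  x · one      ≈⟨ ·-identityʳ x ⟩
  x            ∎
  where open ≈-Reasoning
varP-sound (suc i) (x ∷ ρ) = ≈-trans (⊕-cong (varP-sound i ρ) (·-zeroʳ x)) (⊕-identityʳ _)

+P-sound : ∀ {n} (p q : Poly n) ρ → ⟦ p +P q ⟧ ρ ≈ ⟦ p ⟧ ρ ⊕ ⟦ q ⟧ ρ
+P-sound {zero}  x y []      = constant-+ x y
+P-sound {suc n} []       qs       (x ∷ ρ) = ≈-sym (⊕-identityˡ _)
+P-sound {suc n} (p ∷ ps) []       (x ∷ ρ) = ≈-sym (⊕-identityʳ _)
+P-sound {suc n} (p ∷ ps) (q ∷ qs) (x ∷ ρ) = begin
  ⟦ p +P q ⟧ ρ ⊕ x · ⟦ ps +P qs ⟧ (x ∷ ρ)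
    ≈⟨ ⊕-cong (+P-sound p q ρ) (≈-trans (·-cong ≈-refl (+P-sound ps qs (x ∷ ρ))) (·-distribˡ x _ _)) ⟩
  (⟦ p ⟧ ρ ⊕ ⟦ q ⟧ ρ) ⊕ (x · ⟦ ps ⟧ (x ∷ ρ) ⊕ x · ⟦ qs ⟧ (x ∷ ρ))
    ≈⟨ ⊕-interchange (⟦ p ⟧ ρ) (⟦ q ⟧ ρ) _ _ ⟩
  _ ∎
  where open ≈-Reasoning

-P-sound : ∀ {n} (p : Poly n) ρ → ⟦ -P p ⟧ ρ ≈ ⊝ ⟦ p ⟧ ρ
-P-sound {zero}  x []      = constant-neg x
-P-sound {suc n} []       (x ∷ ρ) = ≈-sym -0#≈0#
-P-sound {suc n} (p ∷ ps) (x ∷ ρ) = begin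
  ⟦ -P p ⟧ ρ ⊕ x · ⟦ -P ps ⟧ (x ∷ ρ)
    ≈⟨ ⊕-cong (-P-sound p ρ) (≈-trans (·-cong ≈-refl (-P-sound ps (x ∷ ρ))) (≈-sym (-‿distribʳ-* x _))) ⟩
  ⊝ ⟦ p ⟧ ρ ⊕ ⊝ (x · ⟦ ps ⟧ (x ∷ ρ))
    ≈⟨ -‿+-comm (⟦ p ⟧ ρ) _ ⟩
  _ ∎
  where open ≈-Reasoning

mutual
  *P-sound : ∀ {n} (p q : Poly n) ρ → ⟦ p *P q ⟧ ρ ≈ ⟦ p ⟧ ρ · ⟦ q ⟧ ρ
  *P-sound {zero}  x y []      = constant-* x y
  *P-sound {suc n} []       qs (x ∷ ρ) = ≈-sym (·-zeroˡ _)
  *P-sound {suc n} (p ∷ ps) qs (x ∷ ρ) = begin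
    ⟦ scaleP p qs +P (conP 0ℤ ∷ (ps *P qs)) ⟧ (x ∷ ρ)
      ≈⟨ +P-sound (scaleP p qs) _ (x ∷ ρ) ⟩
    ⟦ scaleP p qs ⟧ (x ∷ ρ) ⊕ (⟦ conP 0ℤ ⟧ ρ ⊕ x · ⟦ ps *P qs ⟧ (x ∷ ρ))
      ≈⟨ ⊕-cong (scaleP-sound p qs x ρ)
           (≈-trans (⊕-cong (≈-trans (conP-sound 0ℤ ρ) constant-0) (·-cong ≈-refl (*P-sound ps qs (x ∷ ρ))))
           (≈-trans (⊕-identityˡ _) (≈-sym (·-assoc x _ _)))) ⟩
    ⟦ p ⟧ ρ · ⟦ qs ⟧ (x ∷ ρ) ⊕ (x · ⟦ ps ⟧ (x ∷ ρ)) · ⟦ qs ⟧ (x ∷ ρ)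
      ≈⟨ ≈-sym (·-distribʳ _ _ _) ⟩
    _ ∎
    where open ≈-Reasoning

  scaleP-sound : ∀ {n} (p : Poly n) qs x ρ → ⟦ scaleP p qs ⟧ (x ∷ ρ) ≈ ⟦ p ⟧ ρ · ⟦ qs ⟧ (x ∷ ρ)
  scaleP-sound p []       x ρ = ≈-sym (·-zeroʳ _)
  scaleP-sound p (q ∷ qs) x ρ = begin
    ⟦ p *P q ⟧ ρ ⊕ x · ⟦ scaleP p qs ⟧ (x ∷ ρ)
      ≈⟨ ⊕-cong (*P-sound p q ρ) (·-cong ≈-refl (scaleP-sound p qs x ρ)) ⟩
    P · ⟦ q ⟧ ρ ⊕ x · (P · Q)
      ≈⟨ ⊕-cong ≈-refl (≈-trans (≈-sym (·-assoc x P Q)) (≈-trans (·-cong (·-comm x P) ≈-refl) (·-assoc P x Q))) ⟩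
    P · ⟦ q ⟧ ρ ⊕ P · (x · Q)
      ≈⟨ ≈-sym (·-distribˡ P _ _) ⟩
    _ ∎
    where
    open ≈-Reasoning
    P Q : Series
    P = ⟦ p ⟧ ρ
    Q = ⟦ qs ⟧ (x ∷ ρ)

∧-split : ∀ {x y} → x ∧ y ≡ true → (x ≡ true) Data.Product.× (y ≡ true)
∧-split {true} {true} refl = refl , refl

isZero-sound : ∀ {n} (p : Poly n) ρ → isZero p ≡ true → ⟦ p ⟧ ρ ≈ 0S
isZero-sound {zero}  (+ zero) []      h = constant-0
isZero-sound {suc n} []       (x ∷ ρ) h = ≈-refl
isZero-sound {suc n} (p ∷ ps) (x ∷ ρ) h with ∧-split h
... | hp , hps = ≈-trans (⊕-cong (isZero-sound p ρ hp)
                   (≈-trans (·-cong ≈-refl (isZero-sound ps (x ∷ ρ) hps)) (·-zeroʳ x))) (⊕-identityˡ 0S)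

-- Ring expressions and the decision procedure for identities

infix 10 #_
infixl 6 _:+_ _:-_
infixl 7 _:*_
infixr 9 _:^_

data Expr (n : ℕ) : Set where
  con       : ℤ → Expr n
  var       : Fin n → Expr n
  :one      : Expr n
  _:+_ _:*_ : Expr n → Expr n → Expr n
  _:-_      : Expr n → Expr n → Expr n
  :-_       : Expr n → Expr n
  _:^_      : Expr n → ℕ → Expr n

eval : ∀ {n} → Expr n → Vec Series n → Series
eval (con z)   ρ = constant z
eval (var i)   ρ = lookup ρ i
eval :one      ρ = one
eval (e :+ f)  ρ = eval e ρ ⊕ eval f ρ
eval (e :* f)  ρ = eval e ρ · eval f ρ
eval (e :- f)  ρ = eval e ρ ⊖ eval f ρ
eval (:- e)    ρ = ⊝ eval e ρ
eval (e :^ k)  ρ = eval e ρ ^S k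

_^P_ : ∀ {n} → Poly n → ℕ → Poly n
p ^P zero  = conP 1ℤ
p ^P suc k = p *P (p ^P k)

normal : ∀ {n} → Expr n → Poly n
normal (con z)  = conP z
normal (var i)  = varP i
normal :one     = conP 1ℤ
normal (e :+ f) = normal e +P normal f
normal (e :* f) = normal e *P normal f
normal (e :- f) = normal e +P (-P normal f)
normal (:- e)   = -P normal e
normal (e :^ k) = normal e ^P k

^P-sound : ∀ {n} (p : Poly n) k ρ → ⟦ p ^P k ⟧ ρ ≈ ⟦ p ⟧ ρ ^S k
^P-sound p zero    ρ = ≈-trans (conP-sound 1ℤ ρ) (≈-sym one≈constant)
^P-sound p (suc k) ρ = ≈-trans (*P-sound p (p ^P k) ρ) (·-cong ≈-refl (^P-sound p k ρ))

normal-sound : ∀ {n} (e : Expr n) ρ → ⟦ normal e ⟧ ρ ≈ eval e ρ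
normal-sound (con z)  ρ = conP-sound z ρ
normal-sound (var i)  ρ = varP-sound i ρ
normal-sound :one     ρ = ≈-trans (conP-sound 1ℤ ρ) (≈-sym one≈constant)
normal-sound (e :+ f) ρ = ≈-trans (+P-sound (normal e) (normal f) ρ) (⊕-cong (normal-sound e ρ) (normal-sound f ρ))
normal-sound (e :* f) ρ = ≈-trans (*P-sound (normal e) (normal f) ρ) (·-cong (normal-sound e ρ) (normal-sound f ρ))
normal-sound (e :- f) ρ = ≈-trans (+P-sound (normal e) (-P normal f) ρ)
  (⊕-cong (normal-sound e ρ) (≈-trans (-P-sound (normal f) ρ) (⊝-cong (normal-sound f ρ))))
normal-sound (:- e)   ρ = ≈-trans (-P-sound (normal e) ρ) (⊝-cong (normal-sound e ρ))
normal-sound (e :^ k) ρ = ≈-trans (^P-sound (normal e) k ρ) (^S-cong k (normal-sound e ρ))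

x⊖y≈0⇒x≈y : ∀ {f g} → f ⊖ g ≈ 0S → f ≈ g
x⊖y≈0⇒x≈y {f} {g} h = ext λ n → ℤₚ.i-j≡0⇒i≡j (f n) (g n) (trans (sym (⊖-coeff f g n)) (coeff h n))

-- A `refl` as last argument makes the type checker expand e - f and find every coefficient zero.
decide : ∀ {n} (ρ : Vec Series n) (e f : Expr n) → isZero (normal (e :- f)) ≡ true → eval e ρ ≈ eval f ρ
decide ρ e f h = x⊖y≈0⇒x≈y (≈-trans (≈-sym (normal-sound (e :- f) ρ)) (isZero-sound (normal (e :- f)) ρ h))

pattern #_ n = con (+ n)

pattern v0 = var zero
pattern v1 = var (suc zero)
pattern v2 = var (suc (suc zero))
pattern v3 = var (suc (suc (suc zero)))
pattern v4 = var (suc (suc (suc (suc zero))))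
pattern v5 = var (suc (suc (suc (suc (suc zero)))))
pattern v6 = var (suc (suc (suc (suc (suc (suc zero))))))
pattern v7 = var (suc (suc (suc (suc (suc (suc (suc zero)))))))
pattern v8 = var (suc (suc (suc (suc (suc (suc (suc (suc zero))))))))
pattern v9 = var (suc (suc (suc (suc (suc (suc (suc (suc (suc zero)))))))))
pattern v10 = var (suc (suc (suc (suc (suc (suc (suc (suc (suc (suc zero))))))))))
pattern v11 = var (suc (suc (suc (suc (suc (suc (suc (suc (suc (suc (suc zero)))))))))))
pattern v12 = var (suc (suc (suc (suc (suc (suc (suc (suc (suc (suc (suc (suc zero))))))))))))

x≈y⇒x⊖y≈0 : ∀ {f g} → f ≈ g → f ⊖ g ≈ 0S
x≈y⇒x⊖y≈0 {f} {g} h = ext λ n → trans (⊖-coeff f g n) (ℤₚ.i≡j⇒i-j≡0 (coeff h n))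

-- Agreement modulo q^N

infix 4 _≋[_]_
record _≋[_]_ (f : Series) (N : ℕ) (g : Series) : Set where
  constructor upTo
  field below : ∀ n → n < N → f n ≡ g n
open _≋[_]_ public

≈⇒≋ : ∀ {f g N} → f ≈ g → f ≋[ N ] g
≈⇒≋ h = upTo λ n _ → coeff h n

≋-sym : ∀ {f g N} → f ≋[ N ] g → g ≋[ N ] f
≋-sym h = upTo λ n n<N → sym (below h n n<N)

≋-trans : ∀ {f g h N} → f ≋[ N ] g → g ≋[ N ] h → f ≋[ N ] h
≋-trans p r = upTo λ n n<N → trans (below p n n<N) (below r n n<N)

≋-weaken : ∀ {f g M N} → M ≤ N → f ≋[ N ] g → f ≋[ M ] g
≋-weaken M≤N h = upTo λ n n<M → below h n (ℕₚ.<-≤-trans n<M M≤N)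

≋-⊕ : ∀ {f f' g g' N} → f ≋[ N ] f' → g ≋[ N ] g' → f ⊕ g ≋[ N ] f' ⊕ g'
≋-⊕ {f} {f'} {g} {g'} p r = upTo λ n n<N →
  trans (⊕-coeff f g n) (trans (cong₂ _+ℤ_ (below p n n<N) (below r n n<N)) (sym (⊕-coeff f' g' n)))

≋-· : ∀ {f f' g g' N} → f ≋[ N ] f' → g ≋[ N ] g' → f · g ≋[ N ] f' · g'
≋-· {f} {f'} {g} {g'} p r = upTo λ n n<N →
  trans (·-coeff f g n) (trans (sum-cong n λ i i≤n →
    cong₂ _*ℤ_ (below p i (ℕₚ.≤-<-trans i≤n n<N)) (below r (n ∸ i) (ℕₚ.≤-<-trans (ℕₚ.m∸n≤m n i) n<N)))
  (sym (·-coeff f' g' n)))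

≋⇒≈ : ∀ {f g} → (∀ N → f ≋[ N ] g) → f ≈ g
≋⇒≈ h = ext λ n → below (h (suc n)) n ℕₚ.≤-refl

-- Monomials and multiplication by powers of q

mono : ℕ → Series
mono zero    zero    = 1ℤ
mono zero    (suc n) = 0ℤ
mono (suc e) zero    = 0ℤ
mono (suc e) (suc n) = mono e n

q : Series
q = mono 1

mono-0 : mono 0 ≈ one
mono-0 = ext λ { zero → refl ; (suc n) → refl }

q·-zero : ∀ f → (q · f) 0 ≡ 0ℤ
q·-zero f = ·-coeff q f 0

mono-suc-· : ∀ e f n → (mono (suc e) · f) (suc n) ≡ (mono e · f) n
mono-suc-· e f n = trans (·-suc (mono (suc e)) f n) (ℤₚ.+-identityˡ _)

mono·-below : ∀ e f n → n < e → (mono e · f) n ≡ 0ℤ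
mono·-below (suc e) f zero    _         = ·-coeff (mono (suc e)) f 0
mono·-below (suc e) f (suc n) (s≤s n<e) = trans (mono-suc-· e f n) (mono·-below e f n n<e)

mono·-above : ∀ e f n → (mono e · f) (e + n) ≡ f n
mono·-above zero    f n = coeff (≈-trans (·-congʳ mono-0) (·-identityˡ f)) n
mono·-above (suc e) f n = trans (mono-suc-· e f (e + n)) (mono·-above e f n)

q·-suc : ∀ f n → (q · f) (suc n) ≡ f n
q·-suc f n = mono·-above 1 f n

mono-suc : ∀ e → mono (suc e) ≈ q · mono e
mono-suc e = ext λ { zero → sym (q·-zero (mono e)) ; (suc n) → sym (q·-suc (mono e) n) }

mono-^ : ∀ e → mono e ≈ q ^S e
mono-^ zero    = mono-0
mono-^ (suc e) = ≈-trans (mono-suc e) (·-congˡ (mono-^ e))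

mono-+ : ∀ a b → mono (a + b) ≈ mono a · mono b
mono-+ zero    b = ≈-sym (≈-trans (·-congʳ mono-0) (·-identityˡ (mono b)))
mono-+ (suc a) b = ≈-trans (mono-suc (a + b)) (≈-trans (·-congˡ (mono-+ a b))
  (≈-trans (≈-sym (·-assoc q (mono a) (mono b))) (·-congʳ (≈-sym (mono-suc a)))))

mono-small : ∀ e f → mono e · f ≋[ e ] 0S
mono-small e f = upTo λ n n<e → mono·-below e f n n<e

⊝0S : ⊝ 0S ≈ 0S
⊝0S = ext λ n → ⊝-coeff 0S n

mono-+-+ : ∀ j a b → mono (j + a) (j + b) ≡ mono a b
mono-+-+ zero    a b = refl
mono-+-+ (suc j) a b = mono-+-+ j a b

mono-< : ∀ a b → b < a → mono a b ≡ 0ℤ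
mono-< (suc a) zero    _         = refl
mono-< (suc a) (suc b) (s≤s b<a) = mono-< a b b<a

-- Dilation q ↦ q^k and the components f_i of f = Σ q^i f_i(q^k)

comp : ℕ → ℕ → Series → Series
comp k i f n = f (i + n * k)

dil : (k : ℕ) .{{_ : NonZero k}} → Series → Series
dil k f n = if n % k ≡ᵇ 0 then f (n / k) else 0ℤ

module Dilation (k-1 : ℕ) where

  k : ℕ
  k = suc k-1

  instance
    k-nonZero : NonZero k
    k-nonZero = _

  dil-multiple : ∀ f n → dil k f (n * k) ≡ f n
  dil-multiple f n rewrite ℕₚ.m*n%n≡0 n k {{_}} | ℕₚ.m*n/n≡m n k {{_}} = refl

  dil-other : ∀ f n i → suc i < k → dil k f (suc i + n * k) ≡ 0ℤ
  dil-other f n i i<k rewrite ℕₚ.[m+kn]%n≡m%n (suc i) n k {{_}} | ℕₚ.m<n⇒m%n≡m {{_}} i<k = refl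

  -- As i < k, the largest multiple of k in the range is n k, and only the multiples contribute.
  sum-skip : ∀ (h : ℕ → ℤ) → (∀ i n → suc i < k → h (suc i + n * k) ≡ 0ℤ) →
             ∀ n i → i < k → sumTo (i + n * k) h ≡ sumTo n (λ j → h (j * k))
  sum-skip h h0 zero    zero    _   = refl
  sum-skip h h0 (suc n) zero    _   = cong (_+ℤ h (suc n * k)) (sum-skip h h0 n k-1 ℕₚ.≤-refl)
  sum-skip h h0 n       (suc i) i<k =
    trans (cong₂ _+ℤ_ (sum-skip h h0 n i (ℕₚ.<-trans ℕₚ.≤-refl i<k)) (h0 i n i<k)) (ℤₚ.+-identityʳ _)

  -- Components are linear over series in q^k: in the convolution the left exponent must be a
  -- multiple of k, which leaves the residue i to g. Every evaluation of U rests on this.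
  comp-dil· : ∀ f g i → i < k → comp k i (dil k f · g) ≈ f · comp k i g
  comp-dil· f g i i<k = ext λ n →
    trans (·-coeff (dil k f) g (i + n * k))
    (trans (sum-skip (λ t → dil k f t *ℤ g (i + n * k ∸ t))
              (λ j m j<k → cong (_*ℤ g (i + n * k ∸ (suc j + m * k))) (dil-other f m j j<k)) n i i<k)
    (trans (sum-cong n λ j j≤n → cong₂ _*ℤ_ (dil-multiple f j)
              (cong g (trans (ℕₚ.+-∸-assoc i (ℕₚ.*-monoˡ-≤ k j≤n)) (cong (i ℕ.+_) (sym (ℕₚ.*-distribʳ-∸ k n j))))))
    (sym (·-coeff f (comp k i g) n))))

  comp-0-dil : ∀ f → comp k 0 (dil k f) ≈ f
  comp-0-dil f = ext (dil-multiple f)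

  comp-suc-dil : ∀ f i → suc i < k → comp k (suc i) (dil k f) ≈ 0S
  comp-suc-dil f i i<k = ext λ n → dil-other f n i i<k

  comp-ext : ∀ {f g} → (∀ i → i < k → comp k i f ≈ comp k i g) → f ≈ g
  comp-ext {f} {g} h = ext λ n → subst (λ m → f m ≡ g m) (sym (ℕₚ.m≡m%n+[m/n]*n n k))
    (coeff (h (n % k) (ℕₚ.m%n<n n k)) (n / k))

  comp-cong : ∀ i {f g} → f ≈ g → comp k i f ≈ comp k i g
  comp-cong i h = ext λ n → coeff h (i + n * k)

  comp-⊕ : ∀ i f g → comp k i (f ⊕ g) ≈ comp k i f ⊕ comp k i g
  comp-⊕ i f g = ext λ n → trans (⊕-coeff f g _) (sym (⊕-coeff (comp k i f) (comp k i g) n))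

  comp-⊝ : ∀ i f → comp k i (⊝ f) ≈ ⊝ comp k i f
  comp-⊝ i f = ext λ n → trans (⊝-coeff f _) (sym (⊝-coeff (comp k i f) n))

  -- Multiplication by q rotates the components; passing from k - 1 to 0 carries a factor q.
  comp-0-q : ∀ f → comp k 0 (q · f) ≈ q · comp k k-1 f
  comp-0-q f = ext λ { zero → trans (q·-zero f) (sym (q·-zero (comp k k-1 f)))
                     ; (suc n) → trans (q·-suc f _) (sym (q·-suc (comp k k-1 f) n)) }

  comp-suc-q : ∀ i f → comp k (suc i) (q · f) ≈ comp k i f
  comp-suc-q i f = ext λ n → q·-suc f _

  comp-≋ : ∀ i {f g N} → i < k → f ≋[ N * k ] g → comp k i f ≋[ N ] comp k i g
  comp-≋ i {N = N} i<k h = upTo λ n n<N → below h (i + n * k)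
    (ℕₚ.<-≤-trans (ℕₚ.+-monoˡ-< (n * k) i<k) (ℕₚ.*-monoˡ-≤ k n<N))

  dil-cong : ∀ {f g} → f ≈ g → dil k f ≈ dil k g
  dil-cong {f} {g} h = comp-ext λ
    { zero _ → ≈-trans (comp-0-dil f) (≈-trans h (≈-sym (comp-0-dil g)))
    ; (suc i) i<k → ≈-trans (comp-suc-dil f i i<k) (≈-sym (comp-suc-dil g i i<k)) }

  dil-injective : ∀ {f g} → dil k f ≈ dil k g → f ≈ g
  dil-injective {f} {g} h = ≈-trans (≈-sym (comp-0-dil f)) (≈-trans (comp-cong 0 h) (comp-0-dil g))

  dil-· : ∀ f g → dil k (f · g) ≈ dil k f · dil k g
  dil-· f g = comp-ext λ
    { zero i<k → ≈-trans (comp-0-dil (f · g)) (≈-sym (≈-trans (comp-dil· f (dil k g) 0 i<k) (·-congˡ (comp-0-dil g))))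
    ; (suc i) i<k → ≈-trans (comp-suc-dil (f · g) i i<k)
        (≈-sym (≈-trans (comp-dil· f (dil k g) (suc i) i<k) (≈-trans (·-congˡ (comp-suc-dil g i i<k)) (·-zeroʳ f)))) }

  dil-⊕ : ∀ f g → dil k (f ⊕ g) ≈ dil k f ⊕ dil k g
  dil-⊕ f g = comp-ext λ
    { zero i<k → ≈-trans (comp-0-dil (f ⊕ g)) (≈-sym (≈-trans (comp-⊕ 0 (dil k f) (dil k g)) (⊕-cong (comp-0-dil f) (comp-0-dil g))))
    ; (suc i) i<k → ≈-trans (comp-suc-dil (f ⊕ g) i i<k)
        (≈-sym (≈-trans (comp-⊕ (suc i) (dil k f) (dil k g))
          (≈-trans (⊕-cong (comp-suc-dil f i i<k) (comp-suc-dil g i i<k)) (⊕-identityˡ 0S)))) }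

  dil-⊝ : ∀ f → dil k (⊝ f) ≈ ⊝ dil k f
  dil-⊝ f = comp-ext λ
    { zero i<k → ≈-trans (comp-0-dil (⊝ f)) (≈-sym (≈-trans (comp-⊝ 0 (dil k f)) (⊝-cong (comp-0-dil f))))
    ; (suc i) i<k → ≈-trans (comp-suc-dil (⊝ f) i i<k)
        (≈-sym (≈-trans (comp-⊝ (suc i) (dil k f)) (≈-trans (⊝-cong (comp-suc-dil f i i<k)) ⊝0S))) }

  dil-⊖ : ∀ f g → dil k (f ⊖ g) ≈ dil k f ⊖ dil k g
  dil-⊖ f g = ≈-trans (dil-⊕ f (⊝ g)) (⊕-cong ≈-refl (dil-⊝ g))

  dil-constant : ∀ z → dil k (constant z) ≈ constant z
  dil-constant z = comp-ext λ
    { zero _ → ≈-trans (comp-0-dil (constant z)) (ext λ { zero → refl ; (suc n) → refl })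
    ; (suc i) i<k → ≈-trans (comp-suc-dil (constant z) i i<k) (ext λ n → refl) }

  dil-one : dil k one ≈ one
  dil-one = ≈-trans (dil-cong one≈constant) (≈-trans (dil-constant 1ℤ) (≈-sym one≈constant))

  mono-multiples : ∀ n m → mono n m ≡ mono (n * k) (m * k)
  mono-multiples zero    zero    = refl
  mono-multiples zero    (suc m) = refl
  mono-multiples (suc n) zero    = refl
  mono-multiples (suc n) (suc m) = trans (mono-multiples n m) (sym (mono-+-+ k (n * k) (m * k)))

  mono-non-multiple : ∀ i → suc i < k → ∀ n m → mono (n * k) (suc i + m * k) ≡ 0ℤ
  mono-non-multiple i i<k zero    m       = refl
  mono-non-multiple i i<k (suc n) zero    = mono-< (k + n * k) (suc i + 0)
    (ℕₚ.<-≤-trans (subst (_< k) (sym (ℕₚ.+-identityʳ (suc i))) i<k) (ℕₚ.m≤m+n k (n * k)))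
  mono-non-multiple i i<k (suc n) (suc m) = trans (cong (mono (k + n * k)) swap)
      (trans (mono-+-+ k (n * k) (suc i + m * k)) (mono-non-multiple i i<k n m))
    where
    swap : suc i + (k + m * k) ≡ k + (suc i + m * k)
    swap = trans (sym (ℕₚ.+-assoc (suc i) k (m * k)))
      (trans (cong (ℕ._+ m * k) (ℕₚ.+-comm (suc i) k)) (ℕₚ.+-assoc k (suc i) (m * k)))

  dil-mono : ∀ n → dil k (mono n) ≈ mono (n * k)
  dil-mono n = comp-ext λ
    { zero _ → ≈-trans (comp-0-dil (mono n)) (ext (mono-multiples n))
    ; (suc i) i<k → ≈-trans (comp-suc-dil (mono n) i i<k) (ext λ m → sym (mono-non-multiple i i<k n m)) }

-- Truncated products and inverses

oneMinusQ≈ : ∀ j → oneMinusQ^ (suc j) ≈ one ⊖ mono (suc j)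
oneMinusQ≈ j = ext λ { zero → sym (⊖-coeff one (mono (suc j)) 0)
                     ; (suc n) → trans (indicator n j) (sym (⊖-coeff one (mono (suc j)) (suc n))) }
  where
  indicator : ∀ n j → (if n ≡ᵇ j then - (+ 1) else + 0) ≡ 0ℤ -ℤ mono j n
  indicator zero    zero    = refl
  indicator zero    (suc j) = refl
  indicator (suc n) zero    = refl
  indicator (suc n) (suc j) = indicator n j

oneMinusMono-small : ∀ e → one ⊖ mono e ≋[ e ] one
oneMinusMono-small e = upTo λ n n<e →
  trans (⊖-coeff one (mono e) n) (trans (cong (λ z → one n -ℤ z) (mono-< e n n<e)) (ℤₚ.+-identityʳ (one n)))

Jtrunc-suc : ∀ k M → Jtrunc (suc k) (suc M) ≈ Jtrunc (suc k) M · (one ⊖ mono (suc k * suc M))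
Jtrunc-suc k M = ≈-trans (≈-sym (·≈⋆ _ _)) (·-congˡ (oneMinusQ≈ (M + k * suc M)))

-- The factors with index beyond M are 1 + O(q^(M+1)), since the step of the exponents is at least
-- 1. So the diagonal that defines `J` agrees with every later truncated product.
Jtrunc-stable : ∀ k M d → Jtrunc (suc k) (d + M) ≋[ suc M ] Jtrunc (suc k) M
Jtrunc-stable k M zero    = ≈⇒≋ ≈-refl
Jtrunc-stable k M (suc d) = ≋-trans (≈⇒≋ (Jtrunc-suc k (d + M)))
  (≋-trans (≋-· (Jtrunc-stable k M d)
     (≋-weaken (ℕₚ.≤-trans (s≤s (ℕₚ.m≤n+m M d)) (ℕₚ.m≤m+n (suc (d + M)) _)) (oneMinusMono-small (suc k * suc (d + M)))))
  (≈⇒≋ (·-identityʳ _)))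

J-approx : ∀ k M → J (suc k) ≋[ suc M ] Jtrunc (suc k) M
J-approx k M = upTo λ n n<M →
  sym (subst (λ m → Jtrunc (suc k) m n ≡ Jtrunc (suc k) n n) (ℕₚ.m∸n+n≡m (ℕₚ.≤-pred n<M))
    (below (Jtrunc-stable k n (M ∸ n)) n ℕₚ.≤-refl))

-- The inversion of Defs is defined through private helper functions. The `with` below
-- abstracts enough subterms for unification to find the tail of its recursion:
-- inversionTail a N k j = Σ_{i ≤ k} a (j + 1 + i) · inv a (k − i).
mutual
  inversionTail : Series → ℕ → ℕ → ℕ → ℤ
  inversionTail = _

  inv-unfold : ∀ a k → inv a (suc (suc (suc k)))
    ≡ - (a 1 *ℤ inv a (suc (suc k)) +ℤ (a 2 *ℤ inv a (suc k) +ℤ inversionTail a (suc (suc k)) k 2))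
  inv-unfold a k with ℕ.suc (ℕ.suc k) | 2
  ... | N | j = refl

inversionTail-sum : ∀ a N k j → inversionTail a N k j ≡ ((λ i → a (suc j + i)) ⋆ inv a) k
inversionTail-sum a N zero    j = trans (ℤₚ.+-identityʳ _) (cong (λ m → a m *ℤ + 1) (sym (ℕₚ.+-identityʳ (suc j))))
inversionTail-sum a N (suc k) j = trans (cong₂ _+ℤ_ (cong (λ m → a m *ℤ inv a (suc k)) (sym (ℕₚ.+-identityʳ (suc j))))
    (trans (inversionTail-sum a N k (suc j))
      (sum-ext k (λ i → cong (λ m → a m *ℤ inv a (k ∸ i)) (sym (ℕₚ.+-suc (suc j) i))))))
  (sym (⋆-suc (λ i → a (suc j + i)) (inv a) k))

inv-inverse : ∀ a → a 0 ≡ 1ℤ → a · inv a ≈ one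
inv-inverse a a0 = ext λ
  { zero → trans (·-coeff a (inv a) 0) (cong (_*ℤ 1ℤ) a0)
  ; (suc n) → trans (·-suc a (inv a) n) (trans (cong₂ _+ℤ_
      (trans (cong (_*ℤ inv a (suc n)) a0) (ℤₚ.*-identityˡ (inv a (suc n))))
      (trans (·-coeff (shift a) (inv a) n) (sym (inversionTail-sum a n n 0))))
    (ℤₚ.+-inverseˡ (inversionTail a n n 0))) }

≡⇒≈ : ∀ {f g : Series} → f ≡ g → f ≈ g
≡⇒≈ refl = ≈-refl

-- Finite sums and products of series

sumS : ℕ → (ℕ → Series) → Series
sumS zero    F = F 0
sumS (suc n) F = sumS n F ⊕ F (suc n)

sumS-small : ∀ n N F → (∀ s → F (suc s) ≋[ N ] 0S) → sumS n F ≋[ N ] F 0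
sumS-small zero    N F h = ≈⇒≋ ≈-refl
sumS-small (suc n) N F h = ≋-trans (≋-⊕ (sumS-small n N F h) (h n)) (≈⇒≋ (⊕-identityʳ (F 0)))

·mono-small : ∀ e N f → N ≤ e → f · mono e ≋[ N ] 0S
·mono-small e N f N≤e = ≋-trans (≈⇒≋ (·-comm f (mono e))) (≋-weaken N≤e (mono-small e f))

triangle : ℕ → ℕ
triangle zero    = 0
triangle (suc n) = suc n + triangle n

alternating : ℕ → Series
alternating zero    = one
alternating (suc s) = ⊝ alternating s

-- ∏_{i=1}^{d} (1 − q^{c (s+i)})
segment : ℕ → ℕ → ℕ → Series
segment c s zero    = one
segment c s (suc d) = (one ⊖ mono (c * suc s)) · segment c (suc s) d

segment-snoc : ∀ c s d → segment c s (suc d) ≈ segment c s d · (one ⊖ mono (c * suc (s + d)))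
segment-snoc c s zero    = ≈-trans (·-comm _ one) (·-congˡ (≡⇒≈ (cong (λ m → one ⊖ mono (c * suc m)) (sym (ℕₚ.+-identityʳ s)))))
segment-snoc c s (suc d) = ≈-trans (·-congˡ (segment-snoc c (suc s) d))
  (≈-trans (≈-sym (·-assoc _ _ _)) (·-congˡ (≡⇒≈ (cong (λ m → one ⊖ mono (c * suc m)) (sym (ℕₚ.+-suc s d))))))

segment≈Jtrunc : ∀ c n → segment (suc c) 0 n ≈ Jtrunc (suc c) n
segment≈Jtrunc c zero    = ≈-refl
segment≈Jtrunc c (suc n) = ≈-trans (segment-snoc (suc c) 0 n)
  (≈-trans (·-congʳ (segment≈Jtrunc c n)) (≈-sym (Jtrunc-suc c n)))

-- quotient c n s = ∏_{s < i ≤ n} (1 − q^{c i}) for s ≤ n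
quotient : ℕ → ℕ → ℕ → Series
quotient c n s = segment c s (n ∸ s)

quotient-step : ∀ c n s → s < n → quotient c n s ≈ (one ⊖ mono (c * suc s)) · quotient c n (suc s)
quotient-step c (suc n) s (s≤s s≤n) rewrite ℕₚ.+-∸-assoc 1 s≤n = ≈-refl

quotient-suc : ∀ c n s → s ≤ n → quotient c (suc n) s ≈ quotient c n s · (one ⊖ mono (c * suc n))
quotient-suc c n s s≤n rewrite ℕₚ.+-∸-assoc 1 s≤n = subst
  (λ m → segment c s (suc (n ∸ s)) ≈ segment c s (n ∸ s) · (one ⊖ mono (c * suc m)))
  (ℕₚ.m+[n∸m]≡n s≤n) (segment-snoc c s (n ∸ s))

quotient-self : ∀ c n → quotient c n n ≈ one
quotient-self c n rewrite ℕₚ.n∸n≡0 n = ≈-refl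

mono-cong : ∀ {a b} → a ≡ b → mono a ≈ mono b
mono-cong refl = ≈-refl

-- Shanks' finite form of Euler's pentagonal number theorem

euler-exponent : ℕ → ℕ → ℕ
euler-exponent n s = s * n + triangle s

euler-term : ℕ → ℕ → Series
euler-term n s = alternating s · quotient 1 n s · mono (euler-exponent n s)

-- Induction on s. The old boundary term acquires the factor 1 - q^(s+1) from `quotient-step`, the
-- new summand the factor 1 - q^(n+1) from `quotient-suc`; the terms in q^(s+1) cancel, leaving the
-- summand for n and the next boundary term.
euler-telescope : ∀ n s → s ≤ n →
  sumS s (euler-term (suc n)) ≈ sumS s (euler-term n) ⊖ alternating s · quotient 1 n s · mono (euler-exponent n (suc s))
euler-telescope n zero s≤n = begin
  one · quotient 1 (suc n) 0 · mono 0
    ≈⟨ ·-cong (·-congˡ (quotient-suc 1 n 0 s≤n)) mono-0 ⟩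
  one · (quotient 1 n 0 · (one ⊖ mono (1 * suc n))) · one
    ≈⟨ decide (quotient 1 n 0 ∷ mono (1 * suc n) ∷ []) (:one :* (v0 :* (:one :- v1)) :* :one) (:one :* v0 :* :one :- :one :* v0 :* v1) refl ⟩
  one · quotient 1 n 0 · one ⊖ one · quotient 1 n 0 · mono (1 * suc n)
    ≈⟨ ⊖-cong (·-congˡ (≈-sym mono-0)) (·-congˡ (mono-cong (lemma n))) ⟩
  _ ∎
  where
  open ≈-Reasoning
  lemma : ∀ n → 1 * suc n ≡ 1 * n + 1
  lemma = ℕSolver.solve-∀
euler-telescope n (suc s) s<n = begin
  sumS s (euler-term (suc n)) ⊕ ⊝ a · quotient 1 (suc n) (suc s) · mono (euler-exponent (suc n) (suc s))
    ≈⟨ ⊕-cong (euler-telescope n s (ℕₚ.<⇒≤ s<n)) (·-cong (·-congˡ (quotient-suc 1 n (suc s) s<n))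
         (≈-trans (mono-cong (exponent₁ n s (triangle s))) (mono-+ (euler-exponent n (suc s)) (1 * suc s)))) ⟩
  (S ⊖ a · quotient 1 n s · M) ⊕ ⊝ a · (X · (one ⊖ mono (1 * suc n))) · (M · mono (1 * suc s))
    ≈⟨ ⊕-cong (⊖-cong ≈-refl (·-congʳ (·-congˡ (quotient-step 1 n s s<n)))) ≈-refl ⟩
  (S ⊖ a · ((one ⊖ mono (1 * suc s)) · X) · M) ⊕ ⊝ a · (X · (one ⊖ mono (1 * suc n))) · (M · mono (1 * suc s))
    ≈⟨ decide (S ∷ a ∷ X ∷ M ∷ mono (1 * suc s) ∷ mono (1 * suc n) ∷ [])
         ((v0 :- v1 :* ((:one :- v4) :* v2) :* v3) :+ :- v1 :* (v2 :* (:one :- v5)) :* (v3 :* v4))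
         (v0 :+ :- v1 :* v2 :* v3 :- :- v1 :* v2 :* (v3 :* (v4 :* v5))) refl ⟩
  S ⊕ ⊝ a · X · M ⊖ ⊝ a · X · (M · (mono (1 * suc s) · mono (1 * suc n)))
    ≈⟨ ⊖-cong ≈-refl (·-congˡ (≈-sym (≈-trans (mono-cong (exponent₂ n s (triangle s)))
         (≈-trans (mono-+ (euler-exponent n (suc s)) _) (·-congˡ (mono-+ (1 * suc s) (1 * suc n))))))) ⟩
  _ ∎
  where
  open ≈-Reasoning
  S a X M : Series
  S = sumS s (euler-term n)
  a = alternating s
  X = quotient 1 n (suc s)
  M = mono (euler-exponent n (suc s))
  exponent₁ : ∀ n s t → suc s * suc n + (suc s + t) ≡ suc s * n + (suc s + t) + 1 * suc s
  exponent₁ = ℕSolver.solve-∀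
  exponent₂ : ∀ n s t → suc (suc s) * n + (suc (suc s) + (suc s + t))
    ≡ suc s * n + (suc s + t) + (1 * suc s + 1 * suc n)
  exponent₂ = ℕSolver.solve-∀

-- n² + n(n+1)/2 = n(3n+1)/2 and n² + n(n-1)/2 = n(3n-1)/2 are the pentagonal exponents, written
-- without halving.
pentagonal-partial : ℕ → Series
pentagonal-partial zero    = one
pentagonal-partial (suc n) = pentagonal-partial n
  ⊕ alternating (suc n) · (mono (suc n * suc n + triangle (suc n)) ⊕ mono (suc n * suc n + triangle n))

-- For s = n the quotients are 1. The boundary term of the telescope and the topmost summand supply
-- the two pentagonal exponents of index n + 1.
euler-finite : ∀ n → sumS n (euler-term n) ≈ pentagonal-partial n
euler-finite zero    = ≈-trans (·-cong (·-identityˡ one) mono-0) (·-identityˡ one)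
euler-finite (suc n) = begin
  sumS n (euler-term (suc n)) ⊕ ⊝ a · quotient 1 (suc n) (suc n) · M
    ≈⟨ ⊕-cong (≈-trans (euler-telescope n n ℕₚ.≤-refl) (⊖-cong (euler-finite n) (·-cong (·-congˡ (quotient-self 1 n)) (mono-cong (lemma n (triangle n))))))
         (·-congʳ (·-congˡ (quotient-self 1 (suc n)))) ⟩
  (S ⊖ a · one · M') ⊕ ⊝ a · one · M
    ≈⟨ decide (S ∷ a ∷ M ∷ M' ∷ []) ((v0 :- v1 :* :one :* v3) :+ :- v1 :* :one :* v2) (v0 :+ :- v1 :* (v2 :+ v3)) refl ⟩
  _ ∎
  where
  open ≈-Reasoning
  S a M M' : Series
  S = pentagonal-partial n
  a = alternating n
  M = mono (suc n * suc n + triangle (suc n))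
  M' = mono (suc n * suc n + triangle n)
  lemma : ∀ n t → suc n * n + (suc n + t) ≡ suc n * suc n + t
  lemma = ℕSolver.solve-∀

-- Below q^(n+1) only the summand s = 0 is visible in the finite identity, and it is the truncated
-- product.
J1-pentagonal : ∀ n → J 1 ≋[ suc n ] pentagonal-partial n
J1-pentagonal n = ≋-trans (J-approx 0 n) (≋-trans (≈⇒≋ (≈-sym (segment≈Jtrunc 0 n)))
  (≋-trans (≋-sym (≋-trans (sumS-small n (suc n) (euler-term n) small)
     (≈⇒≋ (≈-trans (·-cong (·-identityˡ _) mono-0) (·-identityʳ _)))))
  (≈⇒≋ (euler-finite n))))
  where
  small : ∀ s → euler-term n (suc s) ≋[ suc n ] 0S
  small s = ·mono-small (euler-exponent n (suc s)) (suc n) _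
    (ℕₚ.≤-trans (ℕₚ.≤-reflexive (sym (ℕₚ.+-comm n 1))) (ℕₚ.+-mono-≤ (ℕₚ.m≤m+n n (s * n)) (s≤s z≤n)))

-- Shanks' finite form of Gauss' theorem on triangular numbers

oddProduct : ℕ → Series
oddProduct zero    = one
oddProduct (suc s) = oddProduct s · (one ⊖ mono (suc (2 * s)))

gauss-term : ℕ → ℕ → Series
gauss-term n s = quotient 2 n s · oddProduct s · mono (s * suc (2 * n))

gauss-telescope : ∀ n s → s ≤ n →
  sumS s (gauss-term (suc n)) ≈ (one ⊖ mono (suc (2 * n))) · sumS s (gauss-term n)
    ⊕ quotient 2 n s · oddProduct (suc s) · mono (suc s * suc (2 * n))
gauss-telescope n zero s≤n = begin
  quotient 2 (suc n) 0 · one · mono 0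
    ≈⟨ ·-cong (·-congʳ (quotient-suc 2 n 0 s≤n)) mono-0 ⟩
  quotient 2 n 0 · (one ⊖ mono (2 * suc n)) · one · one
    ≈⟨ ·-congʳ (·-congʳ (·-congˡ (⊖-cong ≈-refl (≈-trans (mono-cong (lemma n)) (mono-+ 1 (suc (2 * n))))))) ⟩
  Q · (one ⊖ mono 1 · x) · one · one
    ≈⟨ decide (Q ∷ x ∷ mono 1 ∷ []) (v0 :* (:one :- v2 :* v1) :* :one :* :one)
         ((:one :- v1) :* (v0 :* :one :* :one) :+ v0 :* (:one :* (:one :- v2)) :* v1) refl ⟩
  (one ⊖ x) · (Q · one · one) ⊕ Q · (one · (one ⊖ mono 1)) · x
    ≈⟨ ⊕-cong (·-congˡ (·-congˡ (≈-sym mono-0))) (·-congˡ (mono-cong {suc (2 * n)} {1 * suc (2 * n)} (sym (ℕₚ.+-identityʳ (suc (2 * n)))))) ⟩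
  _ ∎
  where
  open ≈-Reasoning
  Q x : Series
  Q = quotient 2 n 0
  x = mono (suc (2 * n))
  lemma : ∀ n → 2 * suc n ≡ 1 + suc (2 * n)
  lemma = ℕSolver.solve-∀
gauss-telescope n (suc s) s<n = begin
  sumS s (gauss-term (suc n)) ⊕ quotient 2 (suc n) (suc s) · oddProduct (suc s) · mono (suc s * suc (2 * suc n))
    ≈⟨ ⊕-cong (gauss-telescope n s (ℕₚ.<⇒≤ s<n)) (·-cong (·-congʳ (quotient-suc 2 n (suc s) s<n))
         (≈-trans (mono-cong (exponent₁ n s)) (mono-+ (suc s * suc (2 * n)) (2 * suc s)))) ⟩
  ((one ⊖ x) · S ⊕ quotient 2 n s · O · M) ⊕ X · (one ⊖ mono (2 * suc n)) · O · (M · u)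
    ≈⟨ ⊕-cong (⊕-cong ≈-refl (·-congʳ (·-congʳ (quotient-step 2 n s s<n))))
         (·-congʳ (·-congʳ (·-congˡ (⊖-cong ≈-refl (≈-trans (mono-cong (exponent₂ n)) (mono-+ 1 (suc (2 * n)))))))) ⟩
  ((one ⊖ x) · S ⊕ (one ⊖ u) · X · O · M) ⊕ X · (one ⊖ mono 1 · x) · O · (M · u)
    ≈⟨ decide (S ∷ X ∷ O ∷ M ∷ u ∷ x ∷ mono 1 ∷ [])
         (((:one :- v5) :* v0 :+ (:one :- v4) :* v1 :* v2 :* v3) :+ v1 :* (:one :- v6 :* v5) :* v2 :* (v3 :* v4))
         ((:one :- v5) :* (v0 :+ v1 :* v2 :* v3) :+ v1 :* (v2 :* (:one :- v6 :* v4)) :* (v5 :* v3)) refl ⟩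
  (one ⊖ x) · (S ⊕ X · O · M) ⊕ X · (O · (one ⊖ mono 1 · u)) · (x · M)
    ≈⟨ ⊕-cong ≈-refl (·-cong (·-congˡ (·-congˡ (⊖-cong ≈-refl (≈-sym (mono-+ 1 (2 * suc s))))))
         (≈-sym (mono-+ (suc (2 * n)) (suc s * suc (2 * n))))) ⟩
  _ ∎
  where
  open ≈-Reasoning
  S O X M u x : Series
  S = sumS s (gauss-term n)
  O = oddProduct (suc s)
  X = quotient 2 n (suc s)
  M = mono (suc s * suc (2 * n))
  u = mono (2 * suc s)
  x = mono (suc (2 * n))
  exponent₁ : ∀ n s → suc s * suc (2 * suc n) ≡ suc s * suc (2 * n) + 2 * suc s
  exponent₁ = ℕSolver.solve-∀
  exponent₂ : ∀ n → 2 * suc n ≡ 1 + suc (2 * n)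
  exponent₂ = ℕSolver.solve-∀

gauss-partial : ℕ → Series
gauss-partial zero    = one
gauss-partial (suc n) = gauss-partial n
  ⊕ (mono (suc n * suc (2 * suc n)) ⊕ mono (suc n * suc (2 * n)))

-- Shanks' identity multiplied by the product of 1 - q^(2i-1) over i ≤ n, which clears its
-- denominators. The factor 1 - q^(2n+1) in `gauss-telescope` is the growth of that product.
gauss-finite : ∀ n → sumS n (gauss-term n) ≈ oddProduct n · gauss-partial n
gauss-finite zero    = ·-cong (·-identityˡ one) mono-0
gauss-finite (suc n) = begin
  sumS n (gauss-term (suc n)) ⊕ quotient 2 (suc n) (suc n) · oddProduct (suc n) · M
    ≈⟨ ⊕-cong (≈-trans (gauss-telescope n n ℕₚ.≤-refl) (⊕-cong (·-congˡ (gauss-finite n)) (·-congʳ (·-congʳ (quotient-self 2 n)))))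
         (·-congʳ (·-congʳ (quotient-self 2 (suc n)))) ⟩
  ((one ⊖ x) · (O · S) ⊕ one · (O · (one ⊖ x)) · M') ⊕ one · (O · (one ⊖ x)) · M
    ≈⟨ decide (S ∷ O ∷ x ∷ M ∷ M' ∷ [])
         (((:one :- v2) :* (v1 :* v0) :+ :one :* (v1 :* (:one :- v2)) :* v4) :+ :one :* (v1 :* (:one :- v2)) :* v3)
         (v1 :* (:one :- v2) :* (v0 :+ (v3 :+ v4))) refl ⟩
  _ ∎
  where
  open ≈-Reasoning
  S O x M M' : Series
  S = gauss-partial n
  O = oddProduct n
  x = mono (suc (2 * n))
  M = mono (suc n * suc (2 * suc n))
  M' = mono (suc n * suc (2 * n))

evenProduct : ∀ n → oddProduct n · segment 2 0 n ≈ Jtrunc 1 (2 * n)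
evenProduct zero    = ·-identityˡ one
evenProduct (suc n) = begin
  oddProduct n · (one ⊖ mono (suc (2 * n))) · segment 2 0 (suc n)
    ≈⟨ ·-congˡ (≈-trans (segment-snoc 2 0 n) (·-congˡ (⊖-cong ≈-refl (mono-cong (lemma n))))) ⟩
  oddProduct n · (one ⊖ mono (suc (2 * n))) · (segment 2 0 n · (one ⊖ mono (suc (suc (2 * n)))))
    ≈⟨ decide (oddProduct n ∷ segment 2 0 n ∷ mono (suc (2 * n)) ∷ mono (suc (suc (2 * n))) ∷ [])
         (v0 :* (:one :- v2) :* (v1 :* (:one :- v3))) (v0 :* v1 :* (:one :- v2) :* (:one :- v3)) refl ⟩
  oddProduct n · segment 2 0 n · (one ⊖ mono (suc (2 * n))) · (one ⊖ mono (suc (suc (2 * n))))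
    ≈⟨ ·-cong (·-cong (evenProduct n) (⊖-cong ≈-refl (mono-cong {suc (2 * n)} {1 * suc (2 * n)} (sym (ℕₚ.*-identityˡ (suc (2 * n)))))))
         (⊖-cong ≈-refl (mono-cong {suc (suc (2 * n))} {1 * suc (suc (2 * n))} (sym (ℕₚ.*-identityˡ (suc (suc (2 * n))))))) ⟩
  Jtrunc 1 (2 * n) · (one ⊖ mono (1 * suc (2 * n))) · (one ⊖ mono (1 * suc (suc (2 * n))))
    ≈⟨ ≈-sym (≈-trans (Jtrunc-suc 0 (suc (2 * n))) (·-congʳ (Jtrunc-suc 0 (2 * n)))) ⟩
  Jtrunc 1 (suc (suc (2 * n)))
    ≈⟨ subst (λ m → Jtrunc 1 (suc (suc (2 * n))) ≈ Jtrunc 1 m) (sym (lemma n)) ≈-refl ⟩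
  _ ∎
  where
  open ≈-Reasoning
  lemma : ∀ n → 2 * suc n ≡ suc (suc (2 * n))
  lemma = ℕSolver.solve-∀

-- Write J₁ as O E with odd and even exponents separated. The finite identity turns O times the
-- partial sum into E modulo q^(n+1), so the left side becomes E², and E approximates J₂.
gauss-approx : ∀ n → J 1 · gauss-partial n ≋[ suc n ] J 2 · J 2
gauss-approx n =
  ≋-trans (≋-· (≋-trans (≋-weaken (s≤s (ℕₚ.m≤m+n n _)) (J-approx 0 (2 * n))) (≈⇒≋ (≈-sym (evenProduct n)))) (≈⇒≋ ≈-refl))
  (≋-trans (≈⇒≋ (decide (O ∷ E ∷ gauss-partial n ∷ []) (v0 :* v1 :* v2) (v0 :* v2 :* v1) refl))
  (≋-trans (≋-· (≋-trans (≈⇒≋ (≈-sym (gauss-finite n)))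
      (≋-trans (sumS-small n (suc n) (gauss-term n) small) (≈⇒≋ (≈-trans (·-cong (·-identityʳ _) mono-0) (·-identityʳ _)))))
      (≈⇒≋ ≈-refl))
  (≋-trans (≈⇒≋ (·-cong (segment≈Jtrunc 1 n) (segment≈Jtrunc 1 n)))
  (≋-sym (≋-· (J-approx 1 n) (J-approx 1 n))))))
  where
  O E : Series
  O = oddProduct n
  E = segment 2 0 n
  small : ∀ s → gauss-term n (suc s) ≋[ suc n ] 0S
  small s = ·mono-small (suc s * suc (2 * n)) (suc n) _
    (ℕₚ.≤-trans (s≤s (ℕₚ.m≤m+n n _)) (ℕₚ.m≤m+n (suc (2 * n)) _))

-- Sums over ℤ of finitely supported functions

zsum : ℕ → (ℤ → ℤ) → ℤ
zsum zero    f = f 0ℤ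
zsum (suc n) f = zsum n f +ℤ (f (+ suc n) +ℤ f -[1+ n ])

zsum-cong : ∀ n {f g : ℤ → ℤ} → (∀ m → f m ≡ g m) → zsum n f ≡ zsum n g
zsum-cong zero    h = h 0ℤ
zsum-cong (suc n) h = cong₂ _+ℤ_ (zsum-cong n h) (cong₂ _+ℤ_ (h _) (h _))

zsum-0 : ∀ n → zsum n (λ _ → 0ℤ) ≡ 0ℤ
zsum-0 zero    = refl
zsum-0 (suc n) = cong (_+ℤ 0ℤ) (zsum-0 n)

zsum-+ : ∀ n (f g : ℤ → ℤ) → zsum n (λ m → f m +ℤ g m) ≡ zsum n f +ℤ zsum n g
zsum-+ zero    f g = refl
zsum-+ (suc n) f g = trans (cong (_+ℤ (f (+ suc n) +ℤ g (+ suc n) +ℤ (f -[1+ n ] +ℤ g -[1+ n ]))) (zsum-+ n f g))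
  (lemma (zsum n f) (zsum n g) (f (+ suc n)) (g (+ suc n)) (f -[1+ n ]) (g -[1+ n ]))
  where
  lemma : ∀ a b c d e h → a +ℤ b +ℤ (c +ℤ d +ℤ (e +ℤ h)) ≡ a +ℤ (c +ℤ e) +ℤ (b +ℤ (d +ℤ h))
  lemma = solve-∀

zsum-* : ∀ n c (f : ℤ → ℤ) → zsum n (λ m → c *ℤ f m) ≡ c *ℤ zsum n f
zsum-* zero    c f = refl
zsum-* (suc n) c f = trans (cong (_+ℤ (c *ℤ f (+ suc n) +ℤ c *ℤ f -[1+ n ])) (zsum-* n c f))
  (lemma c (zsum n f) (f (+ suc n)) (f -[1+ n ]))
  where
  lemma : ∀ c x y z → c *ℤ x +ℤ (c *ℤ y +ℤ c *ℤ z) ≡ c *ℤ (x +ℤ (y +ℤ z))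
  lemma = solve-∀

zsum-swap : ∀ n m (f : ℤ → ℤ → ℤ) → zsum n (λ u → zsum m (f u)) ≡ zsum m (λ v → zsum n (λ u → f u v))
zsum-swap zero    m f = refl
zsum-swap (suc n) m f = trans (cong₂ _+ℤ_ (zsum-swap n m f) (sym (zsum-+ m _ _))) (sym (zsum-+ m _ _))

zsum-negate : ∀ n (f : ℤ → ℤ) → zsum n (λ m → f (- m)) ≡ zsum n f
zsum-negate zero    f = refl
zsum-negate (suc n) f = cong₂ _+ℤ_ (zsum-negate n f) (ℤₚ.+-comm (f -[1+ n ]) (f (+ suc n)))

zsum-extend : ∀ B f → (∀ m → B < ∣ m ∣ → f m ≡ 0ℤ) → ∀ d → zsum (d + B) f ≡ zsum B f
zsum-extend B f h zero    = refl
zsum-extend B f h (suc d) = trans (cong₂ _+ℤ_ (zsum-extend B f h d)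
  (cong₂ _+ℤ_ (h (+ suc (d + B)) (s≤s (ℕₚ.m≤n+m B d))) (h -[1+ d + B ] (s≤s (ℕₚ.m≤n+m B d))))) (ℤₚ.+-identityʳ _)

-- Translation loses the value at -n and gains the one at n + 1.
zsum-shift : ∀ n (f : ℤ → ℤ) → zsum n (λ m → f (m +ℤ 1ℤ)) +ℤ f (- (+ n)) ≡ zsum n f +ℤ f (+ suc n)
zsum-shift zero    f = ℤₚ.+-comm (f 1ℤ) (f 0ℤ)
zsum-shift (suc n) f = begin
  zsum n g +ℤ (f (+ suc n +ℤ 1ℤ) +ℤ f (-[1+ n ] +ℤ 1ℤ)) +ℤ f -[1+ n ]
    ≡⟨ cong₂ (λ x y → zsum n g +ℤ (f x +ℤ f y) +ℤ f -[1+ n ]) (cong +_ (ℕₚ.+-comm (suc n) 1)) (neg n) ⟩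
  zsum n g +ℤ (f (+ suc (suc n)) +ℤ f (- (+ n))) +ℤ f -[1+ n ]
    ≡⟨ lemma₁ (zsum n g) (f (+ suc (suc n))) (f (- (+ n))) (f -[1+ n ]) ⟩
  zsum n g +ℤ f (- (+ n)) +ℤ f (+ suc (suc n)) +ℤ f -[1+ n ]
    ≡⟨ cong (λ x → x +ℤ f (+ suc (suc n)) +ℤ f -[1+ n ]) (zsum-shift n f) ⟩
  zsum n f +ℤ f (+ suc n) +ℤ f (+ suc (suc n)) +ℤ f -[1+ n ]
    ≡⟨ lemma₂ (zsum n f) (f (+ suc n)) (f (+ suc (suc n))) (f -[1+ n ]) ⟩
  zsum n f +ℤ (f (+ suc n) +ℤ f -[1+ n ]) +ℤ f (+ suc (suc n)) ∎
  where
  open ≡-Reasoning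
  g : ℤ → ℤ
  g m = f (m +ℤ 1ℤ)
  neg : ∀ n → -[1+ n ] +ℤ 1ℤ ≡ - (+ n)
  neg zero    = refl
  neg (suc n) = refl
  lemma₁ : ∀ a b c d → a +ℤ (b +ℤ c) +ℤ d ≡ a +ℤ c +ℤ b +ℤ d
  lemma₁ = solve-∀
  lemma₂ : ∀ a b c d → a +ℤ b +ℤ c +ℤ d ≡ a +ℤ (b +ℤ d) +ℤ c
  lemma₂ = solve-∀

-- The support bound is carried along, so that two evaluations of the same sum can be compared on a
-- common range; this yields `HasSum-unique`, the way in which coefficient identities are concluded.
record HasSum (f : ℤ → ℤ) (s : ℤ) : Set where
  constructor hasSum
  field
    bound  : ℕ
    vanish : ∀ m → bound < ∣ m ∣ → f m ≡ 0ℤ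
    total  : zsum bound f ≡ s
open HasSum

HasSum-at : ∀ {f s} (h : HasSum f s) n → bound h ≤ n → zsum n f ≡ s
HasSum-at {f} h n b≤n = trans (cong (λ k → zsum k f) (sym (ℕₚ.m∸n+n≡m b≤n)))
  (trans (zsum-extend (bound h) f (vanish h) (n ∸ bound h)) (total h))

HasSum-unique : ∀ {f s t} → HasSum f s → HasSum f t → s ≡ t
HasSum-unique h k = trans (sym (HasSum-at h (bound h + bound k) (ℕₚ.m≤m+n _ _)))
  (HasSum-at k (bound h + bound k) (ℕₚ.m≤n+m _ _))

HasSum-cong : ∀ {f g s} → (∀ m → f m ≡ g m) → HasSum f s → HasSum g s
HasSum-cong e (hasSum B v t) = hasSum B (λ m B<m → trans (sym (e m)) (v m B<m)) (trans (sym (zsum-cong B e)) t)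

HasSum-+ : ∀ {f g s t} → HasSum f s → HasSum g t → HasSum (λ m → f m +ℤ g m) (s +ℤ t)
HasSum-+ {f} {g} h k = hasSum (bound h + bound k)
  (λ m b<m → cong₂ _+ℤ_ (vanish h m (ℕₚ.≤-<-trans (ℕₚ.m≤m+n _ _) b<m)) (vanish k m (ℕₚ.≤-<-trans (ℕₚ.m≤n+m _ _) b<m)))
  (trans (zsum-+ (bound h + bound k) f g)
    (cong₂ _+ℤ_ (HasSum-at h (bound h + bound k) (ℕₚ.m≤m+n _ _)) (HasSum-at k (bound h + bound k) (ℕₚ.m≤n+m _ _))))

HasSum-* : ∀ c {f s} → HasSum f s → HasSum (λ m → c *ℤ f m) (c *ℤ s)
HasSum-* c (hasSum B v t) = hasSum B (λ m B<m → trans (cong (c *ℤ_) (v m B<m)) (ℤₚ.*-zeroʳ c))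
  (trans (zsum-* B c _) (cong (c *ℤ_) t))

HasSum-0 : HasSum (λ _ → 0ℤ) 0ℤ
HasSum-0 = hasSum 0 (λ _ _ → refl) refl

HasSum-sumTo : ∀ n {F : ℕ → ℤ → ℤ} {S : ℕ → ℤ} → (∀ i → HasSum (F i) (S i)) → HasSum (λ m → sumTo n (λ i → F i m)) (sumTo n S)
HasSum-sumTo zero    h = h 0
HasSum-sumTo (suc n) h = HasSum-+ (HasSum-sumTo n h) (h (suc n))

HasSum-negate : ∀ {f s} → HasSum f s → HasSum (λ m → f (- m)) s
HasSum-negate {f} (hasSum B v t) = hasSum B (λ m B<m → v (- m) (subst (B <_) (sym (ℤₚ.∣-i∣≡∣i∣ m)) B<m)) (trans (zsum-negate B f) t)

HasSum-shift₁ : ∀ {f s} → HasSum f s → HasSum (λ m → f (m +ℤ 1ℤ)) s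
HasSum-shift₁ {f} {s} h = hasSum (suc (bound h)) vanish' total'
  where
  B : ℕ
  B = bound h
  vanish' : ∀ m → suc B < ∣ m ∣ → f (m +ℤ 1ℤ) ≡ 0ℤ
  vanish' m sB<m = vanish h (m +ℤ 1ℤ) (ℕₚ.≤-pred (ℕₚ.≤-trans sB<m m≤))
    where
    m≤ : ∣ m ∣ ≤ suc ∣ m +ℤ 1ℤ ∣
    m≤ = subst₂ _≤_ (cong ∣_∣ (cancel m)) (ℕₚ.+-comm ∣ m +ℤ 1ℤ ∣ 1) (ℤₚ.∣i-j∣≤∣i∣+∣j∣ (m +ℤ 1ℤ) 1ℤ)
      where
      cancel : ∀ m → m +ℤ 1ℤ -ℤ 1ℤ ≡ m
      cancel = solve-∀
  total' : zsum (suc B) (λ m → f (m +ℤ 1ℤ)) ≡ s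
  total' = begin
    zsum (suc B) (λ m → f (m +ℤ 1ℤ))
      ≡⟨ sym (ℤₚ.+-identityʳ _) ⟩
    zsum (suc B) (λ m → f (m +ℤ 1ℤ)) +ℤ 0ℤ
      ≡⟨ cong (zsum (suc B) (λ m → f (m +ℤ 1ℤ)) +ℤ_) (sym (vanish h -[1+ B ] ℕₚ.≤-refl)) ⟩
    zsum (suc B) (λ m → f (m +ℤ 1ℤ)) +ℤ f (- (+ suc B))
      ≡⟨ zsum-shift (suc B) f ⟩
    zsum (suc B) f +ℤ f (+ suc (suc B))
      ≡⟨ cong₂ _+ℤ_ (HasSum-at h (suc B) (ℕₚ.n≤1+n B)) (vanish h (+ suc (suc B)) (s≤s (ℕₚ.n≤1+n B))) ⟩
    s +ℤ 0ℤ
      ≡⟨ ℤₚ.+-identityʳ s ⟩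
    s ∎
    where open ≡-Reasoning

HasSum-shift⁺ : ∀ {f s} n → HasSum f s → HasSum (λ m → f (m +ℤ + n)) s
HasSum-shift⁺ {f} zero    h = HasSum-cong (λ m → cong f (sym (ℤₚ.+-identityʳ m))) h
HasSum-shift⁺ {f} (suc n) h = HasSum-cong (λ m → cong f (lemma m (+ n))) (HasSum-shift₁ (HasSum-shift⁺ n h))
  where
  lemma : ∀ m n → m +ℤ 1ℤ +ℤ n ≡ m +ℤ (1ℤ +ℤ n)
  lemma = solve-∀

HasSum-shift : ∀ {f s} c → HasSum f s → HasSum (λ m → f (m +ℤ c)) s
HasSum-shift (+ n)          h = HasSum-shift⁺ n h
HasSum-shift {f} (-[1+ n ]) h =
  HasSum-cong (λ m → cong f (lemma m (+ suc n)))
    (HasSum-negate (HasSum-shift⁺ (suc n) (HasSum-negate h)))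
  where
  lemma : ∀ m c → - (- m +ℤ c) ≡ m +ℤ - c
  lemma = solve-∀

part : (ℤ → ℤ) → ℤ → ℤ → ℤ
part f i w = f (w *ℤ + 5 +ℤ i)

-- With residues -2, ..., 2 the range of absolute values up to 5n + 2 splits into exactly five
-- copies of the range up to n, and all ranges stay symmetric.
zsum-parts : ∀ n f → zsum (2 + n * 5) f ≡
  zsum n (part f (- (+ 2))) +ℤ zsum n (part f (- (+ 1))) +ℤ zsum n (part f 0ℤ) +ℤ zsum n (part f 1ℤ) +ℤ zsum n (part f (+ 2))
zsum-parts zero    f = lemma (f 0ℤ) (f 1ℤ) (f (- (+ 1))) (f (+ 2)) (f (- (+ 2)))
  where
  lemma : ∀ a b c d e → a +ℤ (b +ℤ c) +ℤ (d +ℤ e) ≡ e +ℤ c +ℤ a +ℤ b +ℤ d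
  lemma = solve-∀
zsum-parts (suc n) f rewrite zsum-parts n f = trans
  (lemma (zsum n (part f (- (+ 2)))) (zsum n (part f (- (+ 1)))) (zsum n (part f 0ℤ)) (zsum n (part f 1ℤ)) (zsum n (part f (+ 2)))
     (f (+ (3 + n * 5))) (f -[1+ 2 + n * 5 ]) (f (+ (4 + n * 5))) (f -[1+ 3 + n * 5 ])
     (f (+ (5 + n * 5))) (f -[1+ 4 + n * 5 ]) (f (+ (6 + n * 5))) (f -[1+ 5 + n * 5 ]) (f (+ (7 + n * 5))) (f -[1+ 6 + n * 5 ]))
  (cong₂ _+ℤ_ (cong₂ _+ℤ_ (cong₂ _+ℤ_ (cong₂ _+ℤ_
     (cong (zsum n (part f (- (+ 2))) +ℤ_) (cong₂ _+ℤ_ (cong f pos₋₂) (cong f neg₋₂)))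
     (cong (zsum n (part f (- (+ 1))) +ℤ_) (cong₂ _+ℤ_ (cong f pos₋₁) (cong f neg₋₁))))
     (cong (zsum n (part f 0ℤ) +ℤ_) (cong₂ _+ℤ_ (cong f pos₀) (cong f neg₀))))
     (cong (zsum n (part f 1ℤ) +ℤ_) (cong₂ _+ℤ_ (cong f pos₁) (cong f neg₁))))
     (cong (zsum n (part f (+ 2)) +ℤ_) (cong₂ _+ℤ_ (cong f pos₂) (cong f neg₂))))
  where
  lemma : ∀ A B C D E a a' b b' c c' d d' e e' →
    A +ℤ B +ℤ C +ℤ D +ℤ E +ℤ (a +ℤ a') +ℤ (b +ℤ b') +ℤ (c +ℤ c') +ℤ (d +ℤ d') +ℤ (e +ℤ e')
    ≡ A +ℤ (a +ℤ e') +ℤ (B +ℤ (b +ℤ d')) +ℤ (C +ℤ (c +ℤ c')) +ℤ (D +ℤ (d +ℤ b')) +ℤ (E +ℤ (e +ℤ a'))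
  lemma = solve-∀
  at⁺ : ∀ i → + (5 + n * 5) +ℤ i ≡ + suc n *ℤ + 5 +ℤ i
  at⁺ i = cong (_+ℤ i) (ℤₚ.pos-* (suc n) 5)
  pos₋₂ : + (3 + n * 5) ≡ + suc n *ℤ + 5 +ℤ - (+ 2)
  pos₋₂ = at⁺ (- (+ 2))
  pos₋₁ : + (4 + n * 5) ≡ + suc n *ℤ + 5 +ℤ - (+ 1)
  pos₋₁ = at⁺ (- (+ 1))
  pos₀ : + (5 + n * 5) ≡ + suc n *ℤ + 5 +ℤ 0ℤ
  pos₀ = trans (sym (ℤₚ.+-identityʳ _)) (at⁺ 0ℤ)
  pos₁ : + (6 + n * 5) ≡ + suc n *ℤ + 5 +ℤ 1ℤ
  pos₁ = trans (cong +_ (ℕₚ.+-comm 1 (5 + n * 5))) (at⁺ 1ℤ)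
  pos₂ : + (7 + n * 5) ≡ + suc n *ℤ + 5 +ℤ + 2
  pos₂ = trans (cong +_ (ℕₚ.+-comm 2 (5 + n * 5))) (at⁺ (+ 2))
  flipSign : ∀ i → - (+ suc n *ℤ + 5 +ℤ i) ≡ -[1+ n ] *ℤ + 5 +ℤ - i
  flipSign i = lemma' (+ suc n) i
    where
    lemma' : ∀ x i → - (x *ℤ + 5 +ℤ i) ≡ (- x) *ℤ + 5 +ℤ - i
    lemma' = solve-∀
  neg₋₂ : -[1+ 6 + n * 5 ] ≡ -[1+ n ] *ℤ + 5 +ℤ - (+ 2)
  neg₋₂ = trans (cong -_ pos₂) (flipSign (+ 2))
  neg₋₁ : -[1+ 5 + n * 5 ] ≡ -[1+ n ] *ℤ + 5 +ℤ - (+ 1)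
  neg₋₁ = trans (cong -_ pos₁) (flipSign 1ℤ)
  neg₀ : -[1+ 4 + n * 5 ] ≡ -[1+ n ] *ℤ + 5 +ℤ 0ℤ
  neg₀ = trans (cong -_ pos₀) (flipSign 0ℤ)
  neg₁ : -[1+ 3 + n * 5 ] ≡ -[1+ n ] *ℤ + 5 +ℤ 1ℤ
  neg₁ = trans (cong -_ pos₋₁) (flipSign (- (+ 1)))
  neg₂ : -[1+ 2 + n * 5 ] ≡ -[1+ n ] *ℤ + 5 +ℤ + 2
  neg₂ = trans (cong -_ pos₋₂) (flipSign (- (+ 2)))

-- For w ≠ 0 one has |5w + i| ≥ 5|w| - 2 ≥ |w|, so the support bound of f also serves its parts.
HasSum-part : ∀ {f s} (h : HasSum f s) i → ∣ i ∣ ≤ 2 → HasSum (part f i) (zsum (bound h) (part f i))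
HasSum-part {f} h i i≤2 = hasSum (bound h) (λ m b<m → vanish h _ (ℕₚ.<-≤-trans b<m (large m (ℕₚ.≤-trans (s≤s z≤n) b<m)))) refl
  where
  large : ∀ m → 1 ≤ ∣ m ∣ → ∣ m ∣ ≤ ∣ m *ℤ + 5 +ℤ i ∣
  large m 1≤m = ℕₚ.+-cancelʳ-≤ 2 ∣ m ∣ _ (ℕₚ.≤-trans (ℕₚ.+-monoʳ-≤ ∣ m ∣ (ℕₚ.*-monoʳ-≤ 2 1≤m))
    (ℕₚ.≤-trans (ℕₚ.≤-trans (ℕₚ.≤-reflexive (cong (∣ m ∣ ℕ.+_) refl)) (ℕₚ.≤-trans (ℕₚ.*-monoˡ-≤ ∣ m ∣ {3} {5} (s≤s (s≤s (s≤s z≤n))))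
      (ℕₚ.≤-reflexive (trans (ℕₚ.*-comm 5 ∣ m ∣) (sym (ℤₚ.∣i*j∣≡∣i∣*∣j∣ m (+ 5)))))))
    (ℕₚ.≤-trans (subst (_≤ ∣ m *ℤ + 5 +ℤ i ∣ + ∣ i ∣) (cong ∣_∣ (cancel m i)) (ℤₚ.∣i-j∣≤∣i∣+∣j∣ (m *ℤ + 5 +ℤ i) i))
      (ℕₚ.+-monoʳ-≤ _ i≤2))))
    where
    cancel : ∀ m i → m *ℤ + 5 +ℤ i -ℤ i ≡ m *ℤ + 5
    cancel = solve-∀

HasSum-parts : ∀ {f s s₋₂ s₋₁ s₀ s₁ s₂} → HasSum f s →
  HasSum (part f (- (+ 2))) s₋₂ → HasSum (part f (- (+ 1))) s₋₁ → HasSum (part f 0ℤ) s₀ →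
  HasSum (part f 1ℤ) s₁ → HasSum (part f (+ 2)) s₂ → s ≡ s₋₂ +ℤ s₋₁ +ℤ s₀ +ℤ s₁ +ℤ s₂
HasSum-parts {f} h h₋₂ h₋₁ h₀ h₁ h₂ = trans (sym (HasSum-at h (2 + B * 5) (ℕₚ.m≤n⇒m≤o+n 2 (ℕₚ.≤-trans (ℕₚ.m≤m+n _ _) (ℕₚ.m≤m*n B 5)))))
  (trans (zsum-parts B f) (cong₂ _+ℤ_ (cong₂ _+ℤ_ (cong₂ _+ℤ_ (cong₂ _+ℤ_
    (HasSum-at h₋₂ B (ℕₚ.m≤n⇒m≤o+n b (ℕₚ.m≤m+n _ _)))
    (HasSum-at h₋₁ B (ℕₚ.m≤n⇒m≤o+n b (ℕₚ.m≤n⇒m≤o+n b₋₂ (ℕₚ.m≤m+n _ _)))))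
    (HasSum-at h₀ B (ℕₚ.m≤n⇒m≤o+n b (ℕₚ.m≤n⇒m≤o+n b₋₂ (ℕₚ.m≤n⇒m≤o+n b₋₁ (ℕₚ.m≤m+n _ _))))))
    (HasSum-at h₁ B (ℕₚ.m≤n⇒m≤o+n b (ℕₚ.m≤n⇒m≤o+n b₋₂ (ℕₚ.m≤n⇒m≤o+n b₋₁ (ℕₚ.m≤n⇒m≤o+n b₀ (ℕₚ.m≤m+n _ _)))))))
    (HasSum-at h₂ B (ℕₚ.m≤n⇒m≤o+n b (ℕₚ.m≤n⇒m≤o+n b₋₂ (ℕₚ.m≤n⇒m≤o+n b₋₁ (ℕₚ.m≤n⇒m≤o+n b₀ (ℕₚ.m≤n+m _ _))))))))
  where
  b b₋₂ b₋₁ b₀ B : ℕ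
  b   = bound h
  b₋₂ = bound h₋₂
  b₋₁ = bound h₋₁
  b₀  = bound h₀
  B   = b + (b₋₂ + (b₋₁ + (b₀ + (bound h₁ + bound h₂))))

-- An iterated sum whose inner bound may depend on u: a translation of v by a function of u is then
-- immediate, whereas exchanging the variables asks for a uniform bound.
record HasSum₂ (f : ℤ → ℤ → ℤ) (s : ℤ) : Set where
  constructor hasSum₂
  field
    inner      : ℤ → ℤ
    inner-sums : ∀ u → HasSum (f u) (inner u)
    outer-sum  : HasSum inner s
open HasSum₂

HasSum₂-unique : ∀ {f s t} → HasSum₂ f s → HasSum₂ f t → s ≡ t
HasSum₂-unique h k = HasSum-unique (outer-sum h)
  (HasSum-cong (λ u → HasSum-unique (inner-sums k u) (inner-sums h u)) (outer-sum k))

HasSum₂-cong : ∀ {f g s} → (∀ u v → f u v ≡ g u v) → HasSum₂ f s → HasSum₂ g s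
HasSum₂-cong e (hasSum₂ t i o) = hasSum₂ t (λ u → HasSum-cong (e u) (i u)) o

HasSum₂-shift : ∀ {f s} (c : ℤ → ℤ) → HasSum₂ f s → HasSum₂ (λ u v → f u (v +ℤ c u)) s
HasSum₂-shift c (hasSum₂ t i o) = hasSum₂ t (λ u → HasSum-shift (c u) (i u)) o

HasSum₂-swap : ∀ {f s} B → (∀ u v → B < ∣ u ∣ → f u v ≡ 0ℤ) → (∀ u v → B < ∣ v ∣ → f u v ≡ 0ℤ) →
  HasSum₂ f s → HasSum₂ (flip f) s
HasSum₂-swap {f} {s} B hu hv h = hasSum₂ (λ v → zsum B (flip f v))
  (λ v → hasSum B (λ u → hu u v) refl)
  (hasSum B (λ v B<v → trans (zsum-cong B (λ u → hv u v B<v)) (zsum-0 B)) (trans (sym (zsum-swap B B f)) total'))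
  where
  inner-value : ∀ u → zsum B (f u) ≡ inner h u
  inner-value u = HasSum-unique (hasSum B (hv u) refl) (inner-sums h u)
  total' : zsum B (λ u → zsum B (f u)) ≡ s
  total' = HasSum-unique (hasSum B (λ u B<u → trans (zsum-cong B (λ v → hu u v B<u)) (zsum-0 B)) refl)
    (HasSum-cong (λ u → sym (inner-value u)) (outer-sum h))

HasSum₂-parts : ∀ {f s} B → (∀ u v → B < ∣ u ∣ → f u v ≡ 0ℤ) → HasSum₂ f s → Σ (ℤ → ℤ) λ S →
  (∀ i → ∣ i ∣ ≤ 2 → HasSum₂ (λ u w → f u (w *ℤ + 5 +ℤ i)) (S i))
  × s ≡ S (- (+ 2)) +ℤ S (- (+ 1)) +ℤ S 0ℤ +ℤ S 1ℤ +ℤ S (+ 2)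
HasSum₂-parts {f} {s} B hu h = (λ i → zsum B (inner-part i)) , parts , HasSum-unique (outer-sum h)
    (HasSum-cong (λ u → sym (inner-split u)) (HasSum-+ (HasSum-+ (HasSum-+ (HasSum-+ (outer _) (outer _)) (outer _)) (outer _)) (outer _)))
  where
  inner-part : ℤ → ℤ → ℤ
  inner-part i u = zsum (bound (inner-sums h u)) (part (f u) i)
  outer : ∀ i → HasSum (inner-part i) (zsum B (inner-part i))
  outer i = hasSum B (λ u B<u → trans (zsum-cong (bound (inner-sums h u)) (λ w → hu u _ B<u)) (zsum-0 (bound (inner-sums h u)))) refl
  parts : ∀ i → ∣ i ∣ ≤ 2 → HasSum₂ (λ u w → f u (w *ℤ + 5 +ℤ i)) (zsum B (inner-part i))
  parts i i≤2 = hasSum₂ (inner-part i) (λ u → HasSum-part (inner-sums h u) i i≤2) (outer i)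
  inner-split : ∀ u → inner h u ≡ inner-part (- (+ 2)) u +ℤ inner-part (- (+ 1)) u +ℤ inner-part 0ℤ u +ℤ inner-part 1ℤ u +ℤ inner-part (+ 2) u
  inner-split u = HasSum-parts (inner-sums h u) (p (- (+ 2)) (s≤s (s≤s z≤n))) (p (- (+ 1)) (s≤s z≤n)) (p 0ℤ z≤n) (p 1ℤ (s≤s z≤n)) (p (+ 2) (s≤s (s≤s z≤n)))
    where
    p : ∀ i → ∣ i ∣ ≤ 2 → HasSum (part (f u) i) (inner-part i u)
    p i i≤2 = HasSum-part (inner-sums h u) i i≤2

-- Theta series Σ_{m ∈ ℤ} q^{Q(m)}

-- The inequality makes `∣ Q m ∣` equal to Q m, and it confines the m that contribute to the
-- coefficient N to |m| ≤ N.
record Growing (Q : ℤ → ℤ) : Set where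
  constructor growing
  field grows : ∀ m → + ∣ m ∣ ≤ℤ Q m
open Growing public

quad : ℤ → ℤ → ℤ → ℤ → ℤ
quad a b c m = a *ℤ m *ℤ m +ℤ b *ℤ m +ℤ c

-- Modulo 5 the value at 5w + j depends on j alone; the hypothesis splits a j² + b j into its
-- residue r and the constant term k of the new form.
quad-part : ∀ a b j r k → a *ℤ j *ℤ j +ℤ b *ℤ j ≡ r +ℤ k *ℤ + 5 →
  ∀ w → quad a b 0ℤ (w *ℤ + 5 +ℤ j) ≡ r +ℤ quad (a *ℤ + 5) (a *ℤ j *ℤ + 2 +ℤ b) k w *ℤ + 5
quad-part a b j r k h w = trans (expand a b j w) (trans (cong (_+ℤ _) h) (collect a b j r k w))
  where
  expand : ∀ a b j w → a *ℤ (w *ℤ + 5 +ℤ j) *ℤ (w *ℤ + 5 +ℤ j) +ℤ b *ℤ (w *ℤ + 5 +ℤ j) +ℤ 0ℤ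
    ≡ (a *ℤ j *ℤ j +ℤ b *ℤ j) +ℤ ((a *ℤ + 5) *ℤ w *ℤ w +ℤ (a *ℤ j *ℤ + 2 +ℤ b) *ℤ w) *ℤ + 5
  expand = solve-∀
  collect : ∀ a b j r k w → r +ℤ k *ℤ + 5 +ℤ ((a *ℤ + 5) *ℤ w *ℤ w +ℤ (a *ℤ j *ℤ + 2 +ℤ b) *ℤ w) *ℤ + 5
    ≡ r +ℤ ((a *ℤ + 5) *ℤ w *ℤ w +ℤ (a *ℤ j *ℤ + 2 +ℤ b) *ℤ w +ℤ k) *ℤ + 5
  collect = solve-∀

-- Since |m| ≤ m², the leading term absorbs both |b m| and d |m|. The case d = 2 serves the doubled
-- pentagonal exponents.
quad-bound : ∀ a b c d → ∣ b ∣ + d ≤ a → ∀ m → + (d * ∣ m ∣) ≤ℤ quad (+ a) b (+ c) m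
quad-bound a b c d b+d≤a m = begin
  + (d * n)
    ≡⟨ cancel (+ (d * n)) (+ (∣ b ∣ * n)) ⟩
  + (d * n) +ℤ + (∣ b ∣ * n) +ℤ - (+ (∣ b ∣ * n))
    ≤⟨ ℤₚ.+-mono-≤ (Data.Integer.+≤+ bound') lower ⟩
  + (a * (n * n)) +ℤ b *ℤ m
    ≡⟨ cong (_+ℤ b *ℤ m) square ⟩
  + a *ℤ m *ℤ m +ℤ b *ℤ m
    ≤⟨ ℤₚ.i≤i+j _ (+ c) ⟩
  + a *ℤ m *ℤ m +ℤ b *ℤ m +ℤ + c ∎
  where
  open ℤₚ.≤-Reasoning
  n : ℕ
  n = ∣ m ∣
  cancel : ∀ x y → x ≡ x +ℤ y +ℤ - y
  cancel = solve-∀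
  n≤n² : ∀ n → n ≤ n * n
  n≤n² zero    = z≤n
  n≤n² (suc n) = ℕₚ.m≤m*n (suc n) (suc n)
  bound' : d * n + ∣ b ∣ * n ≤ a * (n * n)
  bound' = ℕₚ.≤-trans (ℕₚ.≤-reflexive (trans (ℕₚ.+-comm (d * n) _) (sym (ℕₚ.*-distribʳ-+ n ∣ b ∣ d)))) (ℕₚ.*-mono-≤ b+d≤a (n≤n² n))
  -∣i∣≤i : ∀ i → - (+ ∣ i ∣) ≤ℤ i
  -∣i∣≤i (+ zero)   = ℤₚ.≤-refl
  -∣i∣≤i (+ suc n)  = Data.Integer.-≤+
  -∣i∣≤i (-[1+ n ]) = ℤₚ.≤-refl
  lower : - (+ (∣ b ∣ * n)) ≤ℤ b *ℤ m
  lower = subst (λ x → - (+ x) ≤ℤ b *ℤ m) (ℤₚ.∣i*j∣≡∣i∣*∣j∣ b m) (-∣i∣≤i (b *ℤ m))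
  m²≥0 : ∀ m → m *ℤ m ≡ + (∣ m ∣ * ∣ m ∣)
  m²≥0 (+ n)      = sym (ℤₚ.pos-* n n)
  m²≥0 (-[1+ n ]) = refl
  square : + (a * (n * n)) ≡ + a *ℤ m *ℤ m
  square = trans (ℤₚ.pos-* a (n * n)) (trans (cong (+ a *ℤ_) (sym (m²≥0 m))) (sym (ℤₚ.*-assoc (+ a) m m)))

quad-growing : ∀ a b c → suc ∣ b ∣ ≤ a → Growing (quad (+ a) b (+ c))
quad-growing a b c b<a = growing λ m → subst (λ x → + x ≤ℤ quad (+ a) b (+ c) m) (ℕₚ.*-identityˡ ∣ m ∣)
  (quad-bound a b c 1 (subst (_≤ a) (ℕₚ.+-comm 1 ∣ b ∣) b<a) m)

Growing-nonNegative : ∀ {Q} → Growing Q → ∀ m → + ∣ Q m ∣ ≡ Q m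
Growing-nonNegative g m = ℤₚ.0≤i⇒+∣i∣≡i (ℤₚ.≤-trans (Data.Integer.+≤+ z≤n) (grows g m))

Growing-abs : ∀ {Q} → Growing Q → ∀ m → ∣ m ∣ ≤ ∣ Q m ∣
Growing-abs g m = ℤₚ.drop‿+≤+ (subst (+ ∣ m ∣ ≤ℤ_) (sym (Growing-nonNegative g m)) (grows g m))

theta : (ℤ → ℤ) → Series
theta Q N = zsum N (λ m → mono ∣ Q m ∣ N)

theta-HasSum : ∀ {Q} → Growing Q → ∀ N → HasSum (λ m → mono ∣ Q m ∣ N) (theta Q N)
theta-HasSum {Q} g N = hasSum N (λ m N<m → mono-< ∣ Q m ∣ N (ℕₚ.<-≤-trans N<m (Growing-abs g m))) refl

Growing-+ : ∀ {Q R} → Growing Q → Growing R → ∀ u v → ∣ Q u +ℤ R v ∣ ≡ ∣ Q u ∣ + ∣ R v ∣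
Growing-+ gQ gR u v = cong ∣_∣ (sym (cong₂ _+ℤ_ (Growing-nonNegative gQ u) (Growing-nonNegative gR v)))

theta-· : ∀ {Q R} → Growing Q → Growing R → ∀ N →
  HasSum₂ (λ u v → mono ∣ Q u +ℤ R v ∣ N) ((theta Q · theta R) N)
theta-· {Q} {R} gQ gR N = hasSum₂ (λ u → sumTo N (λ i → mono ∣ Q u ∣ i *ℤ theta R (N ∸ i)))
  (λ u → HasSum-cong (λ v → sym (trans (cong (λ e → mono e N) (Growing-+ gQ gR u v))
           (trans (coeff (mono-+ ∣ Q u ∣ ∣ R v ∣) N) (·-coeff (mono ∣ Q u ∣) (mono ∣ R v ∣) N))))
         (HasSum-sumTo N (λ i → HasSum-* (mono ∣ Q u ∣ i) (theta-HasSum gR (N ∸ i)))))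
  (subst (HasSum _) (sym (·-coeff (theta Q) (theta R) N))
    (HasSum-sumTo N (λ i → HasSum-cong (λ u → ℤₚ.*-comm (theta R (N ∸ i)) (mono ∣ Q u ∣ i))
      (subst (HasSum _) (ℤₚ.*-comm (theta R (N ∸ i)) (theta Q i)) (HasSum-* (theta R (N ∸ i)) (theta-HasSum gQ i))))))

open Dilation 4 public using (comp-dil·; comp-0-dil; comp-suc-dil; comp-ext; comp-cong; comp-⊕; comp-⊝; comp-0-q; comp-suc-q; comp-≋)
  renaming (dil-cong to D-cong; dil-injective to D-injective; dil-· to D-·; dil-⊕ to D-⊕; dil-⊝ to D-⊝; dil-⊖ to D-⊖; dil-constant to D-constant; dil-one to D-one; dil-mono to D-mono; dil-multiple to D-multiple; dil-other to D-other)

D : Series → Series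
D = dil 5

comp-ext₅ : ∀ {f g} → comp 5 0 f ≈ comp 5 0 g → comp 5 1 f ≈ comp 5 1 g → comp 5 2 f ≈ comp 5 2 g →
  comp 5 3 f ≈ comp 5 3 g → comp 5 4 f ≈ comp 5 4 g → f ≈ g
comp-ext₅ h0 h1 h2 h3 h4 = comp-ext λ
  { 0 _ → h0 ; 1 _ → h1 ; 2 _ → h2 ; 3 _ → h3 ; 4 _ → h4
  ; (suc (suc (suc (suc (suc _))))) (s≤s (s≤s (s≤s (s≤s (s≤s ()))))) }

mono-≢ : ∀ a b → a ≢ b → mono a b ≡ 0ℤ
mono-≢ zero    zero    h = ⊥-elim (h refl)
mono-≢ zero    (suc b) h = refl
mono-≢ (suc a) zero    h = refl
mono-≢ (suc a) (suc b) h = mono-≢ a b (h ∘ cong suc)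

residue-unique : ∀ {r s} a b → r < 5 → s < 5 → r + a * 5 ≡ s + b * 5 → r ≡ s
residue-unique {r} {s} a b r<5 s<5 h = trans (sym (mod r a r<5)) (trans (cong (_% 5) h) (mod s b s<5))
  where
  mod : ∀ r a → r < 5 → (r + a * 5) % 5 ≡ r
  mod r a r<5 = trans (ℕₚ.[m+kn]%n≡m%n r a 5) (ℕₚ.m<n⇒m%n≡m r<5)

mono-same-residue : ∀ r a b → mono (r + a * 5) (r + b * 5) ≡ mono a b
mono-same-residue r a b = trans (mono-+-+ r (a * 5) (b * 5)) (sym (Dilation.mono-multiples 4 a b))

mono-other-residue : ∀ r s a b → r < 5 → s < 5 → r ≢ s → mono (r + a * 5) (s + b * 5) ≡ 0ℤ
mono-other-residue r s a b r<5 s<5 r≢s = mono-≢ _ _ (r≢s ∘ residue-unique a b r<5 s<5)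

-- The series of Gauss and Euler as sums over ℤ

-- As m runs through ℤ, 2m² + m runs once through the triangular numbers.
psi : Series
psi = theta (quad (+ 2) 1ℤ 0ℤ)

psi-growing : Growing (quad (+ 2) 1ℤ 0ℤ)
psi-growing = quad-growing 2 1ℤ 0 (s≤s (s≤s z≤n))

gauss-partial-coeff : ∀ n N → gauss-partial n N ≡ zsum n (λ m → mono ∣ quad (+ 2) 1ℤ 0ℤ m ∣ N)
gauss-partial-coeff zero    N = sym (coeff mono-0 N)
gauss-partial-coeff (suc n) N = trans (⊕-coeff (gauss-partial n) _ N) (cong₂ _+ℤ_ (gauss-partial-coeff n N)
  (trans (⊕-coeff _ _ N) (cong₂ (λ a b → mono a N +ℤ mono b N) (cong ∣_∣ positive) (cong ∣_∣ negative))))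
  where
  positive : + (suc n * suc (2 * suc n)) ≡ quad (+ 2) 1ℤ 0ℤ (+ suc n)
  positive = trans (ℤₚ.pos-* (suc n) (suc (2 * suc n)))
    (trans (cong (λ z → + suc n *ℤ (1ℤ +ℤ z)) (ℤₚ.pos-* 2 (suc n))) (lemma (+ suc n)))
    where
    lemma : ∀ x → x *ℤ (1ℤ +ℤ + 2 *ℤ x) ≡ + 2 *ℤ x *ℤ x +ℤ 1ℤ *ℤ x +ℤ 0ℤ
    lemma = solve-∀
  negative : + (suc n * suc (2 * n)) ≡ quad (+ 2) 1ℤ 0ℤ -[1+ n ]
  negative = trans (ℤₚ.pos-* (suc n) (suc (2 * n)))
    (trans (cong (λ z → + suc n *ℤ (1ℤ +ℤ z)) (ℤₚ.pos-* 2 n)) (lemma (+ n)))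
    where
    lemma : ∀ x → (1ℤ +ℤ x) *ℤ (1ℤ +ℤ + 2 *ℤ x) ≡ + 2 *ℤ (- (1ℤ +ℤ x)) *ℤ (- (1ℤ +ℤ x)) +ℤ 1ℤ *ℤ (- (1ℤ +ℤ x)) +ℤ 0ℤ
    lemma = solve-∀

psi-approx : ∀ n → psi ≋[ suc n ] gauss-partial n
psi-approx n = upTo λ m m<n → trans (sym (HasSum-at (theta-HasSum psi-growing m) n (ℕₚ.≤-pred m<n))) (sym (gauss-partial-coeff n m))

J1·psi : J 1 · psi ≈ J 2 · J 2
J1·psi = ≋⇒≈ λ N → ≋-weaken (ℕₚ.n≤1+n N) (≋-trans (≋-· (≈⇒≋ ≈-refl) (psi-approx N)) (gauss-approx N))

eps : ℕ → ℤ
eps zero    = 1ℤ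
eps (suc n) = - eps n

-- Twice the pentagonal number m(3m+1)/2. To keep the form integral, the coefficient N of J₁ is read
-- at the exponent 2N.
pent : ℤ → ℤ
pent = quad (+ 3) 1ℤ 0ℤ

pentagonal-partial-coeff : ∀ n N → pentagonal-partial n N ≡ zsum n (λ m → eps ∣ m ∣ *ℤ mono ∣ pent m ∣ (N * 2))
pentagonal-partial-coeff zero    N = trans (sym (coeff mono-0 N)) (trans (Dilation.mono-multiples 1 0 N) (sym (ℤₚ.*-identityˡ _)))
pentagonal-partial-coeff (suc n) N = trans (⊕-coeff (pentagonal-partial n) _ N) (cong₂ _+ℤ_ (pentagonal-partial-coeff n N)
  (trans (coeff (·-congʳ (alternating≈ (suc n))) N) (trans (constant-· (eps (suc n)) _ N)
  (trans (cong (eps (suc n) *ℤ_) (⊕-coeff _ _ N)) (trans (ℤₚ.*-distribˡ-+ (eps (suc n)) _ _)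
  (cong₂ (λ a b → eps (suc n) *ℤ a +ℤ eps (suc n) *ℤ b) (double (suc n * suc n + triangle (suc n)) (cong ∣_∣ positive))
     (double (suc n * suc n + triangle n) (cong ∣_∣ negative))))))))
  where
  alternating≈ : ∀ n → alternating n ≈ constant (eps n)
  alternating≈ zero    = one≈constant
  alternating≈ (suc n) = ≈-trans (⊝-cong (alternating≈ n)) (≈-sym (constant-neg (eps n)))
  double : ∀ a {b} → a * 2 ≡ b → mono a N ≡ mono b (N * 2)
  double a refl = Dilation.mono-multiples 1 a N
  double-triangle : ∀ n → + (triangle n * 2) ≡ + n *ℤ (1ℤ +ℤ + n)
  double-triangle n = trans (cong +_ (ℕ-version n)) (ℤₚ.pos-* n (suc n))
    where
    ℕ-version : ∀ n → triangle n * 2 ≡ n * suc n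
    ℕ-version zero    = refl
    ℕ-version (suc n) = trans (cong (2 ℕ.+_) (ℕₚ.*-distribʳ-+ 2 n (triangle n)))
      (trans (cong (λ t → 2 + (n * 2 + t)) (ℕ-version n)) (lemma n))
      where
      lemma : ∀ n → 2 + (n * 2 + n * suc n) ≡ suc n * suc (suc n)
      lemma = ℕSolver.solve-∀
  split : ∀ t → + ((suc n * suc n + triangle t) * 2) ≡ + suc n *ℤ + suc n *ℤ + 2 +ℤ + t *ℤ (1ℤ +ℤ + t)
  split t = trans (cong +_ (ℕₚ.*-distribʳ-+ 2 (suc n * suc n) (triangle t)))
    (cong₂ _+ℤ_ (trans (ℤₚ.pos-* (suc n * suc n) 2) (cong (_*ℤ + 2) (ℤₚ.pos-* (suc n) (suc n)))) (double-triangle t))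
  positive : + ((suc n * suc n + triangle (suc n)) * 2) ≡ pent (+ suc n)
  positive = trans (split (suc n)) (lemma (+ suc n))
    where
    lemma : ∀ x → x *ℤ x *ℤ + 2 +ℤ x *ℤ (1ℤ +ℤ x) ≡ + 3 *ℤ x *ℤ x +ℤ 1ℤ *ℤ x +ℤ 0ℤ
    lemma = solve-∀
  negative : + ((suc n * suc n + triangle n) * 2) ≡ pent -[1+ n ]
  negative = trans (split n) (lemma (+ n))
    where
    lemma : ∀ x → (1ℤ +ℤ x) *ℤ (1ℤ +ℤ x) *ℤ + 2 +ℤ x *ℤ (1ℤ +ℤ x)
      ≡ + 3 *ℤ (- (1ℤ +ℤ x)) *ℤ (- (1ℤ +ℤ x)) +ℤ 1ℤ *ℤ (- (1ℤ +ℤ x)) +ℤ 0ℤ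
    lemma = solve-∀

J1-HasSum : ∀ N → HasSum (λ m → eps ∣ m ∣ *ℤ mono ∣ pent m ∣ (N * 2)) (J 1 N)
J1-HasSum N = hasSum N
  (λ m N<m → trans (cong (eps ∣ m ∣ *ℤ_) (mono-< ∣ pent m ∣ (N * 2) (ℕₚ.<-≤-trans (ℕₚ.*-monoˡ-< 2 N<m)
     (subst (_≤ ∣ pent m ∣) (ℕₚ.*-comm 2 ∣ m ∣) (ℤₚ.drop‿+≤+ (subst (+ (2 * ∣ m ∣) ≤ℤ_)
       (sym (Growing-nonNegative (quad-growing 3 1ℤ 0 (s≤s (s≤s z≤n))) m)) (quad-bound 3 1ℤ 0 2 (s≤s (s≤s (s≤s z≤n))) m)))))))
     (ℤₚ.*-zeroʳ (eps ∣ m ∣)))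
  (sym (trans (below (J1-pentagonal N) N ℕₚ.≤-refl) (pentagonal-partial-coeff N N)))

-- Components modulo 5

abs-residue : ∀ {Q} → Growing Q → ∀ r w {x} → x ≡ + r +ℤ Q w *ℤ + 5 → ∣ x ∣ ≡ r + ∣ Q w ∣ * 5
abs-residue {Q} g r w refl = cong ∣_∣ (cong (+ r +ℤ_)
  (trans (cong (_*ℤ + 5) (sym (Growing-nonNegative g w))) (sym (ℤₚ.pos-* ∣ Q w ∣ 5))))

theta-same : ∀ {Q P : ℤ → ℤ} r N → Growing Q → (∀ w → P w ≡ + r +ℤ Q w *ℤ + 5) →
  HasSum (λ w → mono ∣ P w ∣ (r + N * 5)) (theta Q N)
theta-same {Q} r N g e = HasSum-cong
  (λ w → sym (trans (cong (λ x → mono x (r + N * 5)) (abs-residue g r w (e w))) (mono-same-residue r ∣ Q w ∣ N)))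
  (theta-HasSum g N)

theta-other : ∀ {Q P : ℤ → ℤ} r s N → Growing Q → (∀ w → P w ≡ + r +ℤ Q w *ℤ + 5) → r < 5 → s < 5 → r ≢ s →
  HasSum (λ w → mono ∣ P w ∣ (s + N * 5)) 0ℤ
theta-other {Q} r s N g e r<5 s<5 r≢s = HasSum-cong
  (λ w → sym (trans (cong (λ x → mono x (s + N * 5)) (abs-residue g r w (e w))) (mono-other-residue r s ∣ Q w ∣ N r<5 s<5 r≢s)))
  HasSum-0

-- On m = 5w + i the exponent 2m² + m equals r + 5 Qᵢ(w), with r = 1, 1, 0, 3, 0 for i = -2, ..., 2.
-- The residues 2 and 4 do not occur.
Q₋₂ Q₋₁ Q₀ Q₁ Q₂ : ℤ → ℤ
Q₋₂ = quad (+ 10) (- (+ 7)) 1ℤ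
Q₋₁ = quad (+ 10) (- (+ 3)) 0ℤ
Q₀  = quad (+ 10) 1ℤ 0ℤ
Q₁  = quad (+ 10) (+ 5) 0ℤ
Q₂  = quad (+ 10) (+ 9) (+ 2)

Q₋₂-growing : Growing Q₋₂
Q₋₂-growing = quad-growing 10 (- (+ 7)) 1 (toWitness {a? = 8 ℕ.≤? 10} tt)
Q₋₁-growing : Growing Q₋₁
Q₋₁-growing = quad-growing 10 (- (+ 3)) 0 (toWitness {a? = 4 ℕ.≤? 10} tt)
Q₀-growing : Growing Q₀
Q₀-growing = quad-growing 10 1ℤ 0 (toWitness {a? = 2 ℕ.≤? 10} tt)
Q₁-growing : Growing Q₁
Q₁-growing = quad-growing 10 (+ 5) 0 (toWitness {a? = 6 ℕ.≤? 10} tt)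
Q₂-growing : Growing Q₂
Q₂-growing = quad-growing 10 (+ 9) 2 (toWitness {a? = 10 ℕ.≤? 10} tt)

psi-part : ∀ s N → s < 5 → (f : ℤ → ℤ) → (∀ w → f w ≡ mono ∣ quad (+ 2) 1ℤ 0ℤ w ∣ (s + N * 5)) →
  ∀ {Q} r j → Growing Q → (∀ w → quad (+ 2) 1ℤ 0ℤ (w *ℤ + 5 +ℤ j) ≡ + r +ℤ Q w *ℤ + 5) → r < 5 →
  HasSum (part f j) (if r ≡ᵇ s then theta Q N else 0ℤ)
psi-part s N s<5 f ef r j g e r<5 with r ≡ᵇ s in eq
... | true rewrite ℕₚ.≡ᵇ⇒≡ r s (subst T (sym eq) tt) = HasSum-cong (λ w → sym (ef (w *ℤ + 5 +ℤ j))) (theta-same s N g e)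
... | false = HasSum-cong (λ w → sym (ef (w *ℤ + 5 +ℤ j)))
  (theta-other r s N g e r<5 s<5 (λ r≡s → subst T eq (ℕₚ.≡⇒≡ᵇ r s r≡s)))

psi-component : ∀ s → s < 5 → ∀ N → comp 5 s psi N ≡
  (if 1 ≡ᵇ s then theta Q₋₂ N else 0ℤ) +ℤ (if 1 ≡ᵇ s then theta Q₋₁ N else 0ℤ) +ℤ (if 0 ≡ᵇ s then theta Q₀ N else 0ℤ)
  +ℤ (if 3 ≡ᵇ s then theta Q₁ N else 0ℤ) +ℤ (if 0 ≡ᵇ s then theta Q₂ N else 0ℤ)
psi-component s s<5 N = HasSum-parts (theta-HasSum psi-growing (s + N * 5))
  (p 1 (- (+ 2)) Q₋₂-growing (quad-part (+ 2) 1ℤ (- (+ 2)) 1ℤ 1ℤ refl) (s≤s (s≤s z≤n))) (p 1 (- (+ 1)) Q₋₁-growing (quad-part (+ 2) 1ℤ (- (+ 1)) 1ℤ 0ℤ refl) (s≤s (s≤s z≤n))) (p 0 0ℤ Q₀-growing (quad-part (+ 2) 1ℤ 0ℤ 0ℤ 0ℤ refl) (s≤s z≤n))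
  (p 3 1ℤ Q₁-growing (quad-part (+ 2) 1ℤ 1ℤ (+ 3) 0ℤ refl) (s≤s (s≤s (s≤s (s≤s z≤n))))) (p 0 (+ 2) Q₂-growing (quad-part (+ 2) 1ℤ (+ 2) 0ℤ (+ 2) refl) (s≤s z≤n))
  where
  p : ∀ {Q} r j → Growing Q → (∀ w → quad (+ 2) 1ℤ 0ℤ (w *ℤ + 5 +ℤ j) ≡ + r +ℤ Q w *ℤ + 5) → r < 5 →
      HasSum (part (λ m → mono ∣ quad (+ 2) 1ℤ 0ℤ m ∣ (s + N * 5)) j) (if r ≡ᵇ s then theta Q N else 0ℤ)
  p = psi-part s N s<5 _ (λ w → refl)

psi-0 : comp 5 0 psi ≈ theta Q₀ ⊕ theta Q₂
psi-0 = ext λ N → trans (psi-component 0 (s≤s z≤n) N)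
  (trans (lemma (theta Q₀ N) (theta Q₂ N)) (sym (⊕-coeff (theta Q₀) (theta Q₂) N)))
  where
  lemma : ∀ x y → 0ℤ +ℤ 0ℤ +ℤ x +ℤ 0ℤ +ℤ y ≡ x +ℤ y
  lemma = solve-∀

psi-1 : comp 5 1 psi ≈ theta Q₋₁ ⊕ theta Q₋₂
psi-1 = ext λ N → trans (psi-component 1 (s≤s (s≤s z≤n)) N)
  (trans (lemma (theta Q₋₂ N) (theta Q₋₁ N)) (sym (⊕-coeff (theta Q₋₁) (theta Q₋₂) N)))
  where
  lemma : ∀ x y → x +ℤ y +ℤ 0ℤ +ℤ 0ℤ +ℤ 0ℤ ≡ y +ℤ x
  lemma = solve-∀

psi-2 : comp 5 2 psi ≈ 0S
psi-2 = ext λ N → psi-component 2 (s≤s (s≤s (s≤s z≤n))) N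

psi-4 : comp 5 4 psi ≈ 0S
psi-4 = ext λ N → psi-component 4 ℕₚ.≤-refl N

-- Here Q₁(w) = 5(2w² + w), five times the form of ψ itself.
theta-Q₁ : theta Q₁ ≈ D psi
theta-Q₁ = comp-ext λ
  { zero _ → ≈-trans (ext λ N → HasSum-unique (theta-HasSum Q₁-growing (N * 5)) (theta-same 0 N psi-growing e)) (≈-sym (comp-0-dil psi))
  ; (suc s) s<5 → ≈-trans (ext λ N → HasSum-unique (theta-HasSum Q₁-growing (suc s + N * 5))
      (theta-other 0 (suc s) N psi-growing e (s≤s z≤n) s<5 (λ ()))) (≈-sym (comp-suc-dil psi s s<5)) }
  where
  e : ∀ w → + 10 *ℤ w *ℤ w +ℤ + 5 *ℤ w +ℤ 0ℤ ≡ + 0 +ℤ (+ 2 *ℤ w *ℤ w +ℤ 1ℤ *ℤ w +ℤ 0ℤ) *ℤ + 5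
  e = solve-∀

psi-3 : comp 5 3 psi ≈ D psi
psi-3 = ≈-trans (ext λ N → trans (psi-component 3 (s≤s (s≤s (s≤s (s≤s z≤n)))) N) (lemma (theta Q₁ N))) theta-Q₁
  where
  lemma : ∀ x → 0ℤ +ℤ 0ℤ +ℤ 0ℤ +ℤ x +ℤ 0ℤ ≡ x
  lemma = solve-∀

-- The product of two components of psi. In ψ² = Σ q^{e(u)+e(v)} substitute v = 5w + i + 2u
-- for i = -2, …, 2 and then u ↦ u − 2w + const: the form 10u² + 40uw + 50w² + … becomes diagonal.

e⁻ : ℤ → ℤ
e⁻ = quad (+ 2) (- (+ 1)) 0ℤ

e⁻-growing : Growing e⁻
e⁻-growing = quad-growing 2 (- (+ 1)) 0 (s≤s (s≤s z≤n))

theta-e⁻ : theta e⁻ ≈ psi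
theta-e⁻ = ext λ N → HasSum-unique (theta-HasSum e⁻-growing N)
  (HasSum-cong (λ m → cong (λ x → mono ∣ x ∣ N) (lemma m)) (HasSum-negate (theta-HasSum psi-growing N)))
  where
  lemma : ∀ m → + 2 *ℤ (- m) *ℤ (- m) +ℤ 1ℤ *ℤ (- m) +ℤ 0ℤ ≡ + 2 *ℤ m *ℤ m +ℤ - (+ 1) *ℤ m +ℤ 0ℤ
  lemma = solve-∀

module _ (N : ℕ) where

  private
    F : ℤ → ℤ → ℤ
    F u v = mono ∣ e⁻ u +ℤ e⁻ v ∣ N

    F-left : ∀ u v → N < ∣ u ∣ → F u v ≡ 0ℤ
    F-left u v N<u = mono-< _ N (ℕₚ.<-≤-trans N<u (ℕₚ.≤-trans (Growing-abs e⁻-growing u)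
      (subst (∣ e⁻ u ∣ ≤_) (sym (Growing-+ e⁻-growing e⁻-growing u v)) (ℕₚ.m≤m+n _ _))))

    F-right : ∀ u v → N < ∣ v ∣ → F u v ≡ 0ℤ
    F-right u v N<v = mono-< _ N (ℕₚ.<-≤-trans N<v (ℕₚ.≤-trans (Growing-abs e⁻-growing v)
      (subst (∣ e⁻ v ∣ ≤_) (sym (Growing-+ e⁻-growing e⁻-growing u v)) (ℕₚ.m≤n+m _ _))))

    sheared : HasSum₂ (λ u v → F u (v +ℤ + 2 *ℤ u)) ((theta e⁻ · theta e⁻) N)
    sheared = HasSum₂-shift (λ u → + 2 *ℤ u) (theta-· e⁻-growing e⁻-growing N)

    B : ℕ
    B = N + (2 + 2 * N)

    G : ℤ → ℤ → ℤ → ℤ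
    G i u w = F u (w *ℤ + 5 +ℤ i +ℤ + 2 *ℤ u)

    G-left : ∀ i u w → B < ∣ u ∣ → G i u w ≡ 0ℤ
    G-left i u w B<u = F-left u (w *ℤ + 5 +ℤ i +ℤ + 2 *ℤ u) (ℕₚ.≤-<-trans (ℕₚ.m≤m+n _ _) B<u)

    -- If neither u nor v exceeds N in absolute value, then 5|w| ≤ N + (2 + 2N). This is the uniform
    -- bound B needed to exchange the sums.
    G-right : ∀ i → ∣ i ∣ ≤ 2 → ∀ u w → B < ∣ w ∣ → G i u w ≡ 0ℤ
    G-right i i≤2 u w B<w with N ℕ.<? ∣ u ∣
    ... | yes N<u = F-left u (w *ℤ + 5 +ℤ i +ℤ + 2 *ℤ u) N<u
    ... | no  N≮u with N ℕ.<? ∣ w *ℤ + 5 +ℤ i +ℤ + 2 *ℤ u ∣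
    ... | yes N<v = F-right u (w *ℤ + 5 +ℤ i +ℤ + 2 *ℤ u) N<v
    ... | no  N≮v = ⊥-elim (ℕₚ.≤⇒≯ (ℕₚ.≤-trans w≤5w 5w≤B) B<w)
      where
      v : ℤ
      v = w *ℤ + 5 +ℤ i +ℤ + 2 *ℤ u
      cancel : ∀ w i u → w *ℤ + 5 +ℤ i +ℤ + 2 *ℤ u -ℤ (i +ℤ + 2 *ℤ u) ≡ w *ℤ + 5
      cancel = solve-∀
      w≤5w : ∣ w ∣ ≤ ∣ w *ℤ + 5 ∣
      w≤5w = subst (∣ w ∣ ≤_) (sym (ℤₚ.∣i*j∣≡∣i∣*∣j∣ w (+ 5))) (ℕₚ.m≤m*n ∣ w ∣ 5)
      5w≤B : ∣ w *ℤ + 5 ∣ ≤ B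
      5w≤B = ℕₚ.≤-trans (ℕₚ.≤-reflexive (cong ∣_∣ (sym (cancel w i u)))) (ℕₚ.≤-trans (ℤₚ.∣i-j∣≤∣i∣+∣j∣ v (i +ℤ + 2 *ℤ u))
        (ℕₚ.+-mono-≤ (ℕₚ.≮⇒≥ N≮v) (ℕₚ.≤-trans (ℤₚ.∣i+j∣≤∣i∣+∣j∣ i (+ 2 *ℤ u))
          (ℕₚ.+-mono-≤ i≤2 (ℕₚ.≤-trans (ℕₚ.≤-reflexive (ℤₚ.∣i*j∣≡∣i∣*∣j∣ (+ 2) u)) (ℕₚ.*-monoʳ-≤ 2 (ℕₚ.≮⇒≥ N≮u)))))))

    split : Σ (ℤ → ℤ) λ S → (∀ i → ∣ i ∣ ≤ 2 → HasSum₂ (G i) (S i))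
      × (theta e⁻ · theta e⁻) N ≡ S (- (+ 2)) +ℤ S (- (+ 1)) +ℤ S 0ℤ +ℤ S 1ℤ +ℤ S (+ 2)
    split = HasSum₂-parts N (λ u v → F-left u (v +ℤ + 2 *ℤ u)) sheared

    S : ℤ → ℤ
    S = proj₁ split

    -- c is the constant in the shift u ↦ u - 2w + c, and z is the share of the constant term given
    -- to the form in w. Both are chosen so that the two forms become members of the family Qᵢ, up
    -- to the factor q for i = 1.
    diagonal : ∀ i c z {t} → ∣ i ∣ ≤ 2 → HasSum₂ (λ w u → mono ∣ quad (+ 10) (+ 4 *ℤ i +ℤ 1ℤ) z w
      +ℤ quad (+ 10) (+ 20 *ℤ c +ℤ + 8 *ℤ i -ℤ + 3) (+ 2 *ℤ c *ℤ c +ℤ + 2 *ℤ (i +ℤ + 2 *ℤ c) *ℤ (i +ℤ + 2 *ℤ c) -ℤ + 3 *ℤ c -ℤ i -ℤ z) u ∣ N) t → S i ≡ t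
    diagonal i c z i≤2 h = HasSum₂-unique
      (HasSum₂-cong (λ w u → cong (λ x → mono ∣ x ∣ N) (identity i c z w u))
        (HasSum₂-shift (λ w → c -ℤ + 2 *ℤ w) (HasSum₂-swap B (G-left i) (G-right i i≤2) (proj₁ (proj₂ split) i i≤2))))
      h
      where
      identity : ∀ i c z w u → (+ 2 *ℤ (u +ℤ (c -ℤ + 2 *ℤ w)) *ℤ (u +ℤ (c -ℤ + 2 *ℤ w)) +ℤ - (+ 1) *ℤ (u +ℤ (c -ℤ + 2 *ℤ w)) +ℤ 0ℤ)
        +ℤ (+ 2 *ℤ (w *ℤ + 5 +ℤ i +ℤ + 2 *ℤ (u +ℤ (c -ℤ + 2 *ℤ w))) *ℤ (w *ℤ + 5 +ℤ i +ℤ + 2 *ℤ (u +ℤ (c -ℤ + 2 *ℤ w)))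
          +ℤ - (+ 1) *ℤ (w *ℤ + 5 +ℤ i +ℤ + 2 *ℤ (u +ℤ (c -ℤ + 2 *ℤ w))) +ℤ 0ℤ)
        ≡ (+ 10 *ℤ w *ℤ w +ℤ (+ 4 *ℤ i +ℤ 1ℤ) *ℤ w +ℤ z) +ℤ (+ 10 *ℤ u *ℤ u +ℤ (+ 20 *ℤ c +ℤ + 8 *ℤ i -ℤ + 3) *ℤ u
          +ℤ (+ 2 *ℤ c *ℤ c +ℤ + 2 *ℤ (i +ℤ + 2 *ℤ c) *ℤ (i +ℤ + 2 *ℤ c) -ℤ + 3 *ℤ c -ℤ i -ℤ z))
      identity = solve-∀

    S₀ : S 0ℤ ≡ (theta Q₀ · theta Q₋₁) N
    S₀ = diagonal 0ℤ 0ℤ 0ℤ z≤n (theta-· Q₀-growing Q₋₁-growing N)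

    S₋₁ : S (- (+ 1)) ≡ (theta Q₋₁ · theta Q₂) N
    S₋₁ = diagonal (- (+ 1)) 1ℤ 0ℤ (s≤s z≤n) (theta-· Q₋₁-growing Q₂-growing N)

    S₋₂ : S (- (+ 2)) ≡ (theta Q₋₂ · theta Q₀) N
    S₋₂ = diagonal (- (+ 2)) 1ℤ 1ℤ (s≤s (s≤s z≤n)) (theta-· Q₋₂-growing Q₀-growing N)

    S₂ : S (+ 2) ≡ (theta Q₂ · theta Q₋₂) N
    S₂ = diagonal (+ 2) (- (+ 1)) (+ 2) (s≤s (s≤s z≤n)) (theta-· Q₂-growing Q₋₂-growing N)

    S₁ : S 1ℤ ≡ (q · (theta Q₁ · theta Q₁)) N
    S₁ = diagonal 1ℤ 0ℤ 1ℤ (s≤s z≤n) (HasSum₂-cong (λ w u → cong (λ x → mono x N) (sym (suc-abs w u))) (shifted N))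
      where
      suc-abs : ∀ w u → ∣ quad (+ 10) (+ 5) 1ℤ w +ℤ Q₁ u ∣ ≡ suc ∣ Q₁ w +ℤ Q₁ u ∣
      suc-abs w u = trans (cong ∣_∣ (trans (lemma w (Q₁ u))
          (cong (1ℤ +ℤ_) (sym (cong₂ _+ℤ_ (Growing-nonNegative Q₁-growing w) (Growing-nonNegative Q₁-growing u))))))
        (cong suc (sym (Growing-+ Q₁-growing Q₁-growing w u)))
        where
        lemma : ∀ w z → + 10 *ℤ w *ℤ w +ℤ + 5 *ℤ w +ℤ 1ℤ +ℤ z ≡ 1ℤ +ℤ (+ 10 *ℤ w *ℤ w +ℤ + 5 *ℤ w +ℤ 0ℤ +ℤ z)
        lemma = solve-∀
      shifted : ∀ N → HasSum₂ (λ w u → mono (suc ∣ Q₁ w +ℤ Q₁ u ∣) N) ((q · (theta Q₁ · theta Q₁)) N)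
      shifted zero    = subst (HasSum₂ _) (sym (q·-zero (theta Q₁ · theta Q₁))) (hasSum₂ (λ _ → 0ℤ) (λ _ → HasSum-0) HasSum-0)
      shifted (suc n) = subst (HasSum₂ _) (sym (q·-suc (theta Q₁ · theta Q₁) n)) (theta-· Q₁-growing Q₁-growing n)

  psi²-coeff : (theta e⁻ · theta e⁻) N ≡ (theta Q₋₂ · theta Q₀) N +ℤ (theta Q₋₁ · theta Q₂) N
    +ℤ (theta Q₀ · theta Q₋₁) N +ℤ (q · (theta Q₁ · theta Q₁)) N +ℤ (theta Q₂ · theta Q₋₂) N
  psi²-coeff = trans (proj₂ (proj₂ split)) (cong₂ _+ℤ_ (cong₂ _+ℤ_ (cong₂ _+ℤ_ (cong₂ _+ℤ_ S₋₂ S₋₁) S₀) S₁) S₂)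

-- Ramanujan's ψ(q)² - q ψ(q⁵)² = f(q, q⁴) f(q², q³). The substitution behind it sorts the Gaussian
-- integers u + iv by the cosets of the ideal (1 + 2i), on which the norm form is five times itself.
-- Four cosets give the products of the theta series in the two components, the fifth gives q
-- ψ(q⁵)².
psi-product : comp 5 0 psi · comp 5 1 psi ≈ psi · psi ⊖ q · (D psi · D psi)
psi-product = begin
  comp 5 0 psi · comp 5 1 psi
    ≈⟨ ·-cong psi-0 psi-1 ⟩
  (θ₀ ⊕ θ₂) · (θ₋₁ ⊕ θ₋₂)
    ≈⟨ decide (θ₋₂ ∷ θ₋₁ ∷ θ₀ ∷ θ₂ ∷ X ∷ []) ((v2 :+ v3) :* (v1 :+ v0)) (v0 :* v2 :+ v1 :* v3 :+ v2 :* v1 :+ v4 :+ v3 :* v0 :- v4) refl ⟩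
  θ₋₂ · θ₀ ⊕ θ₋₁ · θ₂ ⊕ θ₀ · θ₋₁ ⊕ X ⊕ θ₂ · θ₋₂ ⊖ X
    ≈⟨ ⊖-cong (≈-trans (≈-sym expansion) (·-cong theta-e⁻ theta-e⁻)) (·-congˡ (·-cong theta-Q₁ theta-Q₁)) ⟩
  psi · psi ⊖ q · (D psi · D psi) ∎
  where
  open ≈-Reasoning
  θ₋₂ θ₋₁ θ₀ θ₂ X : Series
  θ₋₂ = theta Q₋₂
  θ₋₁ = theta Q₋₁
  θ₀  = theta Q₀
  θ₂  = theta Q₂
  X   = q · (theta Q₁ · theta Q₁)
  expansion : theta e⁻ · theta e⁻ ≈ θ₋₂ · θ₀ ⊕ θ₋₁ · θ₂ ⊕ θ₀ · θ₋₁ ⊕ X ⊕ θ₂ · θ₋₂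
  expansion = ext λ N → trans (psi²-coeff N) (sym
    (trans (⊕-coeff _ _ N) (cong (_+ℤ (θ₂ · θ₋₂) N)
    (trans (⊕-coeff _ _ N) (cong (_+ℤ X N)
    (trans (⊕-coeff _ _ N) (cong (_+ℤ (θ₀ · θ₋₁) N) (⊕-coeff _ _ N))))))))

-- Components of J₁

pent-part : ∀ s N → s < 5 → ∀ {Q} r j → Growing Q → (∀ w → pent (w *ℤ + 5 +ℤ j) ≡ + r +ℤ Q w *ℤ + 5) → r < 5 → r ≢ s →
  HasSum (part (λ m → eps ∣ m ∣ *ℤ mono ∣ pent m ∣ (s + N * 5)) j) 0ℤ
pent-part s N s<5 {Q} r j g e r<5 r≢s = HasSum-cong (λ w → sym (trans (cong (eps ∣ w *ℤ + 5 +ℤ j ∣ *ℤ_)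
    (trans (cong (λ x → mono x (s + N * 5)) (abs-residue g r w (e w))) (mono-other-residue r s ∣ Q w ∣ N r<5 s<5 r≢s)))
    (ℤₚ.*-zeroʳ (eps ∣ w *ℤ + 5 +ℤ j ∣)))) HasSum-0

p₋₂ : ∀ w → pent (w *ℤ + 5 +ℤ - (+ 2)) ≡ + 0 +ℤ quad (+ 15) (- (+ 11)) (+ 2) w *ℤ + 5
p₋₂ = quad-part (+ 3) 1ℤ (- (+ 2)) 0ℤ (+ 2) refl
p₋₁ : ∀ w → pent (w *ℤ + 5 +ℤ - (+ 1)) ≡ + 2 +ℤ quad (+ 15) (- (+ 5)) 0ℤ w *ℤ + 5
p₋₁ = quad-part (+ 3) 1ℤ (- (+ 1)) (+ 2) 0ℤ refl
p₀ : ∀ w → pent (w *ℤ + 5 +ℤ 0ℤ) ≡ + 0 +ℤ quad (+ 15) 1ℤ 0ℤ w *ℤ + 5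
p₀ = quad-part (+ 3) 1ℤ 0ℤ 0ℤ 0ℤ refl
p₁ : ∀ w → pent (w *ℤ + 5 +ℤ 1ℤ) ≡ + 4 +ℤ quad (+ 15) (+ 7) 0ℤ w *ℤ + 5
p₁ = quad-part (+ 3) 1ℤ 1ℤ (+ 4) 0ℤ refl
p₂ : ∀ w → pent (w *ℤ + 5 +ℤ + 2) ≡ + 4 +ℤ quad (+ 15) (+ 13) (+ 2) w *ℤ + 5
p₂ = quad-part (+ 3) 1ℤ (+ 2) (+ 4) (+ 2) refl

g₋₂ : Growing (quad (+ 15) (- (+ 11)) (+ 2))
g₋₂ = quad-growing 15 (- (+ 11)) 2 (toWitness {a? = 12 ℕ.≤? 15} tt)
g₋₁ : Growing (quad (+ 15) (- (+ 5)) 0ℤ)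
g₋₁ = quad-growing 15 (- (+ 5)) 0 (toWitness {a? = 6 ℕ.≤? 15} tt)
g₀ : Growing (quad (+ 15) 1ℤ 0ℤ)
g₀ = quad-growing 15 1ℤ 0 (toWitness {a? = 2 ℕ.≤? 15} tt)
g₁ : Growing (quad (+ 15) (+ 7) 0ℤ)
g₁ = quad-growing 15 (+ 7) 0 (toWitness {a? = 8 ℕ.≤? 15} tt)
g₂ : Growing (quad (+ 15) (+ 13) (+ 2))
g₂ = quad-growing 15 (+ 13) 2 (toWitness {a? = 14 ℕ.≤? 15} tt)

J1-at : ∀ {M K} → M * 2 ≡ K → HasSum (λ m → eps ∣ m ∣ *ℤ mono ∣ pent m ∣ K) (J 1 M)
J1-at {M} refl = J1-HasSum M

-- s is the residue of the doubled exponent, and `pent` takes only the residues 0, 2, 4. Doubling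
-- sends 3 to 1 and 4 to 3, so the components 3 and 4 of J₁ vanish.
J1-vanish : ∀ s N M → s < 5 → M * 2 ≡ s + N * 5 → 0 ≢ s → 2 ≢ s → 4 ≢ s → J 1 M ≡ 0ℤ
J1-vanish s N M s<5 e n0 n2 n4 = HasSum-parts (J1-at {M} e)
  (pent-part s N s<5 0 (- (+ 2)) g₋₂ p₋₂ (s≤s z≤n) n0)
  (pent-part s N s<5 2 (- (+ 1)) g₋₁ p₋₁ (s≤s (s≤s (s≤s z≤n))) n2)
  (pent-part s N s<5 0 0ℤ g₀ p₀ (s≤s z≤n) n0)
  (pent-part s N s<5 4 1ℤ g₁ p₁ ℕₚ.≤-refl n4)
  (pent-part s N s<5 4 (+ 2) g₂ p₂ ℕₚ.≤-refl n4)

J1-3 : comp 5 3 (J 1) ≈ 0S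
J1-3 = ext λ N → J1-vanish 1 (1 + N * 2) (3 + N * 5) (s≤s (s≤s z≤n)) (lemma N) (λ ()) (λ ()) (λ ())
  where
  lemma : ∀ N → (3 + N * 5) * 2 ≡ 1 + (1 + N * 2) * 5
  lemma = ℕSolver.solve-∀

J1-4 : comp 5 4 (J 1) ≈ 0S
J1-4 = ext λ N → J1-vanish 3 (1 + N * 2) (4 + N * 5) (s≤s (s≤s (s≤s (s≤s z≤n)))) (lemma N) (λ ()) (λ ()) (λ ())
  where
  lemma : ∀ N → (4 + N * 5) * 2 ≡ 3 + (1 + N * 2) * 5
  lemma = ℕSolver.solve-∀

eps-+2 : ∀ n → eps (2 + n) ≡ eps n
eps-+2 n = ℤₚ.neg-involutive (eps n)

eps-even : ∀ k n → eps (k * 2 + n) ≡ eps n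
eps-even zero    n = refl
eps-even (suc k) n = trans (eps-+2 (k * 2 + n)) (eps-even k n)

eps-part : ∀ w → eps ∣ w *ℤ + 5 +ℤ - (+ 1) ∣ ≡ - eps ∣ w ∣
eps-part (+ zero)   = refl
eps-part (+ suc n)  = trans (cong (λ x → eps ∣ x ∣) value) (trans (eps-even (2 + n * 2) n) (sym (ℤₚ.neg-involutive (eps n))))
  where
  value : + suc n *ℤ + 5 +ℤ - (+ 1) ≡ + ((2 + n * 2) * 2 + n)
  value = trans (cong (_+ℤ - (+ 1)) (sym (ℤₚ.pos-* (suc n) 5))) (cong +_ (lemma n))
    where
    lemma : ∀ n → 4 + n * 5 ≡ (2 + n * 2) * 2 + n
    lemma = ℕSolver.solve-∀
eps-part (-[1+ n ]) = trans (cong (λ x → eps ∣ x ∣) value) (trans (cong eps (lemma n)) (trans (eps-even (3 + n * 2) n) (sym (ℤₚ.neg-involutive (eps n)))))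
  where
  value : -[1+ n ] *ℤ + 5 +ℤ - (+ 1) ≡ -[1+ 5 + n * 5 ]
  value = trans (lemma' (+ suc n)) (trans (cong (λ x → - (x +ℤ 1ℤ)) (sym (ℤₚ.pos-* (suc n) 5))) (cong (λ x → - (+ x)) (ℕₚ.+-comm (suc n * 5) 1)))
    where
    lemma' : ∀ x → (- x) *ℤ + 5 +ℤ - (+ 1) ≡ - (x *ℤ + 5 +ℤ 1ℤ)
    lemma' = solve-∀
  lemma : ∀ n → 6 + n * 5 ≡ (3 + n * 2) * 2 + n
  lemma = ℕSolver.solve-∀

-- A doubled exponent of residue 2 forces m = 5w - 1. The remaining form 15w² - 5w = 5(3w² - w) is,
-- after w ↦ -w, five times `pent`, and the parity of 5w - 1 gives the sign.
J1-1 : comp 5 1 (J 1) ≈ ⊝ D (J 1)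
J1-1 = ext λ N → trans (HasSum-parts (J1-at {1 + N * 5} {2 + (N * 2) * 5} (double N))
    (pent-part 2 (N * 2) s<5 0 (- (+ 2)) g₋₂ p₋₂ (s≤s z≤n) (λ ()))
    (HasSum-cong (λ w → sym (term N w)) (HasSum-* (- (+ 1)) (main N)))
    (pent-part 2 (N * 2) s<5 0 0ℤ g₀ p₀ (s≤s z≤n) (λ ()))
    (pent-part 2 (N * 2) s<5 4 1ℤ g₁ p₁ ℕₚ.≤-refl (λ ()))
    (pent-part 2 (N * 2) s<5 4 (+ 2) g₂ p₂ ℕₚ.≤-refl (λ ())))
  (trans (collect (D (J 1) N)) (sym (⊝-coeff (D (J 1)) N)))
  where
  s<5 : 2 < 5
  s<5 = s≤s (s≤s (s≤s z≤n))
  double : ∀ N → (1 + N * 5) * 2 ≡ 2 + (N * 2) * 5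
  double = ℕSolver.solve-∀
  collect : ∀ x → 0ℤ +ℤ - (+ 1) *ℤ x +ℤ 0ℤ +ℤ 0ℤ +ℤ 0ℤ ≡ - x
  collect = solve-∀
  Q : ℤ → ℤ
  Q = quad (+ 15) (- (+ 5)) 0ℤ
  term : ∀ N w → eps ∣ w *ℤ + 5 +ℤ - (+ 1) ∣ *ℤ mono ∣ pent (w *ℤ + 5 +ℤ - (+ 1)) ∣ (2 + (N * 2) * 5)
    ≡ - (+ 1) *ℤ (eps ∣ w ∣ *ℤ mono ∣ Q w ∣ (N * 2))
  term N w = trans (cong₂ _*ℤ_ (eps-part w) (trans (cong (λ x → mono x (2 + (N * 2) * 5)) (abs-residue g₋₁ 2 w (p₋₁ w)))
      (mono-same-residue 2 ∣ Q w ∣ (N * 2)))) (lemma (eps ∣ w ∣) (mono ∣ Q w ∣ (N * 2)))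
    where
    lemma : ∀ x y → - x *ℤ y ≡ - (+ 1) *ℤ (x *ℤ y)
    lemma = solve-∀
  pent⁻ : ∀ w → Q w ≡ + 0 +ℤ quad (+ 3) (- (+ 1)) 0ℤ w *ℤ + 5
  pent⁻ = lemma
    where
    lemma : ∀ w → + 15 *ℤ w *ℤ w +ℤ - (+ 5) *ℤ w +ℤ 0ℤ ≡ + 0 +ℤ (+ 3 *ℤ w *ℤ w +ℤ - (+ 1) *ℤ w +ℤ 0ℤ) *ℤ + 5
    lemma = solve-∀
  pent⁻-growing : Growing (quad (+ 3) (- (+ 1)) 0ℤ)
  pent⁻-growing = quad-growing 3 (- (+ 1)) 0 (s≤s (s≤s z≤n))
  reflect : ∀ w → quad (+ 3) (- (+ 1)) 0ℤ (- w) ≡ pent w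
  reflect = lemma
    where
    lemma : ∀ w → + 3 *ℤ (- w) *ℤ (- w) +ℤ - (+ 1) *ℤ (- w) +ℤ 0ℤ ≡ + 3 *ℤ w *ℤ w +ℤ 1ℤ *ℤ w +ℤ 0ℤ
    lemma = solve-∀
  multiple : ∀ M → HasSum (λ w → eps ∣ w ∣ *ℤ mono ∣ Q w ∣ ((M * 5) * 2)) (J 1 M)
  multiple M = HasSum-cong
    (λ w → trans (cong₂ (λ n x → eps n *ℤ mono ∣ x ∣ (M * 2)) (ℤₚ.∣-i∣≡∣i∣ w) (trans (sym (reflect (- w))) (cong (quad (+ 3) (- (+ 1)) 0ℤ) (ℤₚ.neg-involutive w))))
      (cong (eps ∣ w ∣ *ℤ_) (sym (trans (cong₂ mono (abs-residue pent⁻-growing 0 w (pent⁻ w)) (swap M))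
        (mono-same-residue 0 ∣ quad (+ 3) (- (+ 1)) 0ℤ w ∣ (M * 2))))))
    (HasSum-negate (J1-HasSum M))
    where
    swap : ∀ M → (M * 5) * 2 ≡ (M * 2) * 5
    swap = ℕSolver.solve-∀
  other : ∀ s N K → s < 5 → K ≡ s + N * 5 → 0 ≢ s → HasSum (λ w → eps ∣ w ∣ *ℤ mono ∣ Q w ∣ K) 0ℤ
  other s N K s<5 e 0≢s = HasSum-cong
    (λ w → sym (trans (cong (eps ∣ w ∣ *ℤ_) (trans (cong₂ mono (abs-residue pent⁻-growing 0 w (pent⁻ w)) e)
        (mono-other-residue 0 s ∣ quad (+ 3) (- (+ 1)) 0ℤ w ∣ N (s≤s z≤n) s<5 0≢s))) (ℤₚ.*-zeroʳ (eps ∣ w ∣)))) HasSum-0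
  fS : Series
  fS N = zsum N (λ w → eps ∣ w ∣ *ℤ mono ∣ Q w ∣ (N * 2))
  fS-sum : ∀ N → HasSum (λ w → eps ∣ w ∣ *ℤ mono ∣ Q w ∣ (N * 2)) (fS N)
  fS-sum N = hasSum N (λ w N<w → trans (cong (eps ∣ w ∣ *ℤ_) (mono-< ∣ Q w ∣ (N * 2) (ℕₚ.<-≤-trans (ℕₚ.*-monoˡ-< 2 N<w)
     (subst (_≤ ∣ Q w ∣) (ℕₚ.*-comm 2 ∣ w ∣) (ℤₚ.drop‿+≤+ (subst (+ (2 * ∣ w ∣) ≤ℤ_)
       (sym (Growing-nonNegative g₋₁ w)) (quad-bound 15 (- (+ 5)) 0 2 (toWitness {a? = 7 ℕ.≤? 15} tt) w)))))))
     (ℤₚ.*-zeroʳ (eps ∣ w ∣))) refl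
  fS≈ : fS ≈ D (J 1)
  fS≈ = comp-ext₅
    (≈-trans (ext λ M → HasSum-unique (fS-sum (M * 5)) (multiple M)) (≈-sym (comp-0-dil (J 1))))
    (vanishing 0 2 (λ M → M * 2) (s≤s (s≤s z≤n)) s<5 l1 (λ ()))
    (vanishing 1 4 (λ M → M * 2) (s≤s (s≤s (s≤s z≤n))) ℕₚ.≤-refl l2 (λ ()))
    (vanishing 2 1 (λ M → 1 + M * 2) (s≤s (s≤s (s≤s (s≤s z≤n)))) (s≤s (s≤s z≤n)) l3 (λ ()))
    (vanishing 3 3 (λ M → 1 + M * 2) ℕₚ.≤-refl (s≤s (s≤s (s≤s (s≤s z≤n)))) l4 (λ ()))
    where
    vanishing : ∀ i s (K : ℕ → ℕ) → suc i < 5 → s < 5 → (∀ M → (suc i + M * 5) * 2 ≡ s + K M * 5) → 0 ≢ s →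
      comp 5 (suc i) fS ≈ comp 5 (suc i) (D (J 1))
    vanishing i s K i<5 s<5 e 0≢s = ≈-trans (ext λ M → HasSum-unique (fS-sum (suc i + M * 5))
      (other s (K M) _ s<5 (e M) 0≢s)) (≈-sym (comp-suc-dil (J 1) i i<5))
    l1 : ∀ M → (1 + M * 5) * 2 ≡ 2 + (M * 2) * 5
    l1 = ℕSolver.solve-∀
    l2 : ∀ M → (2 + M * 5) * 2 ≡ 4 + (M * 2) * 5
    l2 = ℕSolver.solve-∀
    l3 : ∀ M → (3 + M * 5) * 2 ≡ 1 + (1 + M * 2) * 5
    l3 = ℕSolver.solve-∀
    l4 : ∀ M → (4 + M * 5) * 2 ≡ 3 + (1 + M * 2) * 5
    l4 = ℕSolver.solve-∀
  main : ∀ N → HasSum (λ w → eps ∣ w ∣ *ℤ mono ∣ Q w ∣ (N * 2)) (D (J 1) N)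
  main N = subst (HasSum _) (coeff fS≈ N) (fS-sum N)

-- Identities modulo hypotheses: f − g = Σ cᵢ (lᵢ − rᵢ) with lᵢ ≈ rᵢ implies f ≈ g.

data Hypotheses {n} (ρ : Vec Series n) : Set where
  done : Hypotheses ρ
  hyp  : (c l r : Expr n) → eval l ρ ≈ eval r ρ → Hypotheses ρ → Hypotheses ρ

combination : ∀ {n} {ρ : Vec Series n} → Hypotheses ρ → Expr n
combination done            = con 0ℤ
combination (hyp c l r _ h) = c :* (l :- r) :+ combination h

combination≈0 : ∀ {n} {ρ : Vec Series n} (h : Hypotheses ρ) → eval (combination h) ρ ≈ 0S
combination≈0 done = constant-0
combination≈0 (hyp c l r e h) = ≈-trans (⊕-cong (≈-trans (·-congˡ (x≈y⇒x⊖y≈0 e)) (·-zeroʳ _)) (combination≈0 h)) (⊕-identityˡ 0S)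

solveWith : ∀ {n} (ρ : Vec Series n) (f g : Expr n) (h : Hypotheses ρ) →
  isZero (normal (f :- g :- combination h)) ≡ true → eval f ρ ≈ eval g ρ
solveWith ρ f g h z = x⊖y≈0⇒x≈y (≈-trans (x⊖y≈0⇒x≈y (≈-trans (≈-sym (normal-sound (f :- g :- combination h) ρ))
  (isZero-sound (normal (f :- g :- combination h)) ρ z))) (combination≈0 h))

-- Polynomials in q over the image of D

D-^ : ∀ f n → D (f ^S n) ≈ D f ^S n
D-^ f zero    = D-one
D-^ f (suc n) = ≈-trans (D-· f (f ^S n)) (·-congˡ (D-^ f n))

D-eval : ∀ {n} (e : Expr n) (ρ : Vec Series n) → D (eval e ρ) ≈ eval e (map D ρ)
D-eval (con z)  ρ = D-constant z
D-eval (var i)  ρ = subst (D (lookup ρ i) ≈_) (sym (lookup-map i D ρ)) ≈-refl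
D-eval :one     ρ = D-one
D-eval (e :+ f) ρ = ≈-trans (D-⊕ _ _) (⊕-cong (D-eval e ρ) (D-eval f ρ))
D-eval (e :* f) ρ = ≈-trans (D-· _ _) (·-cong (D-eval e ρ) (D-eval f ρ))
D-eval (e :- f) ρ = ≈-trans (D-⊖ _ _) (⊖-cong (D-eval e ρ) (D-eval f ρ))
D-eval (:- e)   ρ = ≈-trans (D-⊝ _) (⊝-cong (D-eval e ρ))
D-eval (e :^ k) ρ = ≈-trans (D-^ _ k) (^S-cong k (D-eval e ρ))

D-q : D q ≈ q ^S 5
D-q = ≈-trans (D-mono 1) (mono-^ 5)

D-poly : ∀ {n} (p : Poly n) (ρ : Vec Series n) → D (⟦ p ⟧ ρ) ≈ ⟦ p ⟧ (map D ρ)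
D-poly {zero}  z        []      = D-constant z
D-poly {suc n} []       (x ∷ ρ) = ≈-trans (D-cong (≈-sym constant-0)) (≈-trans (D-constant 0ℤ) constant-0)
D-poly {suc n} (p ∷ ps) (x ∷ ρ) = ≈-trans (D-⊕ _ _)
  (⊕-cong (D-poly p ρ) (≈-trans (D-· _ _) (·-congˡ (D-poly ps (x ∷ ρ)))))

-- The coefficients at i, i + 5, i + 10, …; for polynomials in q over the image of D they give comp 5 i.
every : ∀ {n} → ℕ → Poly (suc n) → Poly (suc n)
every _             []       = []
every zero          (p ∷ ps) = p ∷ every 4 ps
every (suc i)       (p ∷ ps) = every i ps

every-sound : ∀ {n} i → i < 5 → (ps : Poly (suc n)) (ρ : Vec Series n) →
  comp 5 i (⟦ ps ⟧ (q ∷ map D ρ)) ≈ ⟦ every i ps ⟧ (q ∷ ρ)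
every-sound i i<5 [] ρ = ext λ n → refl
every-sound zero i<5 (p ∷ ps) ρ = ≈-trans (comp-⊕ 0 _ _) (⊕-cong
  (≈-trans (comp-cong 0 (≈-sym (D-poly p ρ))) (comp-0-dil (⟦ p ⟧ ρ)))
  (≈-trans (comp-0-q _) (·-congˡ (every-sound 4 ℕₚ.≤-refl ps ρ))))
every-sound (suc i) i<5 (p ∷ ps) ρ = ≈-trans (comp-⊕ (suc i) _ _) (≈-trans (⊕-cong
  (≈-trans (comp-cong (suc i) (≈-sym (D-poly p ρ))) (comp-suc-dil (⟦ p ⟧ ρ) i i<5))
  (≈-trans (comp-suc-q i _) (every-sound i (ℕₚ.<-trans ℕₚ.≤-refl i<5) ps ρ))) (⊕-identityˡ _))

component : ∀ {n} i → i < 5 → (ρ : Vec Series n) (e f : Expr (suc n)) →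
  isZero (every i (normal e) +P (-P normal f)) ≡ true → comp 5 i (eval e (q ∷ map D ρ)) ≈ eval f (q ∷ ρ)
component i i<5 ρ e f z = ≈-trans (comp-cong i (≈-sym (normal-sound e (q ∷ map D ρ))))
  (≈-trans (every-sound i i<5 (normal e) ρ) (x⊖y≈0⇒x≈y
    (≈-trans (⊕-cong ≈-refl (⊝-cong (≈-sym (normal-sound f (q ∷ ρ)))))
    (≈-trans (≈-sym (≈-trans (+P-sound (every i (normal e)) (-P normal f) (q ∷ ρ)) (⊕-cong ≈-refl (-P-sound (normal f) (q ∷ ρ)))))
      (isZero-sound (every i (normal e) +P (-P normal f)) (q ∷ ρ) z)))))

unit-cancel : ∀ u {f g} → u 0 ≡ 1ℤ → u · f ≈ u · g → f ≈ g
unit-cancel u {f} {g} u0 h = begin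
  f             ≈⟨ solveWith ρ v2 (v1 :* (v0 :* v2)) (hyp (:- v2) (v0 :* v1) :one (inv-inverse u u0) done) refl ⟩
  inv u · (u · f) ≈⟨ ·-congˡ h ⟩
  inv u · (u · g) ≈⟨ solveWith ρ (v1 :* (v0 :* v3)) v3 (hyp v3 (v0 :* v1) :one (inv-inverse u u0) done) refl ⟩
  g             ∎
  where
  open ≈-Reasoning
  ρ : Vec Series 4
  ρ = u ∷ inv u ∷ f ∷ g ∷ []

·-constantTerm : ∀ f g → (f · g) 0 ≡ f 0 *ℤ g 0
·-constantTerm f g = ·-coeff f g 0

q-cancel : ∀ {f g} → q · f ≈ q · g → f ≈ g
q-cancel {f} {g} h = ext λ n → trans (sym (q·-suc f n)) (trans (coeff h (suc n)) (q·-suc g n))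

-- Dilation by 2, and J₂ as J₁(q²)

module E = Dilation 1

E : Series → Series
E = dil 2

E-≋ : ∀ {f g N} → f ≋[ N ] g → E f ≋[ N ] E g
E-≋ {f} {g} {N} h = upTo λ n n<N → go n n<N
  where
  go : ∀ n → n < N → E f n ≡ E g n
  go n n<N with n % 2 ≡ᵇ 0
  ... | true  = below h (n / 2) (ℕₚ.≤-<-trans (ℕₚ.m/n≤m n 2) n<N)
  ... | false = refl

Jtrunc-2 : ∀ M → Jtrunc 2 M ≈ E (Jtrunc 1 M)
Jtrunc-2 zero    = ≈-sym E.dil-one
Jtrunc-2 (suc M) = ≈-trans (Jtrunc-suc 1 M) (≈-sym (≈-trans (E.dil-cong (Jtrunc-suc 0 M)) (≈-trans (E.dil-· _ _)
  (·-cong (≈-sym (Jtrunc-2 M)) (≈-trans (E.dil-⊖ _ _) (⊖-cong E.dil-one (≈-trans (E.dil-mono (1 * suc M)) (mono-cong (lemma M)))))))))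
  where
  lemma : ∀ M → 1 * suc M * 2 ≡ 2 * suc M
  lemma = ℕSolver.solve-∀

J2≈E-J1 : J 2 ≈ E (J 1)
J2≈E-J1 = ≋⇒≈ λ N → ≋-weaken (ℕₚ.n≤1+n N)
  (≋-trans (J-approx 1 N) (≋-trans (≈⇒≋ (Jtrunc-2 N)) (E-≋ (≋-sym (J-approx 0 N)))))

-- Both sides are f(q¹⁰); they are compared by residues modulo 2 and then modulo 5, because a
-- dilation is evaluated on explicit residues.
E-D : ∀ f → E (D f) ≈ D (E f)
E-D f = ≈-sym (E.comp-ext λ
  { 0 _ → ≈-trans even (≈-sym (E.comp-0-dil (D f)))
  ; 1 _ → ≈-trans odd (≈-sym (E.comp-suc-dil (D f) 0 (s≤s (s≤s z≤n))))
  ; (suc (suc _)) (s≤s (s≤s ())) })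
  where
  at : ∀ {m} → ∀ r n → r + n * 5 ≡ m → D (E f) m ≡ D (E f) (r + n * 5)
  at r n refl = refl
  zero-at : ∀ {m} i n → suc i < 5 → suc i + n * 5 ≡ m → D (E f) m ≡ 0ℤ
  zero-at i n i<5 refl = D-other (E f) n i i<5
  <5 : ∀ {i} → i ≤ 4 → i < 5
  <5 = s≤s
  even : comp 2 0 (D (E f)) ≈ D f
  even = comp-ext₅
    (≈-trans (ext λ j → trans (at 0 (j * 2) (l0 j)) (trans (D-multiple (E f) (j * 2)) (E.dil-multiple f j))) (≈-sym (comp-0-dil f)))
    (≈-trans (ext λ j → zero-at 1 (j * 2) (<5 (s≤s (s≤s z≤n))) (l1 j)) (≈-sym (comp-suc-dil f 0 (<5 (s≤s z≤n)))))
    (≈-trans (ext λ j → zero-at 3 (j * 2) (<5 ℕₚ.≤-refl) (l2 j)) (≈-sym (comp-suc-dil f 1 (<5 (s≤s (s≤s z≤n))))))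
    (≈-trans (ext λ j → zero-at 0 (suc (j * 2)) (<5 (s≤s z≤n)) (l3 j)) (≈-sym (comp-suc-dil f 2 (<5 (s≤s (s≤s (s≤s z≤n)))))))
    (≈-trans (ext λ j → zero-at 2 (suc (j * 2)) (<5 (s≤s (s≤s (s≤s z≤n)))) (l4 j)) (≈-sym (comp-suc-dil f 3 (<5 ℕₚ.≤-refl))))
    where
    l0 : ∀ j → j * 2 * 5 ≡ (j * 5) * 2
    l0 = ℕSolver.solve-∀
    l1 : ∀ j → 2 + j * 2 * 5 ≡ (1 + j * 5) * 2
    l1 = ℕSolver.solve-∀
    l2 : ∀ j → 4 + j * 2 * 5 ≡ (2 + j * 5) * 2
    l2 = ℕSolver.solve-∀
    l3 : ∀ j → 1 + suc (j * 2) * 5 ≡ (3 + j * 5) * 2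
    l3 = ℕSolver.solve-∀
    l4 : ∀ j → 3 + suc (j * 2) * 5 ≡ (4 + j * 5) * 2
    l4 = ℕSolver.solve-∀
  odd : comp 2 1 (D (E f)) ≈ 0S
  odd = comp-ext₅
    (ext λ j → zero-at 0 (j * 2) (<5 (s≤s z≤n)) (l0 j))
    (ext λ j → zero-at 2 (j * 2) (<5 (s≤s (s≤s (s≤s z≤n)))) (l1 j))
    (ext λ j → trans (at 0 (suc (j * 2)) (l2 j)) (trans (D-multiple (E f) (suc (j * 2))) (E.dil-other f j 0 (s≤s (s≤s z≤n)))))
    (ext λ j → zero-at 1 (suc (j * 2)) (<5 (s≤s (s≤s z≤n))) (l3 j))
    (ext λ j → zero-at 3 (suc (j * 2)) (<5 ℕₚ.≤-refl) (l4 j))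
    where
    l0 : ∀ j → 1 + j * 2 * 5 ≡ 1 + (j * 5) * 2
    l0 = ℕSolver.solve-∀
    l1 : ∀ j → 3 + j * 2 * 5 ≡ 1 + (1 + j * 5) * 2
    l1 = ℕSolver.solve-∀
    l2 : ∀ j → suc (j * 2) * 5 ≡ 1 + (2 + j * 5) * 2
    l2 = ℕSolver.solve-∀
    l3 : ∀ j → 2 + suc (j * 2) * 5 ≡ 1 + (3 + j * 5) * 2
    l3 = ℕSolver.solve-∀
    l4 : ∀ j → 4 + suc (j * 2) * 5 ≡ 1 + (4 + j * 5) * 2
    l4 = ℕSolver.solve-∀

-- The 5-dissections of J₁, J₂ and psi

P₀ P₂ P₀' P₂' J₅ J₁₀ ψ₅ p g : Series
P₀  = comp 5 0 (J 1)
P₂  = ⊝ comp 5 2 (J 1)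
P₀' = E P₀
P₂' = E P₂
J₅  = D (J 1)
J₁₀ = D (J 2)
ψ₅  = D psi
p   = comp 5 0 psi
g   = comp 5 1 psi

0<5 : 0 < 5
0<5 = s≤s z≤n
1<5 : 1 < 5
1<5 = s≤s (s≤s z≤n)
2<5 : 2 < 5
2<5 = s≤s (s≤s (s≤s z≤n))
3<5 : 3 < 5
3<5 = s≤s (s≤s (s≤s (s≤s z≤n)))
4<5 : 4 < 5
4<5 = s≤s (s≤s (s≤s (s≤s (s≤s z≤n))))

J1-dissection : J 1 ≈ D P₀ ⊖ q · D J₅ ⊖ q ^S 2 · D P₂
J1-dissection = comp-ext₅
  (≈-sym (component 0 0<5 ρ e v1 refl))
  (≈-trans J1-1 (≈-sym (component 1 1<5 ρ e (:- v2) refl)))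
  (≈-sym (≈-trans (component 2 2<5 ρ e (:- v3) refl) (ext λ n → trans (⊝-coeff P₂ n) (trans (cong -_ (⊝-coeff (comp 5 2 (J 1)) n)) (ℤₚ.neg-involutive _)))))
  (≈-trans J1-3 (≈-sym (≈-trans (component 3 3<5 ρ e (con 0ℤ) refl) constant-0)))
  (≈-trans J1-4 (≈-sym (≈-trans (component 4 4<5 ρ e (con 0ℤ) refl) constant-0)))
  where
  ρ : Vec Series 3
  ρ = P₀ ∷ J₅ ∷ P₂ ∷ []
  e : Expr 4
  e = v1 :- v0 :* v2 :- v0 :^ 2 :* v3

psi-dissection : psi ≈ D p ⊕ q · D g ⊕ q ^S 3 · D ψ₅
psi-dissection = comp-ext₅
  (≈-sym (component 0 0<5 ρ e v1 refl))
  (≈-sym (component 1 1<5 ρ e v2 refl))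
  (≈-trans psi-2 (≈-sym (≈-trans (component 2 2<5 ρ e (con 0ℤ) refl) constant-0)))
  (≈-trans psi-3 (≈-sym (component 3 3<5 ρ e v3 refl)))
  (≈-trans psi-4 (≈-sym (≈-trans (component 4 4<5 ρ e (con 0ℤ) refl) constant-0)))
  where
  ρ : Vec Series 3
  ρ = p ∷ g ∷ ψ₅ ∷ []
  e : Expr 4
  e = v1 :+ v0 :* v2 :+ v0 :^ 3 :* v3

E-q : E q ≈ q ^S 2
E-q = ≈-trans (E.dil-mono 1) (mono-^ 2)

E-q² : E (q ^S 2) ≈ q ^S 4
E-q² = ≈-trans (E.dil-cong (≈-sym (mono-^ 2))) (≈-trans (E.dil-mono 2) (mono-^ 4))

E-J₅ : E J₅ ≈ J₁₀
E-J₅ = ≈-trans (E-D (J 1)) (D-cong (≈-sym J2≈E-J1))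

J2-dissection : J 2 ≈ D P₀' ⊖ q ^S 2 · D J₁₀ ⊖ q ^S 4 · D P₂'
J2-dissection = ≈-trans J2≈E-J1 (≈-trans (E.dil-cong J1-dissection) (≈-trans (E.dil-⊖ _ _) (⊖-cong
  (≈-trans (E.dil-⊖ _ _) (⊖-cong (E-D P₀) (≈-trans (E.dil-· _ _) (·-cong E-q (≈-trans (E-D J₅) (D-cong E-J₅))))))
  (≈-trans (E.dil-· _ _) (·-cong E-q² (E-D P₂))))))

-- The five components of J₁ ψ = J₂²

module _ where
  private
    ρ : Vec Series 6
    ρ = P₀ ∷ J₅ ∷ P₂ ∷ p ∷ g ∷ ψ₅ ∷ []
    ρ' : Vec Series 3
    ρ' = P₀' ∷ J₁₀ ∷ P₂' ∷ []
    e : Expr 7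
    e = (v1 :- v0 :* v2 :- v0 :^ 2 :* v3) :* (v4 :+ v0 :* v5 :+ v0 :^ 3 :* v6)
    e' : Expr 4
    e' = (v1 :- v0 :^ 2 :* v2 :- v0 :^ 4 :* v3) :* (v1 :- v0 :^ 2 :* v2 :- v0 :^ 4 :* v3)
    dissected : eval e (q ∷ map D ρ) ≈ eval e' (q ∷ map D ρ')
    dissected = ≈-trans (≈-sym (·-cong J1-dissection psi-dissection)) (≈-trans J1·psi (·-cong J2-dissection J2-dissection))

  relation₀ : P₀ · p ⊖ q · (P₂ · ψ₅) ≈ P₀' · P₀'
  relation₀ = ≈-trans (≈-sym (component 0 0<5 ρ e (v1 :* v4 :- v0 :* (v3 :* v6)) refl))
    (≈-trans (comp-cong 0 dissected) (component 0 0<5 ρ' e' (v1 :* v1) refl))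

  relation₁ : P₀ · g ⊖ J₅ · p ≈ constant (+ 2) · (q · (J₁₀ · P₂'))
  relation₁ = ≈-trans (≈-sym (component 1 1<5 ρ e (v1 :* v5 :- v2 :* v4) refl))
    (≈-trans (comp-cong 1 dissected) (component 1 1<5 ρ' e' (# 2 :* (v0 :* (v2 :* v3))) refl))

  relation₂ : P₂ · p ⊕ J₅ · g ≈ constant (+ 2) · (P₀' · J₁₀)
  relation₂ = ≈-trans (decide (p ∷ g ∷ P₂ ∷ J₅ ∷ []) (v2 :* v0 :+ v3 :* v1) (:- (:- (v2 :* v0 :+ v3 :* v1))) refl)
    (≈-trans (⊝-cong (≈-trans (≈-sym (component 2 2<5 ρ e (:- (v3 :* v4 :+ v2 :* v5)) refl))
      (≈-trans (comp-cong 2 dissected) (component 2 2<5 ρ' e' (:- (# 2 :* (v1 :* v2))) refl))))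
    (decide (P₀' ∷ J₁₀ ∷ []) (:- (:- (# 2 :* (v0 :* v1)))) (# 2 :* (v0 :* v1)) refl))

  relation₃ : P₀ · ψ₅ ⊖ P₂ · g ≈ q · (P₂' · P₂')
  relation₃ = ≈-trans (≈-sym (component 3 3<5 ρ e (v1 :* v6 :- v3 :* v5) refl))
    (≈-trans (comp-cong 3 dissected) (component 3 3<5 ρ' e' (v0 :* (v3 :* v3)) refl))

  relation₄ : ⊝ (J₅ · ψ₅) ≈ J₁₀ · J₁₀ ⊖ constant (+ 2) · (P₀' · P₂')
  relation₄ = ≈-trans (≈-sym (component 4 4<5 ρ e (:- (v2 :* v6)) refl))
    (≈-trans (comp-cong 4 dissected) (component 4 4<5 ρ' e' (v2 :* v2 :- # 2 :* (v1 :* v3)) refl))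

J₅ψ₅ : J₅ · ψ₅ ≈ J₁₀ · J₁₀
J₅ψ₅ = ≈-trans (≈-sym (D-· (J 1) psi)) (≈-trans (D-cong J1·psi) (D-· (J 2) (J 2)))

constant-cancel : ∀ c .{{_ : Data.Integer.NonZero c}} {f g} → constant c · f ≈ constant c · g → f ≈ g
constant-cancel c {f} {g} h = ext λ n → ℤₚ.*-cancelˡ-≡ c (f n) (g n)
  (trans (sym (constant-· c f n)) (trans (coeff h n) (constant-· c g n)))

-- The identity J₁ ψ = J₂² at q⁵ turns the left side of `relation₄` into -J₁₀², whence 2 P₀' P₂' = 2
-- J₁₀².
P₀'P₂' : P₀' · P₂' ≈ J₁₀ · J₁₀
P₀'P₂' = constant-cancel (+ 2) (solveWith (P₀' ∷ P₂' ∷ J₁₀ ∷ J₅ ∷ ψ₅ ∷ []) (# 2 :* (v0 :* v1)) (# 2 :* (v2 :* v2))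
  (hyp :one (:- (v3 :* v4)) (v2 :* v2 :- # 2 :* (v0 :* v1)) relation₄
  (hyp :one (v3 :* v4) (v2 :* v2) J₅ψ₅ done)) refl)

-- This is the preceding identity with q² replaced by q, as E is injective. It makes the outer two
-- parts of the dissection reciprocal once they are divided by the middle one.
P₀P₂ : P₀ · P₂ ≈ J₅ · J₅
P₀P₂ = E.dil-injective (≈-trans (E.dil-· P₀ P₂) (≈-trans P₀'P₂'
  (≈-sym (≈-trans (E.dil-· J₅ J₅) (·-cong E-J₅ E-J₅)))))

J₅-0 : J₅ 0 ≡ 1ℤ
J₅-0 = refl
J₁₀-0 : J₁₀ 0 ≡ 1ℤ
J₁₀-0 = refl
ψ₅-0 : ψ₅ 0 ≡ 1ℤ
ψ₅-0 = refl

-- The dissections divided by their middle terms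

ι₅ ι₁₀ ιψ : Series
ι₅  = inv J₅
ι₁₀ = inv J₁₀
ιψ  = inv ψ₅

ρ ρ⁻ σ σ⁻ p̂ ĝ : Series
ρ  = P₂ · ι₅
ρ⁻ = P₀ · ι₅
σ  = P₂' · ι₁₀
σ⁻ = P₀' · ι₁₀
p̂  = p · ιψ
ĝ  = g · ιψ

module _ where
  private
    env : Vec Series 13
    env = q ∷ P₀ ∷ P₂ ∷ P₀' ∷ P₂' ∷ J₅ ∷ J₁₀ ∷ p ∷ g ∷ ψ₅ ∷ ι₅ ∷ ι₁₀ ∷ ιψ ∷ []
    unit₅ : J₅ · ι₅ ≈ one
    unit₅ = inv-inverse J₅ J₅-0
    unit₁₀ : J₁₀ · ι₁₀ ≈ one
    unit₁₀ = inv-inverse J₁₀ J₁₀-0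
    unitψ : ψ₅ · ιψ ≈ one
    unitψ = inv-inverse ψ₅ ψ₅-0
    -- The reciprocal of J₅ ψ₅ = J₁₀²: the products on the two sides of each relation acquire the
    -- same denominator.
    ι-relation : ι₁₀ · ι₁₀ ≈ ιψ · ι₅
    ι-relation = solveWith (J₅ ∷ J₁₀ ∷ ψ₅ ∷ ι₅ ∷ ι₁₀ ∷ ιψ ∷ []) (v4 :* v4) (v5 :* v3)
      (hyp (:- (v4 :* v4)) (v2 :* v5) :one unitψ
      (hyp (:- (v4 :* v4 :* v2 :* v5)) (v0 :* v3) :one unit₅
      (hyp (v4 :* v4 :* v3 :* v5) (v0 :* v2) (v1 :* v1) J₅ψ₅
      (hyp (v3 :* v5 :* (v1 :* v4 :+ :one)) (v1 :* v4) :one unit₁₀ done)))) refl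

  ρ-inverse : ρ · ρ⁻ ≈ one
  ρ-inverse = solveWith env ((v2 :* v10) :* (v1 :* v10)) :one
    (hyp (v10 :* v10) (v1 :* v2) (v5 :* v5) P₀P₂ (hyp (v5 :* v10 :+ :one) (v5 :* v10) :one unit₅ done)) refl

  σ-inverse : σ · σ⁻ ≈ one
  σ-inverse = solveWith env ((v4 :* v11) :* (v3 :* v11)) :one
    (hyp (v11 :* v11) (v3 :* v4) (v6 :* v6) P₀'P₂' (hyp (v6 :* v11 :+ :one) (v6 :* v11) :one unit₁₀ done)) refl

  normalised₀ : p̂ · ρ⁻ ⊖ q · ρ ≈ σ⁻ · σ⁻
  normalised₀ = solveWith env ((v7 :* v12) :* (v1 :* v10) :- v0 :* (v2 :* v10)) ((v3 :* v11) :* (v3 :* v11))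
    (hyp (v12 :* v10) (v1 :* v7 :- v0 :* (v2 :* v9)) (v3 :* v3) relation₀
    (hyp (v0 :* v2 :* v10) (v9 :* v12) :one unitψ
    (hyp (:- (v3 :* v3)) (v11 :* v11) (v12 :* v10) ι-relation done))) refl

  normalised₁ : ĝ · ρ⁻ ⊖ p̂ ≈ constant (+ 2) · (q · σ)
  normalised₁ = solveWith env ((v8 :* v12) :* (v1 :* v10) :- v7 :* v12) (# 2 :* (v0 :* (v4 :* v11)))
    (hyp (v12 :* v10) (v1 :* v8 :- v5 :* v7) (# 2 :* (v0 :* (v6 :* v4))) relation₁
    (hyp (v7 :* v12) (v5 :* v10) :one unit₅
    (hyp (:- (# 2 :* v0 :* v4 :* v6)) (v11 :* v11) (v12 :* v10) ι-relation
    (hyp (# 2 :* v0 :* v4 :* v11) (v6 :* v11) :one unit₁₀ done)))) refl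

  normalised₂ : p̂ · ρ ⊕ ĝ ≈ constant (+ 2) · σ⁻
  normalised₂ = solveWith env ((v7 :* v12) :* (v2 :* v10) :+ v8 :* v12) (# 2 :* (v3 :* v11))
    (hyp (v12 :* v10) (v2 :* v7 :+ v5 :* v8) (# 2 :* (v3 :* v6)) relation₂
    (hyp (:- (v8 :* v12)) (v5 :* v10) :one unit₅
    (hyp (:- (# 2 :* v3 :* v6)) (v11 :* v11) (v12 :* v10) ι-relation
    (hyp (# 2 :* v3 :* v11) (v6 :* v11) :one unit₁₀ done)))) refl

  normalised₃ : ρ⁻ ⊖ ĝ · ρ ≈ q · (σ · σ)
  normalised₃ = solveWith env (v1 :* v10 :- (v8 :* v12) :* (v2 :* v10)) (v0 :* ((v4 :* v11) :* (v4 :* v11)))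
    (hyp (v12 :* v10) (v1 :* v9 :- v2 :* v8) (v0 :* (v4 :* v4)) relation₃
    (hyp (:- (v1 :* v10)) (v9 :* v12) :one unitψ
    (hyp (:- (v0 :* v4 :* v4)) (v11 :* v11) (v12 :* v10) ι-relation done))) refl

module _ where
  private
    env : Vec Series 7
    env = q ∷ ρ ∷ ρ⁻ ∷ σ ∷ σ⁻ ∷ p̂ ∷ ĝ ∷ []

  p̂-formula : p̂ ≈ ρ · σ⁻ ^S 2 ⊕ q · ρ ^S 2
  p̂-formula = solveWith env v5 (v1 :* v4 :^ 2 :+ v0 :* v1 :^ 2)
    (hyp v1 (v5 :* v2 :- v0 :* v1) (v4 :* v4) normalised₀
    (hyp (:- v5) (v1 :* v2) :one ρ-inverse done)) refl

  ĝ-formula : ĝ ≈ ρ⁻ ^S 2 ⊖ q · σ ^S 2 · ρ⁻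
  ĝ-formula = solveWith env v6 (v2 :^ 2 :- v0 :* v3 :^ 2 :* v2)
    (hyp (:- v2) (v2 :- v6 :* v1) (v0 :* (v3 :* v3)) normalised₃
    (hyp (:- v6) (v1 :* v2) :one ρ-inverse done)) refl

  -- Ramanujan's relation between R(q) and R(q²); in his notation q^{1/5} ρ = R(q) and q^{2/5} σ = R(q²)
  ρσ-relation : σ ≈ ρ ^S 2 ⊕ q · ρ · σ ^S 2 · (σ ⊕ ρ ^S 2)
  ρσ-relation = constant-cancel (+ 2) (solveWith env (# 2 :* v3) (# 2 :* (v1 :^ 2 :+ v0 :* v1 :* v3 :^ 2 :* (v3 :+ v1 :^ 2)))
    (hyp (:- (v3 :^ 2)) (v5 :* v1 :+ v6) (# 2 :* v4) normalised₂
    (hyp (v3 :^ 2 :* v1) (v6 :* v2 :- v5) (# 2 :* (v0 :* v3)) normalised₁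
    (hyp (# 2 :* v1 :* v3 :^ 2) v5 (v1 :* v4 :^ 2 :+ v0 :* v1 :^ 2) p̂-formula
    (hyp (:- (v3 :^ 2 :* v6)) (v1 :* v2) :one ρ-inverse
    (hyp (# 2 :* v1 :^ 2 :* (v3 :* v4 :+ :one) :- # 2 :* v3) (v3 :* v4) :one σ-inverse done))))) refl)

inverse-cancel : ∀ {u v f g} → u · v ≈ one → u · f ≈ u · g → f ≈ g
inverse-cancel {u} {v} {f} {g} uv h = solveWith (u ∷ v ∷ f ∷ g ∷ []) v2 v3
  (hyp (:- v2 :+ v3) (v0 :* v1) :one uv (hyp v1 (v0 :* v2) (v0 :* v3) h done)) refl

inverse-· : ∀ {u v u' v'} → u · v ≈ one → u' · v' ≈ one → (u · u') · (v · v') ≈ one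
inverse-· {u} {v} {u'} {v'} h h' = solveWith (u ∷ v ∷ u' ∷ v' ∷ []) ((v0 :* v2) :* (v1 :* v3)) :one
  (hyp (v2 :* v3) (v0 :* v1) :one h (hyp :one (v2 :* v3) :one h' done)) refl

inverse-^ : ∀ n {u v} → u · v ≈ one → u ^S n · v ^S n ≈ one
inverse-^ zero    h = ·-identityˡ one
inverse-^ (suc n) h = inverse-· h (inverse-^ n h)

J₂₅ J₅₀ ψ₂₅ R R⁻ S S⁻ X W : Series
J₂₅ = D J₅
J₅₀ = D J₁₀
ψ₂₅ = D ψ₅
R   = D ρ
R⁻  = D ρ⁻
S   = D σ
S⁻  = D σ⁻
X   = D p̂
W   = D ĝ

R-inverse : R · R⁻ ≈ one
R-inverse = ≈-trans (≈-sym (D-· ρ ρ⁻)) (≈-trans (D-cong ρ-inverse) D-one)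

S-inverse : S · S⁻ ≈ one
S-inverse = ≈-trans (≈-sym (D-· σ σ⁻)) (≈-trans (D-cong σ-inverse) D-one)

module _ where
  private
    env : Vec Series 5
    env = q ∷ ρ ∷ ρ⁻ ∷ σ ∷ σ⁻ ∷ []

  X-formula : X ≈ R · S⁻ ^S 2 ⊕ q ^S 5 · R ^S 2
  X-formula = ≈-trans (D-cong p̂-formula) (≈-trans (D-eval (v1 :* v4 :^ 2 :+ v0 :* v1 :^ 2) env)
    (⊕-cong ≈-refl (·-congʳ D-q)))

  W-formula : W ≈ R⁻ ^S 2 ⊖ q ^S 5 · S ^S 2 · R⁻
  W-formula = ≈-trans (D-cong ĝ-formula) (≈-trans (D-eval (v2 :^ 2 :- v0 :* v3 :^ 2 :* v2) env)
    (⊖-cong ≈-refl (·-congʳ (·-congʳ D-q))))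

  RS-relation : S ≈ R ^S 2 ⊕ q ^S 5 · R · S ^S 2 · (S ⊕ R ^S 2)
  RS-relation = ≈-trans (D-cong ρσ-relation) (≈-trans (D-eval (v1 :^ 2 :+ v0 :* v1 :* v3 :^ 2 :* (v3 :+ v1 :^ 2)) env)
    (⊕-cong ≈-refl (·-congʳ (·-congʳ (·-congʳ D-q)))))

-- J₁/J₂₅ = q(1/r − 1 − r) and J₂/J₅₀ = q²(1/s − 1 − s) with r = qR, s = q²S

â b̂ ψ̂ V̂ Δ : Series
â = R⁻ ⊖ q ⊖ q ^S 2 · R
b̂ = S⁻ ⊖ q ^S 2 ⊖ q ^S 4 · S
ψ̂ = X ⊕ q · W ⊕ q ^S 3
V̂ = X · W ⊕ q ^S 5
Δ = X · W ⊖ constant (+ 4) · q ^S 5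

D-factor : ∀ {f u} → u 0 ≡ 1ℤ → D f ≈ D u · D (f · inv u)
D-factor {f} {u} u0 = ≈-trans (D-cong (solveWith (u ∷ inv u ∷ f ∷ []) v2 (v0 :* (v2 :* v1)) (hyp (:- v2) (v0 :* v1) :one (inv-inverse u u0) done) refl))
  (D-· u (f · inv u))

J1-factor : J 1 ≈ J₂₅ · â
J1-factor = ≈-trans J1-dissection (≈-trans
  (⊖-cong (⊖-cong (D-factor {P₀} {J₅} J₅-0) ≈-refl) (·-congˡ (D-factor {P₂} {J₅} J₅-0)))
  (decide (q ∷ J₂₅ ∷ R⁻ ∷ R ∷ []) (v1 :* v2 :- v0 :* v1 :- v0 :^ 2 :* (v1 :* v3)) (v1 :* (v2 :- v0 :- v0 :^ 2 :* v3)) refl))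

J2-factor : J 2 ≈ J₅₀ · b̂
J2-factor = ≈-trans J2-dissection (≈-trans
  (⊖-cong (⊖-cong (D-factor {P₀'} {J₁₀} J₁₀-0) ≈-refl) (·-congˡ (D-factor {P₂'} {J₁₀} J₁₀-0)))
  (decide (q ∷ J₅₀ ∷ S⁻ ∷ S ∷ []) (v1 :* v2 :- v0 :^ 2 :* v1 :- v0 :^ 4 :* (v1 :* v3)) (v1 :* (v2 :- v0 :^ 2 :- v0 :^ 4 :* v3)) refl))

psi-factor : psi ≈ ψ₂₅ · ψ̂
psi-factor = ≈-trans psi-dissection (≈-trans
  (⊕-cong (⊕-cong (D-factor {p} {ψ₅} ψ₅-0) (·-congˡ (D-factor {g} {ψ₅} ψ₅-0))) ≈-refl)
  (decide (q ∷ ψ₂₅ ∷ X ∷ W ∷ []) (v1 :* v2 :+ v0 :* (v1 :* v3) :+ v0 :^ 3 :* v1) (v1 :* (v2 :+ v0 :* v3 :+ v0 :^ 3)) refl))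

â-0 : â 0 ≡ 1ℤ
â-0 = trans (sym (trans (·-constantTerm J₂₅ â) (ℤₚ.*-identityˡ (â 0)))) (sym (coeff J1-factor 0))

b̂-0 : b̂ 0 ≡ 1ℤ
b̂-0 = trans (sym (trans (·-constantTerm J₅₀ b̂) (ℤₚ.*-identityˡ (b̂ 0)))) (sym (coeff J2-factor 0))

-- J₁ ψ = J₂² divided by the same identity at q²⁵.
psi-â : psi · â ≈ ψ₂₅ · (b̂ · b̂)
psi-â = unit-cancel J₂₅ refl (solveWith (J₂₅ ∷ J₅₀ ∷ psi ∷ ψ₂₅ ∷ â ∷ b̂ ∷ J 1 ∷ J 2 ∷ [])
  (v0 :* (v2 :* v4)) (v0 :* (v3 :* (v5 :* v5)))
  (hyp (:- v2) v6 (v0 :* v4) J1-factor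
  (hyp :one (v6 :* v2) (v7 :* v7) J1·psi
  (hyp (v7 :+ v1 :* v5) v7 (v1 :* v5) J2-factor
  (hyp (:- (v5 :* v5)) (v0 :* v3) (v1 :* v1) (≈-trans (≈-sym (D-· J₅ ψ₅)) (≈-trans (D-cong J₅ψ₅) (D-· J₁₀ J₁₀))) done)))) refl)

pg-factor : D (p · g) ≈ ψ₂₅ · ψ₂₅ · (X · W)
pg-factor = ≈-trans (D-· p g) (≈-trans (·-cong (D-factor {p} {ψ₅} ψ₅-0) (D-factor {g} {ψ₅} ψ₅-0))
  (decide (ψ₂₅ ∷ X ∷ W ∷ []) (v0 :* v1 :* (v0 :* v2)) (v0 :* v0 :* (v1 :* v2)) refl))

-- `psi-product` at q⁵, where the product of the two components is ψ₂₅² X W.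
ψ₅²-factor : ψ₅ · ψ₅ ≈ ψ₂₅ · ψ₂₅ · V̂
ψ₅²-factor = solveWith (ψ₅ ∷ ψ₂₅ ∷ X ∷ W ∷ q ∷ D (p · g) ∷ []) (v0 :* v0) (v1 :* v1 :* (v2 :* v3 :+ v4 :^ 5))
  (hyp :one v5 (v1 :* v1 :* (v2 :* v3)) pg-factor
  (hyp (:- :one) v5 (v0 :* v0 :- v4 :^ 5 :* (v1 :* v1)) D-product done)) refl
  where
  D-product : D (p · g) ≈ ψ₅ · ψ₅ ⊖ q ^S 5 · (ψ₂₅ · ψ₂₅)
  D-product = ≈-trans (D-cong psi-product) (≈-trans (D-eval (v0 :* v0 :- v1 :* (v2 :* v2)) (psi ∷ q ∷ D psi ∷ []))
    (⊖-cong ≈-refl (·-congʳ D-q)))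

-- After clearing denominators both identities are polynomial in q, R, S and hold modulo RS-relation;
-- the cofactor is the quotient of the difference of the two sides by that relation.

module _ where
  private
    a' b' z' ψ' : Expr 3
    a' = :one :- v0 :* v1 :- v0 :^ 2 :* v1 :^ 2
    b' = :one :- v0 :^ 2 :* v2 :- v0 :^ 4 :* v2 :^ 2
    z' = :one :- v0 :^ 10 :* v1 :^ 2 :* v2 :^ 4
    ψ' = v1 :^ 2 :* (v1 :+ v0 :^ 5 :* v1 :^ 2 :* v2 :^ 2) :+ v0 :* v2 :^ 2 :* (:one :- v0 :^ 5 :* v1 :* v2 :^ 2) :+ v0 :^ 3 :* v1 :^ 2 :* v2 :^ 2
    env : Vec Series 3
    env = q ∷ R ∷ S ∷ []
    full : Vec Series 7
    full = q ∷ R ∷ S ∷ R⁻ ∷ S⁻ ∷ X ∷ W ∷ []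
    Râ : R · â ≈ eval a' env
    Râ = solveWith full (v1 :* (v3 :- v0 :- v0 :^ 2 :* v1)) (:one :- v0 :* v1 :- v0 :^ 2 :* v1 :^ 2) (hyp :one (v1 :* v3) :one R-inverse done) refl
    Sb̂ : S · b̂ ≈ eval b' env
    Sb̂ = solveWith full (v2 :* (v4 :- v0 :^ 2 :- v0 :^ 4 :* v2)) (:one :- v0 :^ 2 :* v2 :- v0 :^ 4 :* v2 :^ 2) (hyp :one (v2 :* v4) :one S-inverse done) refl
    S²X : S ^S 2 · X ≈ R ⊕ q ^S 5 · R ^S 2 · S ^S 2
    S²X = solveWith full (v2 :^ 2 :* v5) (v1 :+ v0 :^ 5 :* v1 :^ 2 :* v2 :^ 2)
      (hyp (v2 :^ 2) v5 (v1 :* v4 :^ 2 :+ v0 :^ 5 :* v1 :^ 2) X-formula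
      (hyp (v1 :* (v2 :* v4 :+ :one)) (v2 :* v4) :one S-inverse done)) refl
    R²W : R ^S 2 · W ≈ one ⊖ q ^S 5 · R · S ^S 2
    R²W = solveWith full (v1 :^ 2 :* v6) (:one :- v0 :^ 5 :* v1 :* v2 :^ 2)
      (hyp (v1 :^ 2) v6 (v3 :^ 2 :- v0 :^ 5 :* v2 :^ 2 :* v3) W-formula
      (hyp (v1 :* v3 :+ :one :- v0 :^ 5 :* v1 :* v2 :^ 2) (v1 :* v3) :one R-inverse done)) refl
    RS²XW : R · S ^S 2 · (X · W) ≈ eval z' env
    RS²XW = inverse-cancel R-inverse (solveWith full (v1 :* (v1 :* v2 :^ 2 :* (v5 :* v6))) (v1 :* (:one :- v0 :^ 10 :* v1 :^ 2 :* v2 :^ 4))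
      (hyp (v1 :^ 2 :* v6) (v2 :^ 2 :* v5) (v1 :+ v0 :^ 5 :* v1 :^ 2 :* v2 :^ 2) S²X
      (hyp (v1 :+ v0 :^ 5 :* v1 :^ 2 :* v2 :^ 2) (v1 :^ 2 :* v6) (:one :- v0 :^ 5 :* v1 :* v2 :^ 2) R²W done)) refl)
    R²S²ψ̂ : R ^S 2 · S ^S 2 · ψ̂ ≈ eval ψ' env
    R²S²ψ̂ = solveWith full (v1 :^ 2 :* v2 :^ 2 :* (v5 :+ v0 :* v6 :+ v0 :^ 3))
      (v1 :^ 2 :* (v1 :+ v0 :^ 5 :* v1 :^ 2 :* v2 :^ 2) :+ v0 :* v2 :^ 2 :* (:one :- v0 :^ 5 :* v1 :* v2 :^ 2) :+ v0 :^ 3 :* v1 :^ 2 :* v2 :^ 2)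
      (hyp (v1 :^ 2) (v2 :^ 2 :* v5) (v1 :+ v0 :^ 5 :* v1 :^ 2 :* v2 :^ 2) S²X
      (hyp (v0 :* v2 :^ 2) (v1 :^ 2 :* v6) (:one :- v0 :^ 5 :* v1 :* v2 :^ 2) R²W done)) refl

  identity₁ : b̂ · Δ ≈ â · (ψ̂ · ψ̂ ⊖ q · V̂)
  identity₁ = inverse-cancel (inverse-· (inverse-^ 5 R-inverse) (inverse-^ 4 S-inverse)) (begin
    R ^S 5 · S ^S 4 · (b̂ · Δ)
      ≈⟨ decide (q ∷ R ∷ S ∷ b̂ ∷ X · W ∷ []) (v1 :^ 5 :* v2 :^ 4 :* (v3 :* (v4 :- # 4 :* v0 :^ 5)))
           (v1 :^ 4 :* v2 :* (v2 :* v3) :* (v1 :* v2 :^ 2 :* v4 :- # 4 :* v0 :^ 5 :* v1 :* v2 :^ 2)) refl ⟩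
    R ^S 4 · S · (S · b̂) · (R · S ^S 2 · (X · W) ⊖ constant (+ 4) · q ^S 5 · R · S ^S 2)
      ≈⟨ ·-cong (·-congˡ Sb̂) (⊖-cong RS²XW ≈-refl) ⟩
    eval (v1 :^ 4 :* v2 :* b' :* (z' :- # 4 :* v0 :^ 5 :* v1 :* v2 :^ 2)) env
      ≈⟨ solveWith env (v1 :^ 4 :* v2 :* b' :* (z' :- # 4 :* v0 :^ 5 :* v1 :* v2 :^ 2))
           (a' :* (ψ' :* ψ' :- v0 :* v1 :^ 3 :* v2 :^ 2 :* (z' :+ v0 :^ 5 :* v1 :* v2 :^ 2)))
           (hyp cofactor v2 (v1 :^ 2 :+ v0 :^ 5 :* v1 :* v2 :^ 2 :* (v2 :+ v1 :^ 2)) RS-relation done) refl ⟩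
    eval (a' :* (ψ' :* ψ' :- v0 :* v1 :^ 3 :* v2 :^ 2 :* (z' :+ v0 :^ 5 :* v1 :* v2 :^ 2))) env
      ≈⟨ ≈-sym (·-cong Râ (⊖-cong (·-cong R²S²ψ̂ R²S²ψ̂) (·-congˡ (⊕-cong RS²XW ≈-refl)))) ⟩
    (R · â) · ((R ^S 2 · S ^S 2 · ψ̂) · (R ^S 2 · S ^S 2 · ψ̂) ⊖ q · R ^S 3 · S ^S 2 · (R · S ^S 2 · (X · W) ⊕ q ^S 5 · R · S ^S 2))
      ≈⟨ decide (q ∷ R ∷ S ∷ â ∷ ψ̂ ∷ X · W ∷ [])
           ((v1 :* v3) :* ((v1 :^ 2 :* v2 :^ 2 :* v4) :* (v1 :^ 2 :* v2 :^ 2 :* v4) :- v0 :* v1 :^ 3 :* v2 :^ 2 :* (v1 :* v2 :^ 2 :* v5 :+ v0 :^ 5 :* v1 :* v2 :^ 2)))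
           (v1 :^ 5 :* v2 :^ 4 :* (v3 :* (v4 :* v4 :- v0 :* (v5 :+ v0 :^ 5)))) refl ⟩
    R ^S 5 · S ^S 4 · (â · (ψ̂ · ψ̂ ⊖ q · V̂)) ∎)
    where
    open ≈-Reasoning
    cofactor : Expr 3
    cofactor = v1 :^ 4 :- v0 :* v1 :^ 3 :* v2 :- v0 :* v1 :^ 5 :- v0 :^ 2 :* v2 :^ 3 :- v0 :^ 2 :* v1 :^ 2 :* v2 :^ 2
      :- v0 :^ 2 :* v1 :^ 4 :* v2 :- v0 :^ 2 :* v1 :^ 6 :+ v0 :^ 3 :* v1 :* v2 :^ 3 :+ v0 :^ 3 :* v1 :^ 3 :* v2 :^ 2
      :- v0 :^ 4 :* v1 :^ 2 :* v2 :^ 3 :- # 2 :* v0 :^ 4 :* v1 :^ 4 :* v2 :^ 2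
      :+ # 2 :* v0 :^ 5 :* v1 :^ 3 :* v2 :^ 3 :- v0 :^ 5 :* v1 :^ 5 :* v2 :^ 2 :+ v0 :^ 6 :* v1 :^ 4 :* v2 :^ 3
      :- v0 :^ 6 :* v1 :^ 6 :* v2 :^ 2 :+ v0 :^ 7 :* v1 :* v2 :^ 5 :- v0 :^ 7 :* v1 :^ 3 :* v2 :^ 4
      :+ v0 :^ 7 :* v1 :^ 5 :* v2 :^ 3 :- v0 :^ 7 :* v1 :^ 7 :* v2 :^ 2 :- v0 :^ 8 :* v1 :^ 2 :* v2 :^ 5
      :+ v0 :^ 8 :* v1 :^ 4 :* v2 :^ 4 :- v0 :^ 9 :* v1 :^ 3 :* v2 :^ 5

  identity₂ : â ^S 3 · (X · W) ≈ b̂ · (ψ̂ · ψ̂ ⊖ constant (+ 5) · (q · V̂))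
  identity₂ = inverse-cancel (inverse-· (inverse-^ 4 R-inverse) (inverse-^ 5 S-inverse)) (begin
    R ^S 4 · S ^S 5 · (â ^S 3 · (X · W))
      ≈⟨ decide (R ∷ S ∷ â ∷ X · W ∷ []) (v0 :^ 4 :* v1 :^ 5 :* (v2 :^ 3 :* v3)) (v1 :^ 3 :* (v0 :* v2) :^ 3 :* (v0 :* v1 :^ 2 :* v3)) refl ⟩
    S ^S 3 · (R · â) ^S 3 · (R · S ^S 2 · (X · W))
      ≈⟨ ·-cong (·-congˡ (^S-cong 3 Râ)) RS²XW ⟩
    eval (v2 :^ 3 :* a' :^ 3 :* z') env
      ≈⟨ solveWith env (v2 :^ 3 :* a' :^ 3 :* z')
           (b' :* (ψ' :* ψ' :- # 5 :* v0 :* v1 :^ 3 :* v2 :^ 2 :* (z' :+ v0 :^ 5 :* v1 :* v2 :^ 2)))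
           (hyp cofactor v2 (v1 :^ 2 :+ v0 :^ 5 :* v1 :* v2 :^ 2 :* (v2 :+ v1 :^ 2)) RS-relation done) refl ⟩
    eval (b' :* (ψ' :* ψ' :- # 5 :* v0 :* v1 :^ 3 :* v2 :^ 2 :* (z' :+ v0 :^ 5 :* v1 :* v2 :^ 2))) env
      ≈⟨ ≈-sym (·-cong Sb̂ (⊖-cong (·-cong R²S²ψ̂ R²S²ψ̂) (·-congˡ (⊕-cong RS²XW ≈-refl)))) ⟩
    (S · b̂) · ((R ^S 2 · S ^S 2 · ψ̂) · (R ^S 2 · S ^S 2 · ψ̂) ⊖ constant (+ 5) · q · R ^S 3 · S ^S 2 · (R · S ^S 2 · (X · W) ⊕ q ^S 5 · R · S ^S 2))
      ≈⟨ decide (q ∷ R ∷ S ∷ b̂ ∷ ψ̂ ∷ X · W ∷ [])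
           ((v2 :* v3) :* ((v1 :^ 2 :* v2 :^ 2 :* v4) :* (v1 :^ 2 :* v2 :^ 2 :* v4) :- # 5 :* v0 :* v1 :^ 3 :* v2 :^ 2 :* (v1 :* v2 :^ 2 :* v5 :+ v0 :^ 5 :* v1 :* v2 :^ 2)))
           (v1 :^ 4 :* v2 :^ 5 :* (v3 :* (v4 :* v4 :- # 5 :* (v0 :* (v5 :+ v0 :^ 5))))) refl ⟩
    R ^S 4 · S ^S 5 · (b̂ · (ψ̂ · ψ̂ ⊖ constant (+ 5) · (q · V̂))) ∎)
    where
    open ≈-Reasoning
    cofactor : Expr 3
    cofactor = v2 :^ 2 :+ v1 :^ 2 :* v2 :+ v1 :^ 4 :- # 3 :* v0 :* v1 :* v2 :^ 2 :- v0 :^ 2 :* v2 :^ 3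
      :- v0 :^ 2 :* v1 :^ 2 :* v2 :^ 2 :- v0 :^ 2 :* v1 :^ 4 :* v2 :+ # 2 :* v0 :^ 3 :* v1 :^ 3 :* v2 :^ 2
      :+ v0 :^ 4 :* v2 :^ 4 :- v0 :^ 4 :* v1 :^ 2 :* v2 :^ 3 :- v0 :^ 4 :* v1 :^ 4 :* v2 :^ 2
      :+ v0 :^ 5 :* v1 :* v2 :^ 4 :+ v0 :^ 5 :* v1 :^ 5 :* v2 :^ 2 :+ v0 :^ 6 :* v2 :^ 5
      :+ v0 :^ 6 :* v1 :^ 4 :* v2 :^ 3 :+ v0 :^ 7 :* v1 :* v2 :^ 5 :- v0 :^ 7 :* v1 :^ 3 :* v2 :^ 4
      :- v0 :^ 7 :* v1 :^ 5 :* v2 :^ 3 :+ # 2 :* v0 :^ 8 :* v1 :^ 2 :* v2 :^ 5 :- v0 :^ 9 :* v1 :* v2 :^ 6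
      :+ v0 :^ 9 :* v1 :^ 3 :* v2 :^ 5 :- v0 :^ 9 :* v1 :^ 5 :* v2 :^ 4
      :- # 3 :* v0 :^ 10 :* v1 :^ 4 :* v2 :^ 5 :- v0 :^ 11 :* v1 :* v2 :^ 7 :+ v0 :^ 11 :* v1 :^ 3 :* v2 :^ 6
      :- v0 :^ 11 :* v1 :^ 5 :* v2 :^ 5

-- The Hauptmodul y = q J₂ J₁₀³ / (J₁³ J₅), defined by 1/y = ψ²/(q ψ₅²) − 5

d η y κ ν y₅ κ₅ ν₅ : Series
d  = psi · psi ⊖ constant (+ 5) · (q · (ψ₅ · ψ₅))
η  = ψ₅ · ψ₅ · inv d
y  = q · η
κ  = one ⊕ constant (+ 5) · y
ν  = one ⊕ constant (+ 4) · y
y₅ = D y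
κ₅ = D κ
ν₅ = D ν

d-0 : d 0 ≡ 1ℤ
d-0 = trans (⊖-coeff (psi · psi) _ 0) (cong₂ _-ℤ_ (·-constantTerm psi psi)
  (trans (·-constantTerm (constant (+ 5)) _) (trans (cong (+ 5 *ℤ_) (q·-zero (ψ₅ · ψ₅))) refl)))

η-0 : η 0 ≡ 1ℤ
η-0 = trans (·-constantTerm (ψ₅ · ψ₅) (inv d)) (cong (_*ℤ 1ℤ) (·-constantTerm ψ₅ ψ₅))

y-0 : y 0 ≡ 0ℤ
y-0 = q·-zero η

y-cancel : ∀ {f h} → y · f ≈ y · h → f ≈ h
y-cancel {f} {h} e = unit-cancel η η-0 (q-cancel (≈-trans (≈-sym (·-assoc q η f)) (≈-trans e (·-assoc q η h))))

κ-0 : κ 0 ≡ 1ℤ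
κ-0 = trans (⊕-coeff one _ 0) (cong (1ℤ +ℤ_) (trans (·-constantTerm (constant (+ 5)) y) (cong (+ 5 *ℤ_) y-0)))

ν-0 : ν 0 ≡ 1ℤ
ν-0 = trans (⊕-coeff one _ 0) (cong (1ℤ +ℤ_) (trans (·-constantTerm (constant (+ 4)) y) (cong (+ 4 *ℤ_) y-0)))

κ₅-formula : κ₅ ≈ one ⊕ constant (+ 5) · y₅
κ₅-formula = D-eval (:one :+ # 5 :* v0) (y ∷ [])

ν₅-formula : ν₅ ≈ one ⊕ constant (+ 4) · y₅
ν₅-formula = D-eval (:one :+ # 4 :* v0) (y ∷ [])

-- d is a common denominator: y, κ and ν are qψ₅², ψ² and ψ² - qψ₅² divided by d. Relations between
-- their values at q and q⁵ are therefore proved after multiplication by powers of d and d₅.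
dy : d · y ≈ q · (ψ₅ · ψ₅)
dy = solveWith (q ∷ d ∷ inv d ∷ ψ₅ ∷ []) (v1 :* (v0 :* (v3 :* v3 :* v2))) (v0 :* (v3 :* v3))
  (hyp (v0 :* v3 :* v3) (v1 :* v2) :one (inv-inverse d d-0) done) refl

dκ : d · κ ≈ psi · psi
dκ = solveWith (q ∷ psi ∷ ψ₅ ∷ y ∷ []) ((v1 :* v1 :- # 5 :* (v0 :* (v2 :* v2))) :* (:one :+ # 5 :* v3)) (v1 :* v1)
  (hyp (# 5) ((v1 :* v1 :- # 5 :* (v0 :* (v2 :* v2))) :* v3) (v0 :* (v2 :* v2)) dy done) refl

dν : d · ν ≈ psi · psi ⊖ q · (ψ₅ · ψ₅)
dν = solveWith (q ∷ psi ∷ ψ₅ ∷ y ∷ []) ((v1 :* v1 :- # 5 :* (v0 :* (v2 :* v2))) :* (:one :+ # 4 :* v3)) (v1 :* v1 :- v0 :* (v2 :* v2))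
  (hyp (# 4) ((v1 :* v1 :- # 5 :* (v0 :* (v2 :* v2))) :* v3) (v0 :* (v2 :* v2)) dy done) refl

d₅ : Series
d₅ = D d

d₅-0 : d₅ 0 ≡ 1ℤ
d₅-0 = d-0

d₅-factor : d₅ ≈ ψ₂₅ · ψ₂₅ · Δ
d₅-factor = ≈-trans (D-eval (v0 :* v0 :- # 5 :* (v1 :* (v2 :* v2))) (psi ∷ q ∷ ψ₅ ∷ []))
  (≈-trans (⊖-cong ψ₅²-factor (·-congˡ (·-congʳ D-q)))
  (decide (q ∷ ψ₂₅ ∷ X · W ∷ []) (v1 :* v1 :* (v2 :+ v0 :^ 5) :- # 5 :* (v0 :^ 5 :* (v1 :* v1)))
    (v1 :* v1 :* (v2 :- # 4 :* v0 :^ 5)) refl))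

d₅y₅ : d₅ · y₅ ≈ q ^S 5 · (ψ₂₅ · ψ₂₅)
d₅y₅ = ≈-trans (≈-sym (D-· d y)) (≈-trans (D-cong dy)
  (≈-trans (D-· _ _) (·-cong D-q (D-· ψ₅ ψ₅))))

d₅κ₅ : d₅ · κ₅ ≈ ψ₅ · ψ₅
d₅κ₅ = ≈-trans (≈-sym (D-· d κ)) (≈-trans (D-cong dκ) (D-· psi psi))

d₅ν₅ : d₅ · ν₅ ≈ ψ₂₅ · ψ₂₅ · (X · W)
d₅ν₅ = ≈-trans (≈-sym (D-· d ν)) (≈-trans (D-cong (≈-trans dν (≈-sym psi-product))) pg-factor)

dd₅-0 : (d · d₅) 0 ≡ 1ℤ
dd₅-0 = trans (·-constantTerm d d₅) (cong₂ _*ℤ_ d-0 d₅-0)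

private
  -- `identity₁` times ψ₂₅², which turns Δ, ψ̂² and V̂ into d₅, ψ² and ψ₅².
  bd₅ : b̂ · d₅ ≈ â · (psi · psi ⊖ q · (ψ₅ · ψ₅))
  bd₅ = solveWith (q ∷ â ∷ b̂ ∷ psi ∷ ψ₅ ∷ d₅ ∷ ψ₂₅ ∷ ψ̂ ∷ V̂ ∷ Δ ∷ []) (v2 :* v5) (v1 :* (v3 :* v3 :- v0 :* (v4 :* v4)))
    (hyp v2 v5 (v6 :* v6 :* v9) d₅-factor
    (hyp (v6 :* v6) (v2 :* v9) (v1 :* (v7 :* v7 :- v0 :* v8)) identity₁
    (hyp (:- (v1 :* (v3 :+ v6 :* v7))) v3 (v6 :* v7) psi-factor
    (hyp (v0 :* v1) (v4 :* v4) (v6 :* v6 :* v8) ψ₅²-factor done)))) refl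

  -- `identity₂` times ψ₂₅², by the same replacements.
  bd : b̂ · d ≈ â ^S 3 · (ψ₂₅ · ψ₂₅ · (X · W))
  bd = solveWith (q ∷ â ∷ b̂ ∷ psi ∷ ψ₅ ∷ ψ₂₅ ∷ ψ̂ ∷ V̂ ∷ X · W ∷ []) (v2 :* (v3 :* v3 :- # 5 :* (v0 :* (v4 :* v4)))) (v1 :^ 3 :* (v5 :* v5 :* v8))
    (hyp (v2 :* (v3 :+ v5 :* v6)) v3 (v5 :* v6) psi-factor
    (hyp (:- (# 5 :* v0 :* v2)) (v4 :* v4) (v5 :* v5 :* v7) ψ₅²-factor
    (hyp (:- (v5 :* v5)) (v1 :^ 3 :* v8) (v2 :* (v6 :* v6 :- # 5 :* (v0 :* v7))) identity₂ done))) refl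

-- With a = â/q, b = b̂/q² and y₅, κ₅, ν₅ the values at q⁵, the relations read y y₅ b⁴ = κ κ₅ a², b y = κ₅ a ν,
-- a² ν₅ y² = κ₅² ν, b² = a⁴ ν ν₅ and y ν₅ a³ = κ₅ b.

relation-κ : q ^S 6 · (κ · (κ₅ · â ^S 2)) ≈ y · (y₅ · b̂ ^S 4)
relation-κ = unit-cancel (d · d₅) dd₅-0 (solveWith
  (q ∷ â ∷ b̂ ∷ psi ∷ ψ₅ ∷ ψ₂₅ ∷ d ∷ d₅ ∷ y ∷ κ ∷ y₅ ∷ κ₅ ∷ [])
  (v6 :* v7 :* (v0 :^ 6 :* (v9 :* (v11 :* v1 :^ 2)))) (v6 :* v7 :* (v8 :* (v10 :* v2 :^ 4)))
  (hyp (v7 :* v0 :^ 6 :* v11 :* v1 :^ 2) (v6 :* v9) (v3 :* v3) dκ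
  (hyp (v3 :* v3 :* v0 :^ 6 :* v1 :^ 2) (v7 :* v11) (v4 :* v4) d₅κ₅
  (hyp (:- (v7 :* v10 :* v2 :^ 4)) (v6 :* v8) (v0 :* (v4 :* v4)) dy
  (hyp (:- (v0 :* v4 :* v4 :* v2 :^ 4)) (v7 :* v10) (v0 :^ 5 :* (v5 :* v5)) d₅y₅
  (hyp (v0 :^ 6 :* v4 :* v4 :* (v3 :* v1 :+ v5 :* (v2 :* v2))) (v3 :* v1) (v5 :* (v2 :* v2)) psi-â done))))) refl)

relation-b : b̂ · y ≈ q · (κ₅ · (â · ν))
relation-b = unit-cancel (d · d₅) dd₅-0 (solveWith
  (q ∷ â ∷ b̂ ∷ psi ∷ ψ₅ ∷ d ∷ d₅ ∷ y ∷ ν ∷ κ₅ ∷ [])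
  (v5 :* v6 :* (v2 :* v7)) (v5 :* v6 :* (v0 :* (v9 :* (v1 :* v8))))
  (hyp (v2 :* v6) (v5 :* v7) (v0 :* (v4 :* v4)) dy
  (hyp (v0 :* v4 :* v4) (v2 :* v6) (v1 :* (v3 :* v3 :- v0 :* (v4 :* v4))) bd₅
  (hyp (:- (v5 :* v0 :* v1 :* v8)) (v6 :* v9) (v4 :* v4) d₅κ₅
  (hyp (:- (v4 :* v4 :* v0 :* v1)) (v5 :* v8) (v3 :* v3 :- v0 :* (v4 :* v4)) dν done)))) refl)

relation-a : â ^S 2 · (ν₅ · y ^S 2) ≈ q ^S 2 · (κ₅ ^S 2 · ν)
relation-a = unit-cancel (b̂ · (d · d₅ · (d · d₅)))
  (trans (·-constantTerm b̂ _) (cong₂ _*ℤ_ b̂-0 (trans (·-constantTerm _ _) (cong₂ _*ℤ_ dd₅-0 dd₅-0))))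
  (solveWith (q ∷ â ∷ b̂ ∷ psi ∷ ψ₅ ∷ d ∷ d₅ ∷ y ∷ ν ∷ κ₅ ∷ ν₅ ∷ ψ₂₅ ∷ X · W ∷ [])
  (v2 :* (v5 :* v6 :* (v5 :* v6)) :* (v1 :^ 2 :* (v10 :* v7 :^ 2))) (v2 :* (v5 :* v6 :* (v5 :* v6)) :* (v0 :^ 2 :* (v9 :^ 2 :* v8)))
  (hyp (v2 :* v6 :* v6 :* v1 :^ 2 :* v10 :* (v5 :* v7 :+ v0 :* (v4 :* v4))) (v5 :* v7) (v0 :* (v4 :* v4)) dy
  (hyp (v2 :* v6 :* v1 :^ 2 :* (v0 :* (v4 :* v4)) :^ 2) (v6 :* v10) (v11 :* v11 :* v12) d₅ν₅
  (hyp (v1 :^ 2 :* (v0 :* (v4 :* v4)) :^ 2 :* (v11 :* v11 :* v12)) (v2 :* v6) (v1 :* (v3 :* v3 :- v0 :* (v4 :* v4))) bd₅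
  (hyp (:- (v2 :* v5 :* v5 :* v0 :^ 2 :* v8 :* (v6 :* v9 :+ v4 :* v4))) (v6 :* v9) (v4 :* v4) d₅κ₅
  (hyp (:- (v2 :* v5 :* v0 :^ 2 :* (v4 :* v4) :^ 2)) (v5 :* v8) (v3 :* v3 :- v0 :* (v4 :* v4)) dν
  (hyp (:- (v0 :^ 2 :* (v4 :* v4) :^ 2 :* (v3 :* v3 :- v0 :* (v4 :* v4)))) (v2 :* v5) (v1 :^ 3 :* (v11 :* v11 :* v12)) bd done)))))) refl)

relation-ν : b̂ ^S 2 ≈ â ^S 4 · (ν · ν₅)
relation-ν = y-cancel (y-cancel (solveWith (q ∷ â ∷ b̂ ∷ y ∷ ν ∷ κ₅ ∷ ν₅ ∷ []) (v3 :* (v3 :* v2 :^ 2)) (v3 :* (v3 :* (v1 :^ 4 :* (v4 :* v6))))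
  (hyp (v2 :* v3 :+ v0 :* (v5 :* (v1 :* v4))) (v2 :* v3) (v0 :* (v5 :* (v1 :* v4))) relation-b
  (hyp (:- (v1 :^ 2 :* v4)) (v1 :^ 2 :* (v6 :* v3 :^ 2)) (v0 :^ 2 :* (v5 :^ 2 :* v4)) relation-a done)) refl))

relation-y : y · (ν₅ · â ^S 3) ≈ q · (κ₅ · b̂)
relation-y = unit-cancel b̂ b̂-0 (solveWith (q ∷ â ∷ b̂ ∷ y ∷ ν ∷ κ₅ ∷ ν₅ ∷ []) (v2 :* (v3 :* (v6 :* v1 :^ 3))) (v2 :* (v0 :* (v5 :* v2)))
  (hyp (v6 :* v1 :^ 3) (v2 :* v3) (v0 :* (v5 :* (v1 :* v4))) relation-b
  (hyp (:- (v0 :* v5)) (v2 :^ 2) (v1 :^ 4 :* (v4 :* v6)) relation-ν done)) refl)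

-- The modular equation of degree 5

κ₅-0 : κ₅ 0 ≡ 1ℤ
κ₅-0 = κ-0

^S-0 : ∀ n {f} → f 0 ≡ 1ℤ → (f ^S n) 0 ≡ 1ℤ
^S-0 zero    f0 = refl
^S-0 (suc n) {f} f0 = trans (·-constantTerm f (f ^S n)) (cong₂ _*ℤ_ f0 (^S-0 n f0))

-- Elimination of a and b: the fourth power of `relation-b` replaces b⁴ in `relation-κ` by a
-- multiple of a⁴, and `relation-a` removes the a² that remains.
modular-sextic : ν₅ · (κ · y ^S 5) ≈ y₅ · (κ₅ ^S 5 · ν ^S 5)
modular-sextic = q-cancel (q-cancel (solveWith (q ∷ â ∷ y ∷ κ ∷ ν ∷ y₅ ∷ κ₅ ∷ ν₅ ∷ [])
  (v0 :* (v0 :* (v7 :* (v3 :* v2 :^ 5)))) (v0 :* (v0 :* (v5 :* (v6 :^ 5 :* v4 :^ 5))))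
  (hyp (v7 :* v2 :^ 2) (v0 :^ 2 :* (v3 :* v2 :^ 3)) (v5 :* (v6 :^ 3 :* (v1 :^ 2 :* v4 :^ 4))) cancelled
  (hyp (v5 :* v6 :^ 3 :* v4 :^ 4) (v1 :^ 2 :* (v7 :* v2 :^ 2)) (v0 :^ 2 :* (v6 :^ 2 :* v4)) relation-a done)) refl))
  where
  cancelled : q ^S 2 · (κ · y ^S 3) ≈ y₅ · (κ₅ ^S 3 · (â ^S 2 · ν ^S 4))
  cancelled = unit-cancel (κ₅ · â ^S 2) (trans (·-constantTerm κ₅ _) (cong₂ _*ℤ_ κ₅-0 (^S-0 2 â-0)))
    (y-cancel (q-cancel (q-cancel (q-cancel (q-cancel (solveWith (q ∷ â ∷ b̂ ∷ y ∷ κ ∷ ν ∷ y₅ ∷ κ₅ ∷ [])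
      (v0 :* (v0 :* (v0 :* (v0 :* (v3 :* (v7 :* v1 :^ 2 :* (v0 :^ 2 :* (v4 :* v3 :^ 3))))))))
      (v0 :* (v0 :* (v0 :* (v0 :* (v3 :* (v7 :* v1 :^ 2 :* (v6 :* (v7 :^ 3 :* (v1 :^ 2 :* v5 :^ 4)))))))))
      (hyp (v3 :^ 4) (v0 :^ 6 :* (v4 :* (v7 :* v1 :^ 2))) (v3 :* (v6 :* v2 :^ 4)) relation-κ
      (hyp (v3 :* v6 :* ((v2 :* v3) :^ 2 :+ (v0 :* v7 :* v1 :* v5) :^ 2) :* (v2 :* v3 :+ v0 :* v7 :* v1 :* v5))
         (v2 :* v3) (v0 :* (v7 :* (v1 :* v5))) relation-b done)) refl))))))

K N : ∀ {n} → Expr (suc n)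
K = :one :+ # 5 :* v0
N = :one :+ # 4 :* v0

-- For l + i > 5 the coefficient of v0ˡ in cᵢ is divisible by 5^⌈(l + i - 5)/2⌉. The stability of
-- the lattice rests on these divisibilities.
c₀ c₁ c₂ c₃ c₄ : ∀ {n} → Expr (suc n)
c₀ = v0 :+ # 20 :* v0 :^ 2 :+ # 150 :* v0 :^ 3 :+ # 500 :* v0 :^ 4 :+ # 625 :* v0 :^ 5
c₁ = # 15 :* v0 :+ # 305 :* v0 :^ 2 :+ # 2325 :* v0 :^ 3 :+ # 7875 :* v0 :^ 4 :+ # 10000 :* v0 :^ 5
c₂ = # 85 :* v0 :+ # 1750 :* v0 :^ 2 :+ # 13525 :* v0 :^ 3 :+ # 46500 :* v0 :^ 4 :+ # 60000 :* v0 :^ 5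
c₃ = # 215 :* v0 :+ # 4475 :* v0 :^ 2 :+ # 35000 :* v0 :^ 3 :+ # 122000 :* v0 :^ 4 :+ # 160000 :* v0 :^ 5
c₄ = # 205 :* v0 :+ # 4300 :* v0 :^ 2 :+ # 34000 :* v0 :^ 3 :+ # 120000 :* v0 :^ 4 :+ # 160000 :* v0 :^ 5

-- The sextic has the extraneous factor 1 + 5y + 5y₅ + 20 y y₅, corresponding to b = −a.
modular-quintic : y ^S 5 ≈ eval c₀ (y₅ ∷ []) ⊕ eval c₁ (y₅ ∷ []) · y ⊕ eval c₂ (y₅ ∷ []) · y ^S 2
  ⊕ eval c₃ (y₅ ∷ []) · y ^S 3 ⊕ eval c₄ (y₅ ∷ []) · y ^S 4
modular-quintic = unit-cancel factor factor-0 (solveWith (y₅ ∷ y ∷ κ₅ ∷ ν₅ ∷ [])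
  (F :* v1 :^ 5) (F :* (c₀ :+ c₁ :* v1 :+ c₂ :* v1 :^ 2 :+ c₃ :* v1 :^ 3 :+ c₄ :* v1 :^ 4))
  (hyp :one (v3 :* ((:one :+ # 5 :* v1) :* v1 :^ 5)) (v0 :* (v2 :^ 5 :* (:one :+ # 4 :* v1) :^ 5)) modular-sextic
  (hyp (v0 :* (:one :+ # 4 :* v1) :^ 5 :* (v2 :^ 4 :+ v2 :^ 3 :* K :+ v2 :^ 2 :* K :^ 2 :+ v2 :* K :^ 3 :+ K :^ 4)) v2 K κ₅-formula
  (hyp (:- ((:one :+ # 5 :* v1) :* v1 :^ 5)) v3 N ν₅-formula done))) refl)
  where
  F : Expr 4
  F = :one :+ # 5 :* v1 :+ # 5 :* v0 :+ # 20 :* v1 :* v0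
  factor : Series
  factor = one ⊕ constant (+ 5) · y ⊕ constant (+ 5) · y₅ ⊕ constant (+ 20) · y · y₅
  y₅-0 : y₅ 0 ≡ 0ℤ
  y₅-0 = y-0
  factor-0 : factor 0 ≡ 1ℤ
  factor-0 = trans (⊕-coeff _ _ 0) (cong₂ _+ℤ_ (trans (⊕-coeff _ _ 0) (cong₂ _+ℤ_ κ-0
    (trans (·-constantTerm (constant (+ 5)) y₅) (cong (+ 5 *ℤ_) y₅-0))))
    (trans (·-constantTerm (constant (+ 20) · y) y₅) (trans (cong ((constant (+ 20) · y) 0 *ℤ_) y₅-0) (ℤₚ.*-zeroʳ ((constant (+ 20) · y) 0)))))

-- The operator U and the parameter k

U : Series → Series
U = comp 5 0

U-cong : ∀ {f g} → f ≈ g → U f ≈ U g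
U-cong = comp-cong 0

U-D· : ∀ f g → U (D f · g) ≈ f · U g
U-D· f g = comp-dil· f g 0 0<5

-- y, κ, ν as rational functions of k = q ρ σ², where m = σ/ρ² = (1 + k)/(1 − k)

k m m⁻ : Series
k  = q · (ρ · σ ^S 2)
m  = ρ⁻ ^S 2 · σ
m⁻ = ρ ^S 2 · σ⁻

module _ where
  private
    env : Vec Series 5
    env = q ∷ ρ ∷ ρ⁻ ∷ σ ∷ σ⁻ ∷ []

  m-inverse : m · m⁻ ≈ one
  m-inverse = solveWith env ((v2 :^ 2 :* v3) :* (v1 :^ 2 :* v4)) :one
    (hyp (v3 :* v4 :* (v1 :* v2 :+ :one)) (v1 :* v2) :one ρ-inverse (hyp :one (v3 :* v4) :one σ-inverse done)) refl

  m-relation : m ≈ one ⊕ k · (m ⊕ one)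
  m-relation = solveWith env (v2 :^ 2 :* v3) (:one :+ v0 :* (v1 :* v3 :^ 2) :* (v2 :^ 2 :* v3 :+ :one))
    (hyp (v2 :^ 2) v3 (v1 :^ 2 :+ v0 :* v1 :* v3 :^ 2 :* (v3 :+ v1 :^ 2)) ρσ-relation
    (hyp ((v1 :* v2 :+ :one) :* (:one :+ v0 :* v1 :* v3 :^ 2)) (v1 :* v2) :one ρ-inverse done)) refl

  pg-formula : p̂ · ĝ ≈ ρ⁻ · σ⁻ ^S 2 ⊖ q ^S 2 · (ρ · σ ^S 2)
  pg-formula = solveWith (q ∷ ρ ∷ ρ⁻ ∷ σ ∷ σ⁻ ∷ p̂ ∷ ĝ ∷ []) (v5 :* v6) (v2 :* v4 :^ 2 :- v0 :^ 2 :* (v1 :* v3 :^ 2))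
    (hyp v6 v5 (v1 :* v4 :^ 2 :+ v0 :* v1 :^ 2) p̂-formula
    (hyp (v1 :* v4 :^ 2 :+ v0 :* v1 :^ 2) v6 (v2 :^ 2 :- v0 :* v3 :^ 2 :* v2) ĝ-formula
    (hyp (v2 :* v4 :^ 2 :- v0 :^ 2 :* v1 :* v3 :^ 2 :+ v0 :* v1 :* v2) (v1 :* v2) :one ρ-inverse
    (hyp (:- (v0 :* v1 :* v2 :* (v3 :* v4 :+ :one))) (v3 :* v4) :one σ-inverse done)))) refl

  k-pg : k · (p̂ · ĝ) ≈ q · (one ⊖ k ^S 2)
  k-pg = solveWith (q ∷ ρ ∷ ρ⁻ ∷ σ ∷ σ⁻ ∷ p̂ · ĝ ∷ []) (v0 :* (v1 :* v3 :^ 2) :* v5) (v0 :* (:one :- (v0 :* (v1 :* v3 :^ 2)) :^ 2))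
    (hyp (v0 :* (v1 :* v3 :^ 2)) v5 (v2 :* v4 :^ 2 :- v0 :^ 2 :* (v1 :* v3 :^ 2)) pg-formula
    (hyp (v0 :* v3 :^ 2 :* v4 :^ 2) (v1 :* v2) :one ρ-inverse
    (hyp (v0 :* (v3 :* v4 :+ :one)) (v3 :* v4) :one σ-inverse done))) refl

k-cancel : ∀ {f g} → k · f ≈ k · g → f ≈ g
k-cancel {f} {g} h = inverse-cancel (inverse-· ρ-inverse (inverse-^ 2 σ-inverse))
  (q-cancel (≈-trans (≈-sym (·-assoc q _ f)) (≈-trans h (·-assoc q _ g))))

-- By `psi-product`, ψ² - 5qψ₅² = p g - 4qψ₅²; this is `dy` divided by ψ₅².
δy : (p̂ · ĝ ⊖ constant (+ 4) · q) · y ≈ q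
δy = unit-cancel (ψ₅ · ψ₅) (trans (·-constantTerm ψ₅ ψ₅) refl)
  (solveWith (q ∷ ψ₅ ∷ p̂ ∷ ĝ ∷ y ∷ psi ∷ p ∷ g ∷ []) (v1 :* v1 :* ((v2 :* v3 :- # 4 :* v0) :* v4)) (v1 :* v1 :* v0)
  (hyp :one ((v5 :* v5 :- # 5 :* (v0 :* (v1 :* v1))) :* v4) (v0 :* (v1 :* v1)) dy
  (hyp v4 (v6 :* v7) (v5 :* v5 :- v0 :* (v1 :* v1)) psi-product
  (hyp (:- (v7 :* v4)) v6 (v1 :* v2) p-factor
  (hyp (:- (v1 :* v2 :* v4)) v7 (v1 :* v3) g-factor done)))) refl)
  where
  p-factor : p ≈ ψ₅ · p̂
  p-factor = solveWith (ψ₅ ∷ ιψ ∷ p ∷ []) v2 (v0 :* (v2 :* v1)) (hyp (:- v2) (v0 :* v1) :one (inv-inverse ψ₅ ψ₅-0) done) refl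
  g-factor : g ≈ ψ₅ · ĝ
  g-factor = solveWith (ψ₅ ∷ ιψ ∷ g ∷ []) v2 (v0 :* (v2 :* v1)) (hyp (:- v2) (v0 :* v1) :one (inv-inverse ψ₅ ψ₅-0) done) refl

u : Series
u = one ⊖ constant (+ 4) · k ⊖ k ^S 2

-- `k-pg` says that p̂ ĝ = q(1/k - k), so `δy` becomes y(1/k - k - 4) = 1, that is y = k/(1 - 4k -
-- k²).
yu : y · u ≈ k
yu = q-cancel (solveWith (q ∷ k ∷ p̂ · ĝ ∷ y ∷ []) (v0 :* (v3 :* (:one :- # 4 :* v1 :- v1 :^ 2))) (v0 :* v1)
  (hyp v1 ((v2 :- # 4 :* v0) :* v3) v0 δy
  (hyp (:- v3) (v1 :* v2) (v0 :* (:one :- v1 :^ 2)) k-pg done)) refl)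

νu : ν · u ≈ one ⊖ k ^S 2
νu = solveWith (k ∷ y ∷ []) ((:one :+ # 4 :* v1) :* (:one :- # 4 :* v0 :- v0 :^ 2)) (:one :- v0 :^ 2)
  (hyp (# 4) (v1 :* (:one :- # 4 :* v0 :- v0 :^ 2)) v0 yu done) refl

k-0 : k 0 ≡ 0ℤ
k-0 = q·-zero (ρ · σ ^S 2)

u-0 : u 0 ≡ 1ℤ
u-0 = trans (⊖-coeff _ _ 0) (cong₂ _-ℤ_ (trans (⊖-coeff one _ 0) (cong (1ℤ -ℤ_) (trans (·-constantTerm (constant (+ 4)) k) (cong (+ 4 *ℤ_) k-0))))
  (trans (·-constantTerm k (k ^S 1)) (cong (_*ℤ (k ^S 1) 0) k-0)))

δη : (p̂ · ĝ ⊖ constant (+ 4) · q) · η ≈ one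
δη = q-cancel (solveWith (q ∷ p̂ · ĝ ⊖ constant (+ 4) · q ∷ η ∷ []) (v0 :* (v1 :* v2)) (v0 :* :one)
  (hyp :one (v1 :* (v0 :* v2)) v0 δy done) refl)

-- In the notation above ã = y₅ a, b̃ = y₅ b and τ = y₅ / y.

ã b̃ τ : Series
ã = q ^S 4 · (D η · â)
b̃ = q ^S 3 · (D η · b̂)
τ = q ^S 4 · (D η · inv η)

y₅-formula : y₅ ≈ q ^S 5 · D η
y₅-formula = ≈-trans (D-· q η) (·-congʳ D-q)

τy : τ · y ≈ y₅
τy = solveWith (q ∷ D η ∷ inv η ∷ η ∷ y₅ ∷ []) (v0 :^ 4 :* (v1 :* v2) :* (v0 :* v3)) v4
  (hyp (v0 :^ 5 :* v1) (v3 :* v2) :one (inv-inverse η η-0)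
  (hyp (:- :one) v4 (v0 :^ 5 :* v1) y₅-formula done)) refl

b̃y : b̃ · y ≈ κ₅ · (ã · ν)
b̃y = solveWith (q ∷ D η ∷ b̂ ∷ â ∷ y ∷ κ₅ ∷ ν ∷ []) (v0 :^ 3 :* (v1 :* v2) :* v4) (v5 :* (v0 :^ 4 :* (v1 :* v3) :* v6))
  (hyp (v0 :^ 3 :* v1) (v2 :* v4) (v0 :* (v5 :* (v3 :* v6))) relation-b done) refl

b̃y₅ : b̃ · y₅ ≈ κ₅ · (ã · (ν · τ))
b̃y₅ = solveWith (b̃ ∷ y ∷ κ₅ ∷ ã ∷ ν ∷ τ ∷ y₅ ∷ []) (v0 :* v6) (v2 :* (v3 :* (v4 :* v5)))
  (hyp v5 (v0 :* v1) (v2 :* (v3 :* v4)) b̃y (hyp (:- v0) (v5 :* v1) v6 τy done)) refl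

ã² : ã ^S 2 · ν₅ ≈ κ₅ ^S 2 · (ν · τ ^S 2)
ã² = y-cancel (y-cancel (solveWith (q ∷ D η ∷ â ∷ y ∷ κ₅ ∷ ν ∷ ν₅ ∷ τ ∷ y₅ ∷ [])
  (v3 :* (v3 :* ((v0 :^ 4 :* (v1 :* v2)) :^ 2 :* v6))) (v3 :* (v3 :* (v4 :^ 2 :* (v5 :* v7 :^ 2))))
  (hyp (v0 :^ 8 :* v1 :^ 2) (v2 :^ 2 :* (v6 :* v3 :^ 2)) (v0 :^ 2 :* (v4 :^ 2 :* v5)) relation-a
  (hyp (:- (v4 :^ 2 :* v5 :* (v7 :* v3 :+ v8))) (v7 :* v3) v8 τy
  (hyp (:- (v4 :^ 2 :* v5 :* (v8 :+ v0 :^ 5 :* v1))) v8 (v0 :^ 5 :* v1) y₅-formula done))) refl))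

ντ : ν · τ ≈ τ ⊕ constant (+ 4) · y₅
ντ = solveWith (y ∷ τ ∷ y₅ ∷ []) ((:one :+ # 4 :* v0) :* v1) (v1 :+ # 4 :* v2)
  (hyp (# 4) (v1 :* v0) v2 τy done) refl

-- Values of U on monomials in ã and b̃

module _ where
  private
    base : Vec Series 5
    base = η ∷ ρ ∷ ρ⁻ ∷ σ ∷ σ⁻ ∷ []
    eã eb̃ : Expr 6
    eã = v0 :^ 4 :* (v1 :* (v3 :- v0 :- v0 :^ 2 :* v2))
    eb̃ = v0 :^ 3 :* (v1 :* (v5 :- v0 :^ 2 :- v0 :^ 4 :* v4))

  U-ã : U ã ≈ ⊝ y
  U-ã = component 0 0<5 base eã (:- (v0 :* v1)) refl

  U-b̃ : U b̃ ≈ ⊝ y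
  U-b̃ = component 0 0<5 base eb̃ (:- (v0 :* v1)) refl

  U-ã² : U (ã ^S 2) ≈ ⊝ (y ^S 2)
  U-ã² = ≈-trans (component 0 0<5 base (eã :^ 2) ((v0 :* v1) :^ 2 :* (:one :- # 2 :* (v2 :* v3))) refl)
    (solveWith (q ∷ base) ((v0 :* v1) :^ 2 :* (:one :- # 2 :* (v2 :* v3))) (:- ((v0 :* v1) :^ 2))
      (hyp (:- (# 2 :* (v0 :* v1) :^ 2)) (v2 :* v3) :one ρ-inverse done) refl)

  U-ãb̃ : U (ã · b̃) ≈ y ^S 2
  U-ãb̃ = component 0 0<5 base (eã :* eb̃) ((v0 :* v1) :^ 2) refl

  U-b̃² : U (b̃ ^S 2) ≈ ⊝ (y ^S 2)
  U-b̃² = ≈-trans (component 0 0<5 base (eb̃ :^ 2) ((v0 :* v1) :^ 2 :* (:one :- # 2 :* (v4 :* v5))) refl)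
    (solveWith (q ∷ base) ((v0 :* v1) :^ 2 :* (:one :- # 2 :* (v4 :* v5))) (:- ((v0 :* v1) :^ 2))
      (hyp (:- (# 2 :* (v0 :* v1) :^ 2)) (v4 :* v5) :one σ-inverse done) refl)

  U-ã³ : U (ã ^S 3) ≈ constant (+ 5) · y ^S 3
  U-ã³ = ≈-trans (component 0 0<5 base (eã :^ 3) ((v0 :* v1) :^ 3 :* (# 6 :* (v2 :* v3) :- :one)) refl)
    (solveWith (q ∷ base) ((v0 :* v1) :^ 3 :* (# 6 :* (v2 :* v3) :- :one)) (# 5 :* (v0 :* v1) :^ 3)
      (hyp (# 6 :* (v0 :* v1) :^ 3) (v2 :* v3) :one ρ-inverse done) refl)

  -- The component is y³(m⁻ - m + 1). From m = (1 + k)/(1 - k) one finds m⁻ - m + 1 = (1 - 4k -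
  -- k²)/(1 - k²), which is 1/ν by `νu`.
  U-ã²b̃ : ν · U (ã ^S 2 · b̃) ≈ y ^S 3
  U-ã²b̃ = ≈-trans (·-congˡ (≈-trans (component 0 0<5 base (eã :^ 2 :* eb̃)
        ((v0 :* v1) :^ 3 :* (v2 :^ 2 :* v5 :- v3 :^ 2 :* v4 :- :one :+ # 2 :* (v2 :* v3))) refl)
      (solveWith (q ∷ base) ((v0 :* v1) :^ 3 :* (v2 :^ 2 :* v5 :- v3 :^ 2 :* v4 :- :one :+ # 2 :* (v2 :* v3)))
        ((v0 :* v1) :^ 3 :* (v2 :^ 2 :* v5 :- v3 :^ 2 :* v4 :+ :one)) (hyp (# 2 :* (v0 :* v1) :^ 3) (v2 :* v3) :one ρ-inverse done) refl)))
    (unit-cancel u u-0 (solveWith (k ∷ m ∷ m⁻ ∷ y ∷ ν ∷ []) (U' :* (v4 :* (v3 :^ 3 :* (v2 :- v1 :+ :one)))) (U' :* v3 :^ 3)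
      (hyp (v3 :^ 3 :* (v2 :- v1 :+ :one)) (v4 :* U') (:one :- v0 :^ 2) νu
      (hyp (:- (v3 :^ 3 :* (:one :+ v0))) v1 (:one :+ v0 :* (v1 :+ :one)) m-relation
      (hyp (:- (v3 :^ 3 :* (:one :- v0) :* v2)) v1 (:one :+ v0 :* (v1 :+ :one)) m-relation
      (hyp (v3 :^ 3 :* (:one :- v0) :* (:one :- v0)) (v1 :* v2) :one m-inverse done)))) refl))
    where
    U' : Expr 5
    U' = :one :- # 4 :* v0 :- v0 :^ 2

  -- Apart from y² the component is η(p̂ ĝ + q). Since η p̂ ĝ = ν by `δη` and q η = y, this is ν + y
  -- = κ.
  U-ãb̃² : U (ã · b̃ ^S 2) ≈ κ · y ^S 2
  U-ãb̃² = ≈-trans (component 0 0<5 base (eã :* eb̃ :^ 2)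
      (v0 :^ 2 :* v1 :^ 3 :* (v3 :* v5 :^ 2 :- v0 :* (:one :- # 2 :* (v4 :* v5)) :- v0 :^ 2 :* (v2 :* v4 :^ 2))) refl)
    (solveWith (q ∷ η ∷ ρ ∷ ρ⁻ ∷ σ ∷ σ⁻ ∷ p̂ · ĝ ∷ [])
      (v0 :^ 2 :* v1 :^ 3 :* (v3 :* v5 :^ 2 :- v0 :* (:one :- # 2 :* (v4 :* v5)) :- v0 :^ 2 :* (v2 :* v4 :^ 2)))
      ((:one :+ # 5 :* (v0 :* v1)) :* (v0 :* v1) :^ 2)
      (hyp (# 2 :* v0 :^ 3 :* v1 :^ 3) (v4 :* v5) :one σ-inverse
      (hyp (:- (v0 :^ 2 :* v1 :^ 3)) v6 (v3 :* v5 :^ 2 :- v0 :^ 2 :* (v2 :* v4 :^ 2)) pg-formula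
      (hyp (v0 :^ 2 :* v1 :^ 2) ((v6 :- # 4 :* v0) :* v1) :one δη done))) refl)

  -- The terms ρ⁻³σ⁻ and q²ρ³σ of the component become q m and q k² m⁻ when multiplied by k.
  -- Everything is then rational in k, and `m-relation` eliminates m and m⁻.
  U-ã³b̃ : ν · U (ã ^S 3 · b̃) ≈ y ^S 3 · (ν ^S 2 ⊖ constant (+ 3) · (y · ν) ⊕ constant (+ 16) · y ^S 2)
  U-ã³b̃ = unit-cancel (u · u) (trans (·-constantTerm u u) (cong₂ _*ℤ_ u-0 u-0)) (solveWith (k ∷ m ∷ m⁻ ∷ y ∷ ν ∷ U (ã ^S 3 · b̃) ∷ [])
      (U' :* U' :* (v4 :* v5)) (U' :* U' :* (v3 :^ 3 :* (v4 :^ 2 :- # 3 :* (v3 :* v4) :+ # 16 :* v3 :^ 2)))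
      (hyp (U' :* v4) (U' :* v5) (v3 :^ 3 :* Q) Uu
      (hyp (v3 :^ 3 :* (Q :- (U' :* v4 :+ :one :- v0 :^ 2) :+ # 3 :* (v3 :* U'))) (v4 :* U') (:one :- v0 :^ 2) νu
      (hyp (v3 :^ 3 :* (# 3 :* (:one :- v0 :^ 2) :- # 16 :* (v3 :* U' :+ v0))) (v3 :* U') v0 yu
      (hyp (v3 :^ 3 :* (:one :+ v0) :* (:one :+ # 3 :* v0)) v1 (:one :+ v0 :* (v1 :+ :one)) m-relation
      (hyp (v3 :^ 3 :* (:one :- v0) :* (v0 :^ 2 :- # 3 :* v0) :* (:- v2)) v1 (:one :+ v0 :* (v1 :+ :one)) m-relation
      (hyp (v3 :^ 3 :* (:one :- v0) :* (v0 :^ 2 :- # 3 :* v0) :* (:one :- v0)) (v1 :* v2) :one m-inverse done)))))) refl)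
    where
    U' Q : Expr 6
    U' = :one :- # 4 :* v0 :- v0 :^ 2
    Q  = v1 :- # 5 :* v0 :+ # 3 :* v0 :* (v1 :- v2) :+ v0 :^ 2 :* v2
    bracket : U (ã ^S 3 · b̃) ≈ q ^S 3 · η ^S 4 · (ρ⁻ ^S 3 · σ⁻ ⊕ q · (constant (+ 3) · m ⊖ constant (+ 3) · m⁻ ⊖ constant (+ 5)) ⊕ q ^S 2 · (ρ ^S 3 · σ))
    bracket = ≈-trans (component 0 0<5 base (eã :^ 3 :* eb̃)
        (v0 :^ 3 :* v1 :^ 4 :* (v3 :^ 3 :* v5 :+ v0 :* (# 3 :* (v3 :^ 2 :* v4) :- # 3 :* (v2 :^ 2 :* v5) :- (# 6 :* (v2 :* v3) :- :one))
          :+ v0 :^ 2 :* (v2 :^ 3 :* v4))) refl)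
      (solveWith (q ∷ base) (v0 :^ 3 :* v1 :^ 4 :* (v3 :^ 3 :* v5 :+ v0 :* (# 3 :* (v3 :^ 2 :* v4) :- # 3 :* (v2 :^ 2 :* v5) :- (# 6 :* (v2 :* v3) :- :one)) :+ v0 :^ 2 :* (v2 :^ 3 :* v4)))
        (v0 :^ 3 :* v1 :^ 4 :* (v3 :^ 3 :* v5 :+ v0 :* (# 3 :* (v3 :^ 2 :* v4) :- # 3 :* (v2 :^ 2 :* v5) :- # 5) :+ v0 :^ 2 :* (v2 :^ 3 :* v4)))
        (hyp (:- (# 6 :* v0 :^ 4 :* v1 :^ 4)) (v2 :* v3) :one ρ-inverse done) refl)
    Uu : u · U (ã ^S 3 · b̃) ≈ y ^S 3 · (m ⊖ constant (+ 5) · k ⊕ constant (+ 3) · k · (m ⊖ m⁻) ⊕ k ^S 2 · m⁻)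
    Uu = k-cancel (≈-trans (·-congˡ (·-congˡ bracket)) (solveWith (q ∷ η ∷ ρ ∷ ρ⁻ ∷ σ ∷ σ⁻ ∷ [])
      (kk :* (UU :* (v0 :^ 3 :* v1 :^ 4 :* (v3 :^ 3 :* v5 :+ v0 :* (# 3 :* (v3 :^ 2 :* v4) :- # 3 :* (v2 :^ 2 :* v5) :- # 5) :+ v0 :^ 2 :* (v2 :^ 3 :* v4)))))
      (kk :* ((v0 :* v1) :^ 3 :* QQ))
      (hyp ((v0 :* v1) :^ 3 :* QQ) ((v0 :* v1) :* UU) kk yu
      (hyp (UU :* v0 :^ 4 :* v1 :^ 4 :* v4 :* v3 :^ 2 :* v4 :* v5) (v2 :* v3) :one ρ-inverse
      (hyp (UU :* v0 :^ 4 :* v1 :^ 4 :* (v4 :* v3 :^ 2 :- kk :* v0 :* v2 :^ 3 :* v4)) (v4 :* v5) :one σ-inverse done))) refl))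
      where
      kk UU QQ : Expr 6
      kk = v0 :* (v2 :* v4 :^ 2)
      UU = :one :- # 4 :* kk :- kk :^ 2
      QQ = v3 :^ 2 :* v4 :- # 5 :* kk :+ # 3 :* kk :* (v3 :^ 2 :* v4 :- v2 :^ 2 :* v5) :+ kk :^ 2 :* (v2 :^ 2 :* v5)

  U-ã²b̃² : ν · U (ã ^S 2 · b̃ ^S 2) ≈ y ^S 3 · (y · ν ⊖ constant (+ 2) · ν ^S 2 ⊕ constant (+ 8) · y ^S 2)
  U-ã²b̃² = unit-cancel (u · u) (trans (·-constantTerm u u) (cong₂ _*ℤ_ u-0 u-0)) (solveWith (k ∷ m ∷ m⁻ ∷ y ∷ ν ∷ U (ã ^S 2 · b̃ ^S 2) ∷ [])
      (U' :* U' :* (v4 :* v5)) (U' :* U' :* (v3 :^ 3 :* (v3 :* v4 :- # 2 :* v4 :^ 2 :+ # 8 :* v3 :^ 2)))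
      (hyp (U' :* v4) (U' :* v5) (v3 :^ 3 :* Q) Uu
      (hyp (v3 :^ 3 :* (Q :+ # 2 :* (U' :* v4 :+ :one :- v0 :^ 2) :- v3 :* U')) (v4 :* U') (:one :- v0 :^ 2) νu
      (hyp (v3 :^ 3 :* (:- (:one :- v0 :^ 2) :- # 8 :* (v3 :* U' :+ v0))) (v3 :* U') v0 yu
      (hyp (v3 :^ 3 :* (:one :+ v0) :* (# 2 :* v0)) v1 (:one :+ v0 :* (v1 :+ :one)) m-relation
      (hyp (v3 :^ 3 :* (:one :- v0) :* (# 2 :* v0) :* v2) v1 (:one :+ v0 :* (v1 :+ :one)) m-relation
      (hyp (:- (v3 :^ 3 :* (:one :- v0) :* (# 2 :* v0) :* (:one :- v0))) (v1 :* v2) :one m-inverse done)))))) refl)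
    where
    U' Q : Expr 6
    U' = :one :- # 4 :* v0 :- v0 :^ 2
    Q  = v0 :* (:one :+ # 2 :* (v1 :- v2)) :- # 2 :* (:one :- v0 :^ 2)
    bracket : U (ã ^S 2 · b̃ ^S 2) ≈ q ^S 3 · η ^S 4 · (q · (one ⊕ constant (+ 2) · (m ⊖ m⁻)) ⊖ constant (+ 2) · (p̂ · ĝ))
    bracket = ≈-trans (component 0 0<5 base (eã :^ 2 :* eb̃ :^ 2)
        (v0 :^ 3 :* v1 :^ 4 :* (v0 :* ((:one :- # 2 :* (v2 :* v3)) :* (:one :- # 2 :* (v4 :* v5)) :+ # 2 :* (v3 :^ 2 :* v4 :- v2 :^ 2 :* v5))
          :- # 2 :* (v3 :* v5 :^ 2 :- v0 :^ 2 :* (v2 :* v4 :^ 2)))) refl)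
      (solveWith (q ∷ η ∷ ρ ∷ ρ⁻ ∷ σ ∷ σ⁻ ∷ p̂ · ĝ ∷ [])
        (v0 :^ 3 :* v1 :^ 4 :* (v0 :* ((:one :- # 2 :* (v2 :* v3)) :* (:one :- # 2 :* (v4 :* v5)) :+ # 2 :* (v3 :^ 2 :* v4 :- v2 :^ 2 :* v5))
          :- # 2 :* (v3 :* v5 :^ 2 :- v0 :^ 2 :* (v2 :* v4 :^ 2))))
        (v0 :^ 3 :* v1 :^ 4 :* (v0 :* (:one :+ # 2 :* (v3 :^ 2 :* v4 :- v2 :^ 2 :* v5)) :- # 2 :* v6))
        (hyp (:- (# 2 :* v0 :^ 4 :* v1 :^ 4 :* (:one :- # 2 :* (v4 :* v5)))) (v2 :* v3) :one ρ-inverse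
        (hyp (# 2 :* v0 :^ 4 :* v1 :^ 4) (v4 :* v5) :one σ-inverse
        (hyp (# 2 :* v0 :^ 3 :* v1 :^ 4) v6 (v3 :* v5 :^ 2 :- v0 :^ 2 :* (v2 :* v4 :^ 2)) pg-formula done))) refl)
    Uu : u · U (ã ^S 2 · b̃ ^S 2) ≈ y ^S 3 · (k · (one ⊕ constant (+ 2) · (m ⊖ m⁻)) ⊖ constant (+ 2) · (one ⊖ k ^S 2))
    Uu = k-cancel (≈-trans (·-congˡ (·-congˡ bracket)) (solveWith (q ∷ η ∷ k ∷ m ∷ m⁻ ∷ p̂ · ĝ ∷ [])
      (v2 :* (UU :* (v0 :^ 3 :* v1 :^ 4 :* (v0 :* (:one :+ # 2 :* (v3 :- v4)) :- # 2 :* v5))))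
      (v2 :* ((v0 :* v1) :^ 3 :* QQ))
      (hyp ((v0 :* v1) :^ 3 :* QQ) ((v0 :* v1) :* UU) v2 yu
      (hyp (:- (# 2 :* UU :* v0 :^ 3 :* v1 :^ 4)) (v2 :* v5) (v0 :* (:one :- v2 :^ 2)) k-pg done)) refl))
      where
      UU QQ : Expr 6
      UU = :one :- # 4 :* v2 :- v2 :^ 2
      QQ = v2 :* (:one :+ # 2 :* (v3 :- v4)) :- # 2 :* (:one :- v2 :^ 2)

-- Values of U on ã τʲ and ã² τʲ

U-⊕ : ∀ f g → U (f ⊕ g) ≈ U f ⊕ U g
U-⊕ = comp-⊕ 0

U-poly : ∀ (c : Expr 1) h → U (eval c (y₅ ∷ []) · h) ≈ eval c (y ∷ []) · U h
U-poly c h = ≈-trans (U-cong (·-congʳ (≈-sym (D-eval c (y ∷ []))))) (U-D· (eval c (y ∷ [])) h)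

Ea Eb : ℕ → Series
Ea j = U (ã · τ ^S j)
Eb j = U (ã ^S 2 · τ ^S j)

private
  env₅ : Vec Series 7
  env₅ = y₅ ∷ ã ∷ b̃ ∷ τ ∷ κ₅ ∷ ν₅ ∷ ν ∷ []

  -- This relation and the next rewrite y₅ b̃ and ν₅ ã² through ã and τ with coefficients in ℤ[y₅].
  -- They translate monomials in ã and b̃, where U is known, into ã τʲ and ã² τʲ.
  b̃y₅' : eval (v0 :* v2) env₅ ≈ eval (K :* v1 :* (v3 :+ # 4 :* v0)) env₅
  b̃y₅' = solveWith env₅ (v0 :* v2) (K :* v1 :* (v3 :+ # 4 :* v0))
    (hyp :one (v2 :* v0) (v4 :* (v1 :* (v6 :* v3))) b̃y₅
    (hyp (v4 :* v1) (v6 :* v3) (v3 :+ # 4 :* v0) ντ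
    (hyp (v1 :* (v3 :+ # 4 :* v0)) v4 K κ₅-formula done))) refl

  ã²' : eval (N :* v1 :^ 2) env₅ ≈ eval (K :^ 2 :* (v3 :+ # 4 :* v0) :* v3) env₅
  ã²' = solveWith env₅ (N :* v1 :^ 2) (K :^ 2 :* (v3 :+ # 4 :* v0) :* v3)
    (hyp :one (v1 :^ 2 :* v5) (v4 :^ 2 :* (v6 :* v3 :^ 2)) ã²
    (hyp (v4 :^ 2 :* v3) (v6 :* v3) (v3 :+ # 4 :* v0) ντ
    (hyp (v3 :* (v3 :+ # 4 :* v0) :* (v4 :+ K)) v4 K κ₅-formula
    (hyp (:- (v1 :^ 2)) v5 N ν₅-formula done)))) refl

  infixr 5 _⊕U_
  _⊕U_ : ∀ {f g f' g'} → U f ≈ f' → U g ≈ g' → U (f ⊕ g) ≈ f' ⊕ g'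
  p ⊕U r = ≈-trans (U-⊕ _ _) (⊕-cong p r)

  -- In this equation and its analogues the left side is known and the unknown of highest index
  -- carries a power of κ. The systems are triangular and are solved upwards, with denominator κ⁴.
  relation-Ea₁ : y · U b̃ ≈ κ · Ea 1 ⊕ eval (# 4 :* v0 :* K) (y ∷ []) · Ea 0
  relation-Ea₁ = ≈-trans (≈-sym (U-poly v0 b̃)) (≈-trans
    (U-cong (≈-trans b̃y₅' (decide env₅ (K :* v1 :* (v3 :+ # 4 :* v0)) (K :* (v1 :* v3 :^ 1) :+ # 4 :* v0 :* K :* (v1 :* v3 :^ 0)) refl)))
    (U-poly K _ ⊕U U-poly (# 4 :* v0 :* K) _))

  relation-Ea₂ : ν · U (ã ^S 3) ≈ eval (K :^ 2) (y ∷ []) · Ea 2 ⊕ eval (# 4 :* v0 :* K :^ 2) (y ∷ []) · Ea 1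
  relation-Ea₂ = ≈-trans (≈-sym (U-poly N (ã ^S 3))) (≈-trans
    (U-cong (solveWith env₅ (N :* v1 :^ 3) (K :^ 2 :* (v1 :* v3 :^ 2) :+ # 4 :* v0 :* K :^ 2 :* (v1 :* v3 :^ 1))
      (hyp v1 (N :* v1 :^ 2) (K :^ 2 :* (v3 :+ # 4 :* v0) :* v3) ã²' done) refl))
    (U-poly (K :^ 2) _ ⊕U U-poly (# 4 :* v0 :* K :^ 2) _))

  relation-Ea₃ : eval (v0 :* N) (y ∷ []) · U (ã ^S 2 · b̃)
    ≈ eval (K :^ 3) (y ∷ []) · Ea 3 ⊕ (eval (# 8 :* v0 :* K :^ 3) (y ∷ []) · Ea 2 ⊕ eval (# 16 :* v0 :^ 2 :* K :^ 3) (y ∷ []) · Ea 1)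
  relation-Ea₃ = ≈-trans (≈-sym (U-poly (v0 :* N) (ã ^S 2 · b̃))) (≈-trans
    (U-cong (solveWith env₅ (v0 :* N :* (v1 :^ 2 :* v2))
      (K :^ 3 :* (v1 :* v3 :^ 3) :+ (# 8 :* v0 :* K :^ 3 :* (v1 :* v3 :^ 2) :+ # 16 :* v0 :^ 2 :* K :^ 3 :* (v1 :* v3 :^ 1)))
      (hyp (v0 :* v2) (N :* v1 :^ 2) (K :^ 2 :* (v3 :+ # 4 :* v0) :* v3) ã²'
      (hyp (K :^ 2 :* (v3 :+ # 4 :* v0) :* v3) (v0 :* v2) (K :* v1 :* (v3 :+ # 4 :* v0)) b̃y₅' done)) refl))
    (U-poly (K :^ 3) _ ⊕U U-poly (# 8 :* v0 :* K :^ 3) _ ⊕U U-poly (# 16 :* v0 :^ 2 :* K :^ 3) _))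

  relation-Ea₄ : eval (v0 :^ 2 :* N) (y ∷ []) · U (ã · b̃ ^S 2)
    ≈ eval (K :^ 4) (y ∷ []) · Ea 4 ⊕ (eval (# 12 :* v0 :* K :^ 4) (y ∷ []) · Ea 3
      ⊕ (eval (# 48 :* v0 :^ 2 :* K :^ 4) (y ∷ []) · Ea 2 ⊕ eval (# 64 :* v0 :^ 3 :* K :^ 4) (y ∷ []) · Ea 1))
  relation-Ea₄ = ≈-trans (≈-sym (U-poly (v0 :^ 2 :* N) (ã · b̃ ^S 2))) (≈-trans
    (U-cong (solveWith env₅ (v0 :^ 2 :* N :* (v1 :* v2 :^ 2))
      (K :^ 4 :* (v1 :* v3 :^ 4) :+ (# 12 :* v0 :* K :^ 4 :* (v1 :* v3 :^ 3)
        :+ (# 48 :* v0 :^ 2 :* K :^ 4 :* (v1 :* v3 :^ 2) :+ # 64 :* v0 :^ 3 :* K :^ 4 :* (v1 :* v3 :^ 1))))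
      (hyp (N :* v1 :* (v0 :* v2 :+ K :* v1 :* (v3 :+ # 4 :* v0))) (v0 :* v2) (K :* v1 :* (v3 :+ # 4 :* v0)) b̃y₅'
      (hyp (K :^ 2 :* v1 :* (v3 :+ # 4 :* v0) :^ 2) (N :* v1 :^ 2) (K :^ 2 :* (v3 :+ # 4 :* v0) :* v3) ã²' done)) refl))
    (U-poly (K :^ 4) _ ⊕U U-poly (# 12 :* v0 :* K :^ 4) _ ⊕U U-poly (# 48 :* v0 :^ 2 :* K :^ 4) _ ⊕U U-poly (# 64 :* v0 :^ 3 :* K :^ 4) _))

  relation-Eb₁ : y · U (ã · b̃) ≈ κ · Eb 1 ⊕ eval (# 4 :* v0 :* K) (y ∷ []) · Eb 0
  relation-Eb₁ = ≈-trans (≈-sym (U-poly v0 (ã · b̃))) (≈-trans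
    (U-cong (solveWith env₅ (v0 :* (v1 :* v2)) (K :* (v1 :^ 2 :* v3 :^ 1) :+ # 4 :* v0 :* K :* (v1 :^ 2 :* v3 :^ 0))
      (hyp v1 (v0 :* v2) (K :* v1 :* (v3 :+ # 4 :* v0)) b̃y₅' done) refl))
    (U-poly K _ ⊕U U-poly (# 4 :* v0 :* K) _))

  relation-Eb₂ : eval (v0 :^ 2) (y ∷ []) · U (b̃ ^S 2)
    ≈ eval (K :^ 2) (y ∷ []) · Eb 2 ⊕ (eval (# 8 :* v0 :* K :^ 2) (y ∷ []) · Eb 1 ⊕ eval (# 16 :* v0 :^ 2 :* K :^ 2) (y ∷ []) · Eb 0)
  relation-Eb₂ = ≈-trans (≈-sym (U-poly (v0 :^ 2) (b̃ ^S 2))) (≈-trans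
    (U-cong (solveWith env₅ (v0 :^ 2 :* v2 :^ 2)
      (K :^ 2 :* (v1 :^ 2 :* v3 :^ 2) :+ (# 8 :* v0 :* K :^ 2 :* (v1 :^ 2 :* v3 :^ 1) :+ # 16 :* v0 :^ 2 :* K :^ 2 :* (v1 :^ 2 :* v3 :^ 0)))
      (hyp (v0 :* v2 :+ K :* v1 :* (v3 :+ # 4 :* v0)) (v0 :* v2) (K :* v1 :* (v3 :+ # 4 :* v0)) b̃y₅' done) refl))
    (U-poly (K :^ 2) _ ⊕U U-poly (# 8 :* v0 :* K :^ 2) _ ⊕U U-poly (# 16 :* v0 :^ 2 :* K :^ 2) _))

  relation-Eb₃ : eval (v0 :* N) (y ∷ []) · U (ã ^S 3 · b̃)
    ≈ eval (K :^ 3) (y ∷ []) · Eb 3 ⊕ (eval (# 8 :* v0 :* K :^ 3) (y ∷ []) · Eb 2 ⊕ eval (# 16 :* v0 :^ 2 :* K :^ 3) (y ∷ []) · Eb 1)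
  relation-Eb₃ = ≈-trans (≈-sym (U-poly (v0 :* N) (ã ^S 3 · b̃))) (≈-trans
    (U-cong (solveWith env₅ (v0 :* N :* (v1 :^ 3 :* v2))
      (K :^ 3 :* (v1 :^ 2 :* v3 :^ 3) :+ (# 8 :* v0 :* K :^ 3 :* (v1 :^ 2 :* v3 :^ 2) :+ # 16 :* v0 :^ 2 :* K :^ 3 :* (v1 :^ 2 :* v3 :^ 1)))
      (hyp (v0 :* v1 :* v2) (N :* v1 :^ 2) (K :^ 2 :* (v3 :+ # 4 :* v0) :* v3) ã²'
      (hyp (v1 :* K :^ 2 :* (v3 :+ # 4 :* v0) :* v3) (v0 :* v2) (K :* v1 :* (v3 :+ # 4 :* v0)) b̃y₅' done)) refl))
    (U-poly (K :^ 3) _ ⊕U U-poly (# 8 :* v0 :* K :^ 3) _ ⊕U U-poly (# 16 :* v0 :^ 2 :* K :^ 3) _))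

  relation-Eb₄ : eval (v0 :^ 2 :* N) (y ∷ []) · U (ã ^S 2 · b̃ ^S 2)
    ≈ eval (K :^ 4) (y ∷ []) · Eb 4 ⊕ (eval (# 12 :* v0 :* K :^ 4) (y ∷ []) · Eb 3
      ⊕ (eval (# 48 :* v0 :^ 2 :* K :^ 4) (y ∷ []) · Eb 2 ⊕ eval (# 64 :* v0 :^ 3 :* K :^ 4) (y ∷ []) · Eb 1))
  relation-Eb₄ = ≈-trans (≈-sym (U-poly (v0 :^ 2 :* N) (ã ^S 2 · b̃ ^S 2))) (≈-trans
    (U-cong (solveWith env₅ (v0 :^ 2 :* N :* (v1 :^ 2 :* v2 :^ 2))
      (K :^ 4 :* (v1 :^ 2 :* v3 :^ 4) :+ (# 12 :* v0 :* K :^ 4 :* (v1 :^ 2 :* v3 :^ 3)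
        :+ (# 48 :* v0 :^ 2 :* K :^ 4 :* (v1 :^ 2 :* v3 :^ 2) :+ # 64 :* v0 :^ 3 :* K :^ 4 :* (v1 :^ 2 :* v3 :^ 1))))
      (hyp (N :* v1 :^ 2 :* (v0 :* v2 :+ K :* v1 :* (v3 :+ # 4 :* v0))) (v0 :* v2) (K :* v1 :* (v3 :+ # 4 :* v0)) b̃y₅'
      (hyp (K :^ 2 :* v1 :^ 2 :* (v3 :+ # 4 :* v0) :^ 2) (N :* v1 :^ 2) (K :^ 2 :* (v3 :+ # 4 :* v0) :* v3) ã²' done)) refl))
    (U-poly (K :^ 4) _ ⊕U U-poly (# 12 :* v0 :* K :^ 4) _ ⊕U U-poly (# 48 :* v0 :^ 2 :* K :^ 4) _ ⊕U U-poly (# 64 :* v0 :^ 3 :* K :^ 4) _))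

-- κ⁴ U (ã τ^j) and κ⁴ U (ã² τ^j) are the polynomials Aⱼ and Bⱼ in y.

A₀ A₁ A₂ A₃ A₄ B₀ B₁ B₂ B₃ B₄ : ∀ {n} → Expr (suc n)
A₀ = :- (v0 :* K :^ 4)
A₁ = K :^ 3 :* (# 4 :* v0 :^ 2 :* K :- v0 :^ 2)
A₂ = # 5 :* N :* v0 :^ 3 :* K :^ 2 :- # 4 :* v0 :* A₁
A₃ = K :* v0 :^ 4 :- # 8 :* v0 :* A₂ :- # 16 :* v0 :^ 2 :* A₁
A₄ = v0 :^ 4 :* N :* K :- # 12 :* v0 :* A₃ :- # 48 :* v0 :^ 2 :* A₂ :- # 64 :* v0 :^ 3 :* A₁
B₀ = :- (v0 :^ 2 :* K :^ 4)
B₁ = K :^ 3 :* v0 :^ 3 :- # 4 :* v0 :* B₀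
B₂ = :- (K :^ 2 :* v0 :^ 4) :- # 8 :* v0 :* B₁ :- # 16 :* v0 :^ 2 :* B₀
B₃ = K :* v0 :^ 4 :* (N :^ 2 :- # 3 :* (v0 :* N) :+ # 16 :* v0 :^ 2) :- # 8 :* v0 :* B₂ :- # 16 :* v0 :^ 2 :* B₁
B₄ = v0 :^ 5 :* (v0 :* N :- # 2 :* N :^ 2 :+ # 8 :* v0 :^ 2) :- # 12 :* v0 :* B₃ :- # 48 :* v0 :^ 2 :* B₂ :- # 64 :* v0 :^ 3 :* B₁

κ⁴Ea₀ : κ ^S 4 · Ea 0 ≈ eval A₀ (y ∷ [])
κ⁴Ea₀ = ≈-trans (·-congˡ (≈-trans (U-cong (·-identityʳ ã)) U-ã)) (decide (y ∷ []) (K :^ 4 :* :- v0) A₀ refl)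

κ⁴Ea₁ : κ ^S 4 · Ea 1 ≈ eval A₁ (y ∷ [])
κ⁴Ea₁ = solveWith (y ∷ Ea 0 ∷ Ea 1 ∷ U b̃ ∷ []) (K :^ 4 :* v2) A₁
  (hyp (:- (K :^ 3)) (v0 :* v3) (K :* v2 :+ # 4 :* v0 :* K :* v1) relation-Ea₁
  (hyp (K :^ 3 :* v0) v3 (:- v0) U-b̃
  (hyp (:- (# 4 :* v0)) (K :^ 4 :* v1) A₀ κ⁴Ea₀ done))) refl

κ⁴Ea₂ : κ ^S 4 · Ea 2 ≈ eval A₂ (y ∷ [])
κ⁴Ea₂ = solveWith (y ∷ Ea 1 ∷ Ea 2 ∷ U (ã ^S 3) ∷ []) (K :^ 4 :* v2) A₂
  (hyp (:- (K :^ 2)) (N :* v3) (K :^ 2 :* v2 :+ # 4 :* v0 :* K :^ 2 :* v1) relation-Ea₂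
  (hyp (K :^ 2 :* N) v3 (# 5 :* v0 :^ 3) U-ã³
  (hyp (:- (# 4 :* v0)) (K :^ 4 :* v1) A₁ κ⁴Ea₁ done))) refl

κ⁴Ea₃ : κ ^S 4 · Ea 3 ≈ eval A₃ (y ∷ [])
κ⁴Ea₃ = solveWith (y ∷ Ea 1 ∷ Ea 2 ∷ Ea 3 ∷ U (ã ^S 2 · b̃) ∷ []) (K :^ 4 :* v3) A₃
  (hyp (:- K) (v0 :* N :* v4) (K :^ 3 :* v3 :+ (# 8 :* v0 :* K :^ 3 :* v2 :+ # 16 :* v0 :^ 2 :* K :^ 3 :* v1)) relation-Ea₃
  (hyp (K :* v0) (N :* v4) (v0 :^ 3) U-ã²b̃
  (hyp (:- (# 8 :* v0)) (K :^ 4 :* v2) A₂ κ⁴Ea₂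
  (hyp (:- (# 16 :* v0 :^ 2)) (K :^ 4 :* v1) A₁ κ⁴Ea₁ done)))) refl

κ⁴Ea₄ : κ ^S 4 · Ea 4 ≈ eval A₄ (y ∷ [])
κ⁴Ea₄ = solveWith (y ∷ Ea 1 ∷ Ea 2 ∷ Ea 3 ∷ Ea 4 ∷ U (ã · b̃ ^S 2) ∷ []) (K :^ 4 :* v4) A₄
  (hyp (:- :one) (v0 :^ 2 :* N :* v5) (K :^ 4 :* v4 :+ (# 12 :* v0 :* K :^ 4 :* v3 :+ (# 48 :* v0 :^ 2 :* K :^ 4 :* v2 :+ # 64 :* v0 :^ 3 :* K :^ 4 :* v1))) relation-Ea₄
  (hyp (v0 :^ 2 :* N) v5 (K :* v0 :^ 2) U-ãb̃²
  (hyp (:- (# 12 :* v0)) (K :^ 4 :* v3) A₃ κ⁴Ea₃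
  (hyp (:- (# 48 :* v0 :^ 2)) (K :^ 4 :* v2) A₂ κ⁴Ea₂
  (hyp (:- (# 64 :* v0 :^ 3)) (K :^ 4 :* v1) A₁ κ⁴Ea₁ done))))) refl

κ⁴Eb₀ : κ ^S 4 · Eb 0 ≈ eval B₀ (y ∷ [])
κ⁴Eb₀ = ≈-trans (·-congˡ (≈-trans (U-cong (·-identityʳ (ã ^S 2))) U-ã²)) (decide (y ∷ []) (K :^ 4 :* :- (v0 :^ 2)) B₀ refl)

κ⁴Eb₁ : κ ^S 4 · Eb 1 ≈ eval B₁ (y ∷ [])
κ⁴Eb₁ = solveWith (y ∷ Eb 0 ∷ Eb 1 ∷ U (ã · b̃) ∷ []) (K :^ 4 :* v2) B₁
  (hyp (:- (K :^ 3)) (v0 :* v3) (K :* v2 :+ # 4 :* v0 :* K :* v1) relation-Eb₁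
  (hyp (K :^ 3 :* v0) v3 (v0 :^ 2) U-ãb̃
  (hyp (:- (# 4 :* v0)) (K :^ 4 :* v1) B₀ κ⁴Eb₀ done))) refl

κ⁴Eb₂ : κ ^S 4 · Eb 2 ≈ eval B₂ (y ∷ [])
κ⁴Eb₂ = solveWith (y ∷ Eb 0 ∷ Eb 1 ∷ Eb 2 ∷ U (b̃ ^S 2) ∷ []) (K :^ 4 :* v3) B₂
  (hyp (:- (K :^ 2)) (v0 :^ 2 :* v4) (K :^ 2 :* v3 :+ (# 8 :* v0 :* K :^ 2 :* v2 :+ # 16 :* v0 :^ 2 :* K :^ 2 :* v1)) relation-Eb₂
  (hyp (K :^ 2 :* v0 :^ 2) v4 (:- (v0 :^ 2)) U-b̃²
  (hyp (:- (# 8 :* v0)) (K :^ 4 :* v2) B₁ κ⁴Eb₁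
  (hyp (:- (# 16 :* v0 :^ 2)) (K :^ 4 :* v1) B₀ κ⁴Eb₀ done)))) refl

κ⁴Eb₃ : κ ^S 4 · Eb 3 ≈ eval B₃ (y ∷ [])
κ⁴Eb₃ = solveWith (y ∷ Eb 1 ∷ Eb 2 ∷ Eb 3 ∷ U (ã ^S 3 · b̃) ∷ []) (K :^ 4 :* v3) B₃
  (hyp (:- K) (v0 :* N :* v4) (K :^ 3 :* v3 :+ (# 8 :* v0 :* K :^ 3 :* v2 :+ # 16 :* v0 :^ 2 :* K :^ 3 :* v1)) relation-Eb₃
  (hyp (K :* v0) (N :* v4) (v0 :^ 3 :* (N :^ 2 :- # 3 :* (v0 :* N) :+ # 16 :* v0 :^ 2)) U-ã³b̃
  (hyp (:- (# 8 :* v0)) (K :^ 4 :* v2) B₂ κ⁴Eb₂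
  (hyp (:- (# 16 :* v0 :^ 2)) (K :^ 4 :* v1) B₁ κ⁴Eb₁ done)))) refl

κ⁴Eb₄ : κ ^S 4 · Eb 4 ≈ eval B₄ (y ∷ [])
κ⁴Eb₄ = solveWith (y ∷ Eb 1 ∷ Eb 2 ∷ Eb 3 ∷ Eb 4 ∷ U (ã ^S 2 · b̃ ^S 2) ∷ []) (K :^ 4 :* v4) B₄
  (hyp (:- :one) (v0 :^ 2 :* N :* v5) (K :^ 4 :* v4 :+ (# 12 :* v0 :* K :^ 4 :* v3 :+ (# 48 :* v0 :^ 2 :* K :^ 4 :* v2 :+ # 64 :* v0 :^ 3 :* K :^ 4 :* v1))) relation-Eb₄
  (hyp (v0 :^ 2) (N :* v5) (v0 :^ 3 :* (v0 :* N :- # 2 :* N :^ 2 :+ # 8 :* v0 :^ 2)) U-ã²b̃²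
  (hyp (:- (# 12 :* v0)) (K :^ 4 :* v3) B₃ κ⁴Eb₃
  (hyp (:- (# 48 :* v0 :^ 2)) (K :^ 4 :* v2) B₂ κ⁴Eb₂
  (hyp (:- (# 64 :* v0 :^ 3)) (K :^ 4 :* v1) B₁ κ⁴Eb₁ done))))) refl

-- `modular-quintic` is multiplied by h yⁿ; its coefficients are polynomials in y(q⁵) and leave U as
-- the same polynomials in y.
quintic-recurrence : ∀ h n → U (h · y ^S (5 + n)) ≈ eval c₀ (y ∷ []) · U (h · y ^S n) ⊕ (eval c₁ (y ∷ []) · U (h · y ^S (1 + n))
  ⊕ (eval c₂ (y ∷ []) · U (h · y ^S (2 + n)) ⊕ (eval c₃ (y ∷ []) · U (h · y ^S (3 + n)) ⊕ eval c₄ (y ∷ []) · U (h · y ^S (4 + n)))))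
quintic-recurrence h n = ≈-trans (U-cong (solveWith (C₀ ∷ C₁ ∷ C₂ ∷ C₃ ∷ C₄ ∷ y ∷ h ∷ y ^S n ∷ [])
    (v6 :* (v5 :* (v5 :* (v5 :* (v5 :* (v5 :* v7))))))
    (v0 :* (v6 :* v7) :+ (v1 :* (v6 :* (v5 :* v7)) :+ (v2 :* (v6 :* (v5 :* (v5 :* v7))) :+ (v3 :* (v6 :* (v5 :* (v5 :* (v5 :* v7)))) :+ v4 :* (v6 :* (v5 :* (v5 :* (v5 :* (v5 :* v7)))))))))
    (hyp (v6 :* v7) (v5 :^ 5) (v0 :+ v1 :* v5 :+ v2 :* v5 :^ 2 :+ v3 :* v5 :^ 3 :+ v4 :* v5 :^ 4) modular-quintic done) refl))
  (U-poly c₀ _ ⊕U U-poly c₁ _ ⊕U U-poly c₂ _ ⊕U U-poly c₃ _ ⊕U U-poly c₄ _)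
  where
  C₀ C₁ C₂ C₃ C₄ : Series
  C₀ = eval c₀ (y₅ ∷ [])
  C₁ = eval c₁ (y₅ ∷ [])
  C₂ = eval c₂ (y₅ ∷ [])
  C₃ = eval c₃ (y₅ ∷ [])
  C₄ = eval c₄ (y₅ ∷ [])

-- A window holds κ⁴ U (h yⁿ), …, κ⁴ U (h yⁿ⁺⁴) as polynomials in y; quintic-recurrence moves it on.

record Window : Set where
  constructor window
  field w₀ w₁ w₂ w₃ w₄ : Poly 1
open Window

next : Window → Window
next (window p₀ p₁ p₂ p₃ p₄) = window p₁ p₂ p₃ p₄
  (normal c₀ *P p₀ +P (normal c₁ *P p₁ +P (normal c₂ *P p₂ +P (normal c₃ *P p₃ +P normal c₄ *P p₄))))

record Represents (h : Series) (n : ℕ) (w : Window) : Set where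
  field
    r₀ : κ ^S 4 · U (h · y ^S n) ≈ ⟦ w₀ w ⟧ (y ∷ [])
    r₁ : κ ^S 4 · U (h · y ^S (1 + n)) ≈ ⟦ w₁ w ⟧ (y ∷ [])
    r₂ : κ ^S 4 · U (h · y ^S (2 + n)) ≈ ⟦ w₂ w ⟧ (y ∷ [])
    r₃ : κ ^S 4 · U (h · y ^S (3 + n)) ≈ ⟦ w₃ w ⟧ (y ∷ [])
    r₄ : κ ^S 4 · U (h · y ^S (4 + n)) ≈ ⟦ w₄ w ⟧ (y ∷ [])
open Represents

next-represents : ∀ {h n w} → Represents h n w → Represents h (suc n) (next w)
next-represents {h} {n} {w} r = record { r₀ = r₁ r ; r₁ = r₂ r ; r₂ = r₃ r ; r₃ = r₄ r ; r₄ = last }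
  where
  open ≈-Reasoning
  product : ∀ (c : Expr 1) (p : Poly 1) → eval c (y ∷ []) · ⟦ p ⟧ (y ∷ []) ≈ ⟦ normal c *P p ⟧ (y ∷ [])
  product c p = ≈-sym (≈-trans (*P-sound (normal c) p (y ∷ [])) (·-congʳ (normal-sound c (y ∷ []))))
  sum : ∀ {f g} (p p' : Poly 1) → f ≈ ⟦ p ⟧ (y ∷ []) → g ≈ ⟦ p' ⟧ (y ∷ []) → f ⊕ g ≈ ⟦ p +P p' ⟧ (y ∷ [])
  sum p p' hf hg = ≈-trans (⊕-cong hf hg) (≈-sym (+P-sound p p' (y ∷ [])))
  t₀ t₁ t₂ t₃ t₄ : Poly 1
  t₀ = normal c₀ *P w₀ w
  t₁ = normal c₁ *P w₁ w
  t₂ = normal c₂ *P w₂ w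
  t₃ = normal c₃ *P w₃ w
  t₄ = normal c₄ *P w₄ w
  U₀ U₁ U₂ U₃ U₄ C₀ C₁ C₂ C₃ C₄ : Series
  U₀ = U (h · y ^S n)
  U₁ = U (h · y ^S (1 + n))
  U₂ = U (h · y ^S (2 + n))
  U₃ = U (h · y ^S (3 + n))
  U₄ = U (h · y ^S (4 + n))
  C₀ = eval c₀ (y ∷ [])
  C₁ = eval c₁ (y ∷ [])
  C₂ = eval c₂ (y ∷ [])
  C₃ = eval c₃ (y ∷ [])
  C₄ = eval c₄ (y ∷ [])
  last : κ ^S 4 · U (h · y ^S (5 + n)) ≈ ⟦ w₄ (next w) ⟧ (y ∷ [])
  last = begin
    κ ^S 4 · U (h · y ^S (5 + n))
      ≈⟨ ·-congˡ (quintic-recurrence h n) ⟩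
    κ ^S 4 · (C₀ · U₀ ⊕ (C₁ · U₁ ⊕ (C₂ · U₂ ⊕ (C₃ · U₃ ⊕ C₄ · U₄))))
      ≈⟨ decide (κ ^S 4 ∷ C₀ ∷ C₁ ∷ C₂ ∷ C₃ ∷ C₄ ∷ U₀ ∷ U₁ ∷ U₂ ∷ U₃ ∷ U₄ ∷ [])
           (v0 :* (v1 :* v6 :+ (v2 :* v7 :+ (v3 :* v8 :+ (v4 :* v9 :+ v5 :* v10)))))
           (v1 :* (v0 :* v6) :+ (v2 :* (v0 :* v7) :+ (v3 :* (v0 :* v8) :+ (v4 :* (v0 :* v9) :+ v5 :* (v0 :* v10))))) refl ⟩
    C₀ · (κ ^S 4 · U₀) ⊕ (C₁ · (κ ^S 4 · U₁) ⊕ (C₂ · (κ ^S 4 · U₂) ⊕ (C₃ · (κ ^S 4 · U₃) ⊕ C₄ · (κ ^S 4 · U₄))))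
      ≈⟨ ⊕-cong (·-congˡ (r₀ r)) (⊕-cong (·-congˡ (r₁ r)) (⊕-cong (·-congˡ (r₂ r)) (⊕-cong (·-congˡ (r₃ r)) (·-congˡ (r₄ r))))) ⟩
    C₀ · ⟦ w₀ w ⟧ (y ∷ []) ⊕ (C₁ · ⟦ w₁ w ⟧ (y ∷ []) ⊕ (C₂ · ⟦ w₂ w ⟧ (y ∷ []) ⊕ (C₃ · ⟦ w₃ w ⟧ (y ∷ []) ⊕ C₄ · ⟦ w₄ w ⟧ (y ∷ []))))
      ≈⟨ sum t₀ (t₁ +P (t₂ +P (t₃ +P t₄))) (product c₀ (w₀ w)) (sum t₁ (t₂ +P (t₃ +P t₄)) (product c₁ (w₁ w))
           (sum t₂ (t₃ +P t₄) (product c₂ (w₂ w)) (sum t₃ t₄ (product c₃ (w₃ w)) (product c₄ (w₄ w))))) ⟩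
    ⟦ w₄ (next w) ⟧ (y ∷ []) ∎

advance : ℕ → Window → Window
advance zero    w = w
advance (suc n) w = advance n (next w)

advance-represents : ∀ {h} j {n w} → Represents h n w → Represents h (j + n) (advance j w)
advance-represents zero r = r
advance-represents {h} (suc j) {n} {w} r = subst (λ m → Represents h m (advance j (next w))) (ℕₚ.+-suc j n) (advance-represents j (next-represents r))

-- The power τ⁴ provides five consecutive starting values: τ⁴ yⁿ = y₅ⁿ τ^(4-n) for n ≤ 4, and U is
-- known on ã τʲ and ã² τʲ for j ≤ 4.
hA hB : Series
hA = ã · τ ^S 4
hB = ã ^S 2 · τ ^S 4

windowA windowB : Window
windowA = window (normal A₄) (normal (v0 :^ 1 :* A₃)) (normal (v0 :^ 2 :* A₂)) (normal (v0 :^ 3 :* A₁)) (normal (v0 :^ 4 :* A₀))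
windowB = window (normal B₄) (normal (v0 :^ 1 :* B₃)) (normal (v0 :^ 2 :* B₂)) (normal (v0 :^ 3 :* B₁)) (normal (v0 :^ 4 :* B₀))

private
  initial : ∀ (x : Series) j n (e : Expr 1) → κ ^S 4 · U (x · τ ^S j) ≈ eval e (y ∷ []) →
    x · τ ^S 4 · y ^S n ≈ eval (v0 :^ n) (y₅ ∷ []) · (x · τ ^S j) → κ ^S 4 · U (x · τ ^S 4 · y ^S n) ≈ ⟦ normal (v0 :^ n :* e) ⟧ (y ∷ [])
  initial x j n e hE h = ≈-trans (·-congˡ (≈-trans (U-cong h) (U-poly (v0 :^ n) (x · τ ^S j))))
    (≈-trans (decide (κ ^S 4 ∷ y ^S n ∷ U (x · τ ^S j) ∷ []) (v0 :* (v1 :* v2)) (v1 :* (v0 :* v2)) refl)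
    (≈-trans (·-congˡ hE) (≈-sym (normal-sound (v0 :^ n :* e) (y ∷ [])))))

  trade : ∀ x → Vec Series 4
  trade x = x ∷ τ ∷ y ∷ y₅ ∷ []

  trade₁ : ∀ x → x · τ ^S 4 · y ^S 1 ≈ y₅ ^S 1 · (x · τ ^S 3)
  trade₁ x = solveWith (trade x) (v0 :* v1 :^ 4 :* v2 :^ 1) (v3 :^ 1 :* (v0 :* v1 :^ 3)) (hyp (v0 :* v1 :^ 3) (v1 :* v2) v3 τy done) refl
  trade₂ : ∀ x → x · τ ^S 4 · y ^S 2 ≈ y₅ ^S 2 · (x · τ ^S 2)
  trade₂ x = solveWith (trade x) (v0 :* v1 :^ 4 :* v2 :^ 2) (v3 :^ 2 :* (v0 :* v1 :^ 2)) (hyp (v0 :* v1 :^ 2 :* (v1 :* v2 :+ v3)) (v1 :* v2) v3 τy done) refl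
  trade₃ : ∀ x → x · τ ^S 4 · y ^S 3 ≈ y₅ ^S 3 · (x · τ ^S 1)
  trade₃ x = solveWith (trade x) (v0 :* v1 :^ 4 :* v2 :^ 3) (v3 :^ 3 :* (v0 :* v1 :^ 1))
    (hyp (v0 :* v1 :* ((v1 :* v2) :^ 2 :+ v1 :* v2 :* v3 :+ v3 :^ 2)) (v1 :* v2) v3 τy done) refl
  trade₄ : ∀ x → x · τ ^S 4 · y ^S 4 ≈ y₅ ^S 4 · (x · τ ^S 0)
  trade₄ x = solveWith (trade x) (v0 :* v1 :^ 4 :* v2 :^ 4) (v3 :^ 4 :* (v0 :* v1 :^ 0))
    (hyp (v0 :* (v1 :* v2 :+ v3) :* ((v1 :* v2) :^ 2 :+ v3 :^ 2)) (v1 :* v2) v3 τy done) refl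

windowA-represents : Represents hA 0 windowA
windowA-represents = record
  { r₀ = ≈-trans (·-congˡ (U-cong (·-identityʳ hA))) (≈-trans κ⁴Ea₄ (≈-sym (normal-sound A₄ (y ∷ []))))
  ; r₁ = initial ã 3 1 A₃ κ⁴Ea₃ (trade₁ ã)
  ; r₂ = initial ã 2 2 A₂ κ⁴Ea₂ (trade₂ ã)
  ; r₃ = initial ã 1 3 A₁ κ⁴Ea₁ (trade₃ ã)
  ; r₄ = initial ã 0 4 A₀ κ⁴Ea₀ (trade₄ ã) }

windowB-represents : Represents hB 0 windowB
windowB-represents = record
  { r₀ = ≈-trans (·-congˡ (U-cong (·-identityʳ hB))) (≈-trans κ⁴Eb₄ (≈-sym (normal-sound B₄ (y ∷ []))))
  ; r₁ = initial (ã ^S 2) 3 1 B₃ κ⁴Eb₃ (trade₁ (ã ^S 2))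
  ; r₂ = initial (ã ^S 2) 2 2 B₂ κ⁴Eb₂ (trade₂ (ã ^S 2))
  ; r₃ = initial (ã ^S 2) 1 3 B₁ κ⁴Eb₁ (trade₃ (ã ^S 2))
  ; r₄ = initial (ã ^S 2) 0 4 B₀ κ⁴Eb₀ (trade₄ (ã ^S 2)) }

gp hp : ℕ → Poly 1
gp n = w₀ (advance n windowA)
hp n = w₀ (advance n windowB)

gp-sound : ∀ n → κ ^S 4 · U (hA · y ^S n) ≈ ⟦ gp n ⟧ (y ∷ [])
gp-sound n = subst (λ m → κ ^S 4 · U (hA · y ^S m) ≈ ⟦ gp n ⟧ (y ∷ [])) (ℕₚ.+-identityʳ n) (r₀ (advance-represents n windowA-represents))

hp-sound : ∀ n → κ ^S 4 · U (hB · y ^S n) ≈ ⟦ hp n ⟧ (y ∷ [])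
hp-sound n = subst (λ m → κ ^S 4 · U (hB · y ^S m) ≈ ⟦ hp n ⟧ (y ∷ [])) (ℕₚ.+-identityʳ n) (r₀ (advance-represents n windowB-represents))

-- If A = Σ PDN1(n) qⁿ, then U (q A κν f) = A(q⁵) κν V₀ f and U (A(q⁵) κν f) = A κν V₁ f.

κν Φ : Series
κν = κ · ν
Φ  = q · (b̂ ^S 2 · inv (â ^S 5))

κν-0 : κν 0 ≡ 1ℤ
κν-0 = trans (·-constantTerm κ ν) (cong₂ _*ℤ_ κ-0 ν-0)

V₀ V₁ : Series → Series
V₀ f = inv κν · U (Φ · (κν · f))
V₁ f = inv κν · U (κν · f)

κνV₀ : ∀ f → κν · V₀ f ≈ U (Φ · (κν · f))
κνV₀ f = solveWith (κν ∷ inv κν ∷ U (Φ · (κν · f)) ∷ []) (v0 :* (v1 :* v2)) v2 (hyp v2 (v0 :* v1) :one (inv-inverse κν κν-0) done) refl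

κνV₁ : ∀ f → κν · V₁ f ≈ U (κν · f)
κνV₁ f = solveWith (κν ∷ inv κν ∷ U (κν · f) ∷ []) (v0 :* (v1 :* v2)) v2 (hyp v2 (v0 :* v1) :one (inv-inverse κν κν-0) done) refl

qã : q · ã ≈ y₅ · â
qã = solveWith (q ∷ D η ∷ â ∷ y₅ ∷ []) (v0 :* (v0 :^ 4 :* (v1 :* v2))) (v3 :* v2) (hyp (:- v2) v3 (v0 :^ 5 :* v1) y₅-formula done) refl

-- Φ = b²/a⁵, and `relation-y`, in the form y ν₅ a³ = κ₅ b, gives b²/a⁵ = (ν₅/κ₅)² y² a.
relation-Φ : κ₅ ^S 2 · (Φ · y₅) ≈ ν₅ ^S 2 · (ã · y ^S 2)
relation-Φ = q-cancel (unit-cancel (â ^S 5) (^S-0 5 â-0) (solveWith (q ∷ â ∷ b̂ ∷ inv (â ^S 5) ∷ y ∷ y₅ ∷ κ₅ ∷ ν₅ ∷ ã ∷ [])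
  (v1 :^ 5 :* (v0 :* (v6 :^ 2 :* (v0 :* (v2 :^ 2 :* v3) :* v5)))) (v1 :^ 5 :* (v0 :* (v7 :^ 2 :* (v8 :* v4 :^ 2))))
  (hyp (v0 :^ 2 :* v6 :^ 2 :* v2 :^ 2 :* v5) (v1 :^ 5 :* v3) :one (inv-inverse (â ^S 5) (^S-0 5 â-0))
  (hyp (:- (v5 :* (v4 :* v7 :* v1 :^ 3 :+ v0 :* v6 :* v2))) (v4 :* (v7 :* v1 :^ 3)) (v0 :* (v6 :* v2)) relation-y
  (hyp (:- (v1 :^ 5 :* v7 :^ 2 :* v4 :^ 2)) (v0 :* v8) (v5 :* v1) qã done))) refl))

private
  y₅⁴ : y ^S 4 · τ ^S 4 ≈ y₅ ^S 4
  y₅⁴ = solveWith (τ ∷ y ∷ y₅ ∷ []) (v1 :^ 4 :* v0 :^ 4) (v2 :^ 4) (hyp ((v0 :* v1 :+ v2) :* ((v0 :* v1) :^ 2 :+ v2 :^ 2)) (v0 :* v1) v2 τy done) refl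

  -- Since τ y = y₅, the quotient y²/y₅ in Φ may be written as τ⁴ y⁶/y₅⁵, which brings `hA` into
  -- play.
  Φ-expanded : ∀ f → eval (v0 :^ 5 :* K :^ 2) (y₅ ∷ []) · (Φ · f) ≈ eval (N :^ 2) (y₅ ∷ []) · (hA · (y ^S 6 · f))
  Φ-expanded f = solveWith (y₅ ∷ κ₅ ∷ ν₅ ∷ Φ ∷ ã ∷ y ∷ τ ∷ f ∷ []) (v0 :^ 5 :* K :^ 2 :* (v3 :* v7)) (N :^ 2 :* (v4 :* v6 :^ 4 :* (v5 :^ 6 :* v7)))
    (hyp (v7 :* v0 :^ 4) (v1 :^ 2 :* (v3 :* v0)) (v2 :^ 2 :* (v4 :* v5 :^ 2)) relation-Φ
    (hyp (:- (v7 :* v0 :^ 5 :* v3 :* (v1 :+ K))) v1 K κ₅-formula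
    (hyp (v7 :* v0 :^ 4 :* v4 :* v5 :^ 2 :* (v2 :+ N)) v2 N ν₅-formula
    (hyp (:- (v7 :* N :^ 2 :* v4 :* v5 :^ 2)) (v5 :^ 4 :* v6 :^ 4) (v0 :^ 4) y₅⁴ done)))) refl

  U-Φ : ∀ f → eval (v0 :^ 5 :* K :^ 2) (y ∷ []) · U (Φ · f) ≈ eval (N :^ 2) (y ∷ []) · U (hA · (y ^S 6 · f))
  U-Φ f = ≈-trans (≈-sym (U-poly (v0 :^ 5 :* K :^ 2) (Φ · f))) (≈-trans (U-cong (Φ-expanded f)) (U-poly (N :^ 2) (hA · (y ^S 6 · f))))

-- The constants 9 and 20 come from κν = 1 + 9y + 20y². In `V₁-poly` the factor ν is absorbed in ã²,
-- so only κ = 1 + 5y is expanded.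
V₀-poly V₁-poly : ℕ → Poly 1
V₀-poly n = normal N *P (gp (6 + n) +P (conP (+ 9) *P gp (7 + n) +P conP (+ 20) *P gp (8 + n)))
V₁-poly n = hp (6 + n) +P conP (+ 5) *P hp (7 + n)

V₀-row : ∀ n → y ^S 5 · (κ ^S 7 · V₀ (y ^S n)) ≈ ⟦ V₀-poly n ⟧ (y ∷ [])
V₀-row n = unit-cancel ν ν-0 (begin
  ν · (y ^S 5 · (κ ^S 7 · V₀ (y ^S n)))
    ≈⟨ decide (y ∷ V₀ (y ^S n) ∷ []) (N :* (v0 :^ 5 :* (K :^ 7 :* v1))) (K :^ 4 :* (v0 :^ 5 :* K :^ 2 :* (K :* N :* v1))) refl ⟩
  κ ^S 4 · (eval (v0 :^ 5 :* K :^ 2) (y ∷ []) · (κν · V₀ (y ^S n)))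
    ≈⟨ ·-congˡ (≈-trans (·-congˡ (κνV₀ (y ^S n))) (≈-trans (U-Φ (κν · y ^S n)) (·-congˡ
         (≈-trans (U-cong split) (≈-trans (U-⊕ _ _) (⊕-cong ≈-refl (≈-trans (U-⊕ _ _) (⊕-cong (U-poly (# 9) _) (U-poly (# 20) _))))))))) ⟩
  κ ^S 4 · (ν ^S 2 · (G₆ ⊕ (constant (+ 9) · G₇ ⊕ constant (+ 20) · G₈)))
    ≈⟨ decide (y ∷ κ ^S 4 ∷ G₆ ∷ G₇ ∷ G₈ ∷ []) (v1 :* (N :^ 2 :* (v2 :+ (# 9 :* v3 :+ # 20 :* v4))))
         (N :* (N :* (v1 :* v2 :+ (# 9 :* (v1 :* v3) :+ # 20 :* (v1 :* v4))))) refl ⟩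
  ν · (ν · (κ ^S 4 · G₆ ⊕ (constant (+ 9) · (κ ^S 4 · G₇) ⊕ constant (+ 20) · (κ ^S 4 · G₈))))
    ≈⟨ ·-congˡ (·-cong (≈-sym (normal-sound N (y ∷ []))) (⊕-cong (gp-sound (6 + n)) (⊕-cong
         (·-cong (≈-sym (conP-sound (+ 9) (y ∷ []))) (gp-sound (7 + n))) (·-cong (≈-sym (conP-sound (+ 20) (y ∷ []))) (gp-sound (8 + n)))))) ⟩
  ν · (⟦ normal N ⟧ Y · (⟦ gp (6 + n) ⟧ Y ⊕ (⟦ conP (+ 9) ⟧ Y · ⟦ gp (7 + n) ⟧ Y ⊕ ⟦ conP (+ 20) ⟧ Y · ⟦ gp (8 + n) ⟧ Y)))
    ≈⟨ ·-congˡ (≈-sym (≈-trans (*P-sound (normal N) P Y) (·-congˡ (≈-trans (+P-sound (gp (6 + n)) _ Y) (⊕-cong ≈-refl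
         (≈-trans (+P-sound (conP (+ 9) *P gp (7 + n)) _ Y) (⊕-cong (*P-sound (conP (+ 9)) (gp (7 + n)) Y) (*P-sound (conP (+ 20)) (gp (8 + n)) Y)))))))) ⟩
  ν · ⟦ normal N *P P ⟧ Y ∎)
  where
  open ≈-Reasoning
  Y : Vec Series 1
  Y = y ∷ []
  P : Poly 1
  P = gp (6 + n) +P (conP (+ 9) *P gp (7 + n) +P conP (+ 20) *P gp (8 + n))
  G₆ G₇ G₈ : Series
  G₆ = U (hA · y ^S (6 + n))
  G₇ = U (hA · y ^S (7 + n))
  G₈ = U (hA · y ^S (8 + n))
  split : hA · (y ^S 6 · (κν · y ^S n)) ≈ hA · y ^S (6 + n) ⊕ (constant (+ 9) · (hA · y ^S (7 + n)) ⊕ constant (+ 20) · (hA · y ^S (8 + n)))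
  split = decide (y ∷ hA ∷ y ^S n ∷ []) (v1 :* (v0 :^ 6 :* (K :* N :* v2)))
    (v1 :* y⁶ :+ (# 9 :* (v1 :* (v0 :* y⁶)) :+ # 20 :* (v1 :* (v0 :* (v0 :* y⁶))))) refl
    where
    y⁶ : Expr 3
    y⁶ = v0 :* (v0 :* (v0 :* (v0 :* (v0 :* (v0 :* v2)))))

-- The first step starts from q A, where no factor κν is present yet, so Φ alone is put under U.
V₀-start : y ^S 5 · (κ ^S 7 · (inv κν · U Φ)) ≈ ⟦ normal N *P gp 6 ⟧ (y ∷ [])
V₀-start = unit-cancel ν ν-0 (begin
  ν · (y ^S 5 · (κ ^S 7 · (inv κν · U Φ)))
    ≈⟨ solveWith (y ∷ inv κν ∷ U Φ ∷ []) (N :* (v0 :^ 5 :* (K :^ 7 :* (v1 :* v2)))) (K :^ 4 :* (v0 :^ 5 :* K :^ 2 :* v2))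
         (hyp (v0 :^ 5 :* K :^ 6 :* v2) (K :* N :* v1) :one (inv-inverse κν κν-0) done) refl ⟩
  κ ^S 4 · (eval (v0 :^ 5 :* K :^ 2) (y ∷ []) · U Φ)
    ≈⟨ ·-congˡ (≈-trans (·-congˡ (U-cong (≈-sym (·-identityʳ Φ)))) (≈-trans (U-Φ one) (·-congˡ (U-cong (·-congˡ (·-identityʳ (y ^S 6))))))) ⟩
  κ ^S 4 · (ν ^S 2 · U (hA · y ^S 6))
    ≈⟨ decide (y ∷ κ ^S 4 ∷ U (hA · y ^S 6) ∷ []) (v1 :* (N :^ 2 :* v2)) (N :* (N :* (v1 :* v2))) refl ⟩
  ν · (ν · (κ ^S 4 · U (hA · y ^S 6)))
    ≈⟨ ·-congˡ (≈-sym (≈-trans (*P-sound (normal N) (gp 6) (y ∷ [])) (·-cong (normal-sound N (y ∷ [])) (≈-sym (gp-sound 6))))) ⟩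
  ν · ⟦ normal N *P gp 6 ⟧ (y ∷ []) ∎)
  where open ≈-Reasoning

V₁-row : ∀ n → y ^S 6 · (κ ^S 7 · V₁ (y ^S n)) ≈ ⟦ V₁-poly n ⟧ (y ∷ [])
V₁-row n = unit-cancel ν ν-0 (begin
  ν · (y ^S 6 · (κ ^S 7 · V₁ (y ^S n)))
    ≈⟨ decide (y ∷ V₁ (y ^S n) ∷ []) (N :* (v0 :^ 6 :* (K :^ 7 :* v1))) (K :^ 4 :* (v0 :^ 6 :* K :^ 2 :* (K :* N :* v1))) refl ⟩
  κ ^S 4 · (eval (v0 :^ 6 :* K :^ 2) (y ∷ []) · (κν · V₁ (y ^S n)))
    ≈⟨ ·-congˡ (≈-trans (·-congˡ (κνV₁ (y ^S n))) (≈-trans (≈-sym (U-poly (v0 :^ 6 :* K :^ 2) (κν · y ^S n)))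
         (≈-trans (U-cong split) (≈-trans (U-poly N _) (·-congˡ (≈-trans (U-⊕ _ _) (⊕-cong ≈-refl (U-poly (# 5) _)))))))) ⟩
  κ ^S 4 · (ν · (H₆ ⊕ constant (+ 5) · H₇))
    ≈⟨ decide (y ∷ κ ^S 4 ∷ H₆ ∷ H₇ ∷ []) (v1 :* (N :* (v2 :+ # 5 :* v3))) (N :* (v1 :* v2 :+ # 5 :* (v1 :* v3))) refl ⟩
  ν · (κ ^S 4 · H₆ ⊕ constant (+ 5) · (κ ^S 4 · H₇))
    ≈⟨ ·-congˡ (≈-sym (≈-trans (+P-sound (hp (6 + n)) _ (y ∷ [])) (⊕-cong (≈-sym (hp-sound (6 + n)))
         (≈-trans (*P-sound (conP (+ 5)) (hp (7 + n)) (y ∷ [])) (·-cong (conP-sound (+ 5) (y ∷ [])) (≈-sym (hp-sound (7 + n)))))))) ⟩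
  ν · ⟦ hp (6 + n) +P conP (+ 5) *P hp (7 + n) ⟧ (y ∷ []) ∎)
  where
  open ≈-Reasoning
  H₆ H₇ : Series
  H₆ = U (hB · y ^S (6 + n))
  H₇ = U (hB · y ^S (7 + n))
  y₅⁶ : y₅ ^S 6 ≈ (τ · y) ^S 6
  y₅⁶ = ^S-cong 6 (≈-sym τy)
  -- The relation `ã²` gives ν = ν₅ ã²/(κ₅² τ²), and τ⁻² = τ⁴ y⁶/y₅⁶.
  split : eval (v0 :^ 6 :* K :^ 2) (y₅ ∷ []) · (κν · y ^S n) ≈ eval N (y₅ ∷ []) · (hB · y ^S (6 + n) ⊕ constant (+ 5) · (hB · y ^S (7 + n)))
  split = solveWith (y₅ ∷ y ∷ y ^S n ∷ ã ∷ τ ∷ κ₅ ∷ ν₅ ∷ [])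
    (v0 :^ 6 :* K :^ 2 :* ((:one :+ # 5 :* v1) :* N₁ :* v2))
    (N :* (v3 :^ 2 :* v4 :^ 4 :* y⁶ :+ # 5 :* (v3 :^ 2 :* v4 :^ 4 :* (v1 :* y⁶))))
    (hyp (K :^ 2 :* ((:one :+ # 5 :* v1) :* N₁ :* v2)) (v0 :^ 6) ((v4 :* v1) :^ 6) y₅⁶
    (hyp (:- ((:one :+ # 5 :* v1) :* v2 :* v4 :^ 4 :* v1 :^ 6)) (v3 :^ 2 :* v6) (v5 :^ 2 :* (N₁ :* v4 :^ 2)) ã²
    (hyp (:- ((:one :+ # 5 :* v1) :* v2 :* v4 :^ 6 :* v1 :^ 6 :* N₁ :* (v5 :+ K))) v5 K κ₅-formula
    (hyp ((:one :+ # 5 :* v1) :* v2 :* v4 :^ 4 :* v1 :^ 6 :* v3 :^ 2) v6 N ν₅-formula done)))) refl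
    where
    N₁ y⁶ : Expr 7
    N₁ = :one :+ # 4 :* v1
    y⁶ = v1 :* (v1 :* (v1 :* (v1 :* (v1 :* (v1 :* v2)))))

-- Divisibility by powers of 5 and the lattice

record Div (a : ℕ) (z : ℤ) : Set where
  constructor div
  field by : + (5 ^ a) Signed.∣ z
open Div public

Div-zero : ∀ a → Div a 0ℤ
Div-zero a = div (divides 0ℤ refl)

Div-any : ∀ z → Div 0 z
Div-any z = div (divides z (sym (ℤₚ.*-identityʳ z)))

Div-+ : ∀ {a x z} → Div a x → Div a z → Div a (x +ℤ z)
Div-+ (div p) (div r) = div (∣m∣n⇒∣m+n p r)

Div-*ˡ : ∀ {a z} x → Div a z → Div a (x *ℤ z)
Div-*ˡ x (div p) = div (∣n⇒∣m*n x p)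

Div-* : ∀ {a b x z} → Div a x → Div b z → Div (a + b) (x *ℤ z)
Div-* {a} {b} (div (divides s refl)) (div (divides t refl)) = div (divides (s *ℤ t)
  (trans (lemma s (+ (5 ^ a)) t (+ (5 ^ b))) (cong (s *ℤ t *ℤ_) (sym (trans (cong +_ (ℕₚ.^-distribˡ-+-* 5 a b)) (ℤₚ.pos-* (5 ^ a) (5 ^ b)))))))
  where
  lemma : ∀ s x t z → s *ℤ x *ℤ (t *ℤ z) ≡ s *ℤ t *ℤ (x *ℤ z)
  lemma = solve-∀

Div-weaken : ∀ {a b z} → b ≤ a → Div a z → Div b z
Div-weaken {a} {b} b≤a (div p) = div (∣-trans (divides (+ (5 ^ (a ∸ b)))
  (trans (cong +_ (trans (cong (5 ^_) (sym (ℕₚ.m∸n+n≡m b≤a))) (ℕₚ.^-distribˡ-+-* 5 (a ∸ b) b))) (ℤₚ.pos-* (5 ^ (a ∸ b)) (5 ^ b)))) p)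

-- Series Σ_{m ≥ 0} c_m y^{m+1} with 5^{e m} ∣ c_m, described by their truncations

psum : (ℕ → ℤ) → ℕ → Series
psum c zero    = 0S
psum c (suc N) = psum c N ⊕ constant (c N) · y ^S N

-- The coefficients c may depend on the precision M, so no limit of coefficient sequences has to be
-- formed.
record Mem (e : ℕ → ℕ) (f : Series) : Set where
  constructor mem
  field approximations : ∀ M → Σ (ℕ → ℤ) λ c → (∀ m → Div (e m) (c m)) × f ≋[ M ] y · psum c M
open Mem public

≋-refl : ∀ {M f} → f ≋[ M ] f
≋-refl = ≈⇒≋ ≈-refl

y^-small : ∀ M f → f · y ^S M ≋[ M ] 0S
y^-small M f = ≋-trans (≈⇒≋ (shape M)) (mono-small M (f · η ^S M))
  where
  y^ : ∀ M → y ^S M ≈ mono M · η ^S M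
  y^ zero    = ≈-sym (≈-trans (·-congʳ mono-0) (·-identityˡ one))
  y^ (suc M) = ≈-trans (·-congˡ (y^ M)) (≈-trans
    (decide (q ∷ η ∷ mono M ∷ η ^S M ∷ []) (v0 :* v1 :* (v2 :* v3)) (v0 :* v2 :* (v1 :* v3)) refl) (·-congʳ (≈-sym (mono-suc M))))
  shape : ∀ M → f · y ^S M ≈ mono M · (f · η ^S M)
  shape M = ≈-trans (·-congˡ (y^ M)) (decide (f ∷ mono M ∷ η ^S M ∷ []) (v0 :* (v1 :* v2)) (v1 :* (v0 :* v2)) refl)

psum-⊕ : ∀ c c' M → psum (λ m → c m +ℤ c' m) M ≈ psum c M ⊕ psum c' M
psum-⊕ c c' zero    = ≈-sym (⊕-identityˡ 0S)
psum-⊕ c c' (suc M) = ≈-trans (⊕-cong (psum-⊕ c c' M) (·-congʳ (constant-+ (c M) (c' M))))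
  (decide (psum c M ∷ psum c' M ∷ constant (c M) ∷ constant (c' M) ∷ y ^S M ∷ [])
    (v0 :+ v1 :+ (v2 :+ v3) :* v4) (v0 :+ v2 :* v4 :+ (v1 :+ v3 :* v4)) refl)

psum-constant : ∀ z c M → psum (λ m → z *ℤ c m) M ≈ constant z · psum c M
psum-constant z c zero    = ≈-sym (·-zeroʳ (constant z))
psum-constant z c (suc M) = ≈-trans (⊕-cong (psum-constant z c M) (·-congʳ (constant-* z (c M))))
  (decide (constant z ∷ psum c M ∷ constant (c M) ∷ y ^S M ∷ []) (v0 :* v1 :+ v0 :* v2 :* v3) (v0 :* (v1 :+ v2 :* v3)) refl)

shiftUp : (ℕ → ℤ) → ℕ → ℤ
shiftUp c zero    = 0ℤ
shiftUp c (suc m) = c m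

psum-shiftUp : ∀ c M → psum (shiftUp c) (suc M) ≈ y · psum c M
psum-shiftUp c zero    = ≈-trans (⊕-cong ≈-refl (≈-trans (·-congʳ constant-0) (·-zeroˡ one))) (≈-trans (⊕-identityˡ 0S) (≈-sym (·-zeroʳ y)))
psum-shiftUp c (suc M) = ≈-trans (⊕-cong (psum-shiftUp c M) ≈-refl)
  (decide (y ∷ psum c M ∷ constant (c M) ∷ y ^S M ∷ []) (v0 :* v1 :+ v2 :* (v0 :* v3)) (v0 :* (v1 :+ v2 :* v3)) refl)

psum-last : ∀ c M → psum c (suc M) ≋[ M ] psum c M
psum-last c M = ≋-trans (≋-⊕ ≋-refl (y^-small M (constant (c M)))) (≈⇒≋ (⊕-identityʳ (psum c M)))

Mem-cong : ∀ {e f g} → f ≈ g → Mem e f → Mem e g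
Mem-cong h (mem a) = mem λ M → let (c , d , r) = a M in c , d , ≋-trans (≈⇒≋ (≈-sym h)) r

Mem-0S : ∀ {e} → Mem e 0S
Mem-0S {e} = mem λ M → (λ _ → 0ℤ) , (λ m → Div-zero (e m)) , ≈⇒≋ (≈-sym (≈-trans (·-congˡ (zeros M)) (·-zeroʳ y)))
  where
  zeros : ∀ M → psum (λ _ → 0ℤ) M ≈ 0S
  zeros zero    = ≈-refl
  zeros (suc M) = ≈-trans (⊕-cong (zeros M) (≈-trans (·-congʳ constant-0) (·-zeroˡ (y ^S M)))) (⊕-identityˡ 0S)

Mem-⊕ : ∀ {e f g} → Mem e f → Mem e g → Mem e (f ⊕ g)
Mem-⊕ (mem a) (mem b) = mem λ M → let (c , d , r) = a M ; (c' , d' , r') = b M in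
  (λ m → c m +ℤ c' m) , (λ m → Div-+ (d m) (d' m)) ,
  ≋-trans (≋-⊕ r r') (≈⇒≋ (≈-trans (≈-sym (·-distribˡ y (psum c M) (psum c' M))) (·-congˡ (≈-sym (psum-⊕ c c' M)))))

Mem-constant : ∀ {e e' f} z a → Div a z → (∀ m → e' m ≤ a + e m) → Mem e f → Mem e' (constant z · f)
Mem-constant z a az le (mem b) = mem λ M → let (c , d , r) = b M in
  (λ m → z *ℤ c m) , (λ m → Div-weaken (le m) (Div-* az (d m))) ,
  ≋-trans (≋-· ≋-refl r) (≈⇒≋ (≈-trans (decide (constant z ∷ y ∷ psum c M ∷ []) (v0 :* (v1 :* v2)) (v1 :* (v0 :* v2)) refl)
    (·-congˡ (≈-sym (psum-constant z c M)))))

Mem-y : ∀ {e f} → Mem (e ∘ suc) f → Mem e (y · f)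
Mem-y {e} (mem b) = mem λ M → let (c , d , r) = b M in
  shiftUp c , (λ { zero → Div-zero (e 0) ; (suc m) → d m }) ,
  ≋-trans (≋-· ≋-refl r) (≋-· ≋-refl (≋-trans (≈⇒≋ (≈-sym (psum-shiftUp c M))) (psum-last (shiftUp c) M)))

Mem-limit : ∀ {e f} → (∀ M → Σ Series λ g → Mem e g × f ≋[ M ] g) → Mem e f
Mem-limit h = mem λ M → let (g , mem a , r) = h M ; (c , d , r') = a M in c , d , ≋-trans r r'

Mem-base : ∀ {e} z → Div (e 0) z → Mem e (y · constant z)
Mem-base {e} z d = mem λ M → c , (λ { zero → d ; (suc m) → Div-zero (e (suc m)) }) , head M
  where
  c : ℕ → ℤ
  c zero    = z
  c (suc _) = 0ℤ
  first : ∀ M → psum c (suc M) ≈ constant z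
  first zero    = ≈-trans (⊕-identityˡ _) (·-identityʳ (constant z))
  first (suc M) = ≈-trans (⊕-cong (first M) (≈-trans (·-congʳ constant-0) (·-zeroˡ _))) (⊕-identityʳ _)
  head : ∀ M → y · constant z ≋[ M ] y · psum c M
  head zero    = upTo λ _ ()
  head (suc M) = ≈⇒≋ (·-congˡ (≈-sym (first M)))

-- Multiplication by 5y preserves the lattice, so division by κ = 1 + 5y does too.
Mem-κ : ∀ {e f g} → (∀ m → e (suc m) ≤ suc (e m)) → κ · f ≈ g → Mem e g → Mem e f
Mem-κ {e} {f} {g} le h Mg = Mem-limit λ M → approx M , approx-Mem M , close M
  where
  approx : ℕ → Series
  approx zero    = 0S
  approx (suc M) = g ⊕ constant (- (+ 5)) · (y · approx M)
  approx-Mem : ∀ M → Mem e (approx M)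
  approx-Mem zero    = Mem-0S
  approx-Mem (suc M) = Mem-⊕ Mg (Mem-cong (decide (y ∷ approx M ∷ []) (v0 :* (con (- (+ 5)) :* v1)) (con (- (+ 5)) :* (v0 :* v1)) refl)
    (Mem-y (Mem-constant (- (+ 5)) 1 (div (divides (- (+ 1)) refl)) le (approx-Mem M))))
  step : f ≈ g ⊕ constant (- (+ 5)) · (y · f)
  step = solveWith (y ∷ f ∷ g ∷ []) v1 (v2 :+ con (- (+ 5)) :* (v0 :* v1)) (hyp :one ((:one :+ # 5 :* v0) :* v1) v2 h done) refl
  -- As y has no constant term, every round of the iteration f = g - 5 y f makes one more
  -- coefficient correct.
  gain : ∀ {M f g} → f ≋[ M ] g → y · f ≋[ suc M ] y · g
  gain {M} {f} {g} r = ≋-trans (≈⇒≋ (·-assoc q η f)) (≋-trans (upTo shifted) (≈⇒≋ (≈-sym (·-assoc q η g))))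
    where
    shifted : ∀ n → n < suc M → (q · (η · f)) n ≡ (q · (η · g)) n
    shifted zero    _         = trans (q·-zero _) (sym (q·-zero _))
    shifted (suc n) (s≤s n<M) = trans (q·-suc _ n) (trans (below (≋-· (≋-refl {M} {η}) r) n n<M) (sym (q·-suc _ n)))
  close : ∀ M → f ≋[ M ] approx M
  close zero    = upTo λ _ ()
  close (suc M) = ≋-trans (≈⇒≋ step) (≋-⊕ ≋-refl (≋-· ≋-refl (gain (close M))))

Mem-κ^ : ∀ n {e f g} → (∀ m → e (suc m) ≤ suc (e m)) → κ ^S n · f ≈ g → Mem e g → Mem e f
Mem-κ^ zero    le h Mg = Mem-cong (≈-trans (≈-sym h) (·-identityˡ _)) Mg
Mem-κ^ (suc n) {f = f} le h Mg = Mem-κ^ n le ≈-refl (Mem-κ le (≈-trans (≈-sym (·-assoc κ (κ ^S n) f)) h) Mg)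

allDiv : (ℕ → ℕ) → List ℤ → Bool
allDiv e []       = true
allDiv e (z ∷ zs) = (_%_ ∣ z ∣ (5 ^ e 0) {{ℕₚ.m^n≢0 5 (e 0)}} ≡ᵇ 0) ∧ allDiv (e ∘ suc) zs

Div-check : ∀ a z → (_%_ ∣ z ∣ (5 ^ a) {{ℕₚ.m^n≢0 5 a}} ≡ᵇ 0) ≡ true → Div a z
Div-check a z h = div (∣ᵤ⇒∣ (ℕₚ.m%n≡0⇒n∣m ∣ z ∣ (5 ^ a) {{ℕₚ.m^n≢0 5 a}} (ℕₚ.≡ᵇ⇒≡ _ 0 (subst T (sym h) tt))))

Mem-poly : ∀ e (p : Poly 1) → allDiv e p ≡ true → Mem e (y · ⟦ p ⟧ (y ∷ []))
Mem-poly e []       h = Mem-cong (≈-sym (·-zeroʳ y)) Mem-0S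
Mem-poly e (z ∷ zs) h with ∧-split h
... | hz , hzs = Mem-cong (≈-sym (·-distribˡ y (constant z) (y · ⟦ zs ⟧ (y ∷ []))))
  (Mem-⊕ (Mem-base z (Div-check (e 0) z hz)) (Mem-y (Mem-poly (e ∘ suc) zs hzs)))

Mem-poly· : ∀ {e e' g} (v : ℕ → ℕ) (p : Poly 1) → allDiv v p ≡ true → (∀ l m → e' (l + m) ≤ v l + e m) →
  Mem e g → Mem e' (⟦ p ⟧ (y ∷ []) · g)
Mem-poly· {g = g} v [] h le Mg = Mem-cong (≈-sym (·-zeroˡ g)) Mem-0S
Mem-poly· {e} {e'} {g} v (z ∷ zs) h le Mg with ∧-split h
... | hz , hzs = Mem-cong (decide (constant z ∷ y ∷ ⟦ zs ⟧ (y ∷ []) ∷ g ∷ []) (v0 :* v3 :+ v1 :* (v2 :* v3)) ((v0 :+ v1 :* v2) :* v3) refl)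
  (Mem-⊕ (Mem-constant z (v 0) (Div-check (v 0) z hz) (le 0) Mg)
    (Mem-y (Mem-poly· {e' = e' ∘ suc} (v ∘ suc) zs hzs (λ l m → le (suc l) m) Mg)))

dropP : ℕ → Poly 1 → Poly 1
dropP zero    p        = p
dropP (suc n) []       = []
dropP (suc n) (_ ∷ ps) = dropP n ps

takeZero : ℕ → Poly 1 → Bool
takeZero zero    p        = true
takeZero (suc n) []       = true
takeZero (suc n) (z ∷ zs) = isZero {0} z ∧ takeZero n zs

dropP-sound : ∀ n p → takeZero n p ≡ true → ⟦ p ⟧ (y ∷ []) ≈ y ^S n · ⟦ dropP n p ⟧ (y ∷ [])
dropP-sound zero    p        h = ≈-sym (·-identityˡ _)
dropP-sound (suc n) []       h = ≈-sym (·-zeroʳ _)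
dropP-sound (suc n) (z ∷ zs) h with ∧-split h
... | hz , hzs = ≈-trans (⊕-cong (isZero-sound {0} z [] hz) (·-congˡ (dropP-sound n zs hzs)))
  (≈-trans (⊕-identityˡ _) (≈-sym (·-assoc y (y ^S n) _)))

^-y-cancel : ∀ n {f g} → y ^S n · f ≈ y ^S n · g → f ≈ g
^-y-cancel zero    h = ≈-trans (≈-sym (·-identityˡ _)) (≈-trans h (·-identityˡ _))
^-y-cancel (suc n) h = ^-y-cancel n (y-cancel (≈-trans (≈-sym (·-assoc y (y ^S n) _)) (≈-trans h (·-assoc y (y ^S n) _))))

-- The first n vanishing coefficients cancel yⁿ, the next one supplies the factor y common to the
-- lattice, and dividing by κ⁷ is harmless. What remains is a computation with the coefficients of
-- P.
Mem-row : ∀ n e (P : Poly 1) {f} → (∀ m → e (suc m) ≤ suc (e m)) → y ^S n · (κ ^S 7 · f) ≈ ⟦ P ⟧ (y ∷ []) →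
  takeZero (suc n) P ≡ true → allDiv e (dropP (suc n) P) ≡ true → Mem e f
Mem-row n e P {f} le h z d = Mem-κ^ 7 le (^-y-cancel n (≈-trans h (≈-trans (dropP-sound (suc n) P z)
  (≈-trans (·-congʳ (·-comm y (y ^S n))) (·-assoc (y ^S n) y _))))) (Mem-poly e (dropP (suc n) P) d)

-- Operators on the lattice and their rows

record Operator (T : Series → Series) : Set where
  field
    op-⊕  : ∀ f g → T (f ⊕ g) ≈ T f ⊕ T g
    op-c  : ∀ z f → T (constant z · f) ≈ constant z · T f
    op-≋  : ∀ {f g} M → f ≋[ M * 5 ] g → T f ≋[ M ] T g
open Operator public

tsum : (Series → Series) → (ℕ → ℤ) → ℕ → Series
tsum T c zero    = 0S
tsum T c (suc M) = tsum T c M ⊕ constant (c M) · T (y · y ^S M)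

op-cong : ∀ {T} → Operator T → ∀ {f g} → f ≈ g → T f ≈ T g
op-cong o h = ≋⇒≈ λ M → op-≋ o M (≈⇒≋ h)

op-0 : ∀ {T} → Operator T → T 0S ≈ 0S
op-0 {T} o = ≈-trans (op-cong o (≈-sym (·-zeroˡ one))) (≈-trans (op-cong o (·-congʳ (≈-sym constant-0)))
  (≈-trans (op-c o 0ℤ one) (≈-trans (·-congʳ constant-0) (·-zeroˡ (T one)))))

op-psum : ∀ {T} → Operator T → ∀ c M → T (y · psum c M) ≈ tsum T c M
op-psum o c zero    = ≈-trans (op-cong o (·-zeroʳ y)) (op-0 o)
op-psum {T} o c (suc M) = ≈-trans (op-cong o (decide (y ∷ psum c M ∷ constant (c M) ∷ y ^S M ∷ []) (v0 :* (v1 :+ v2 :* v3)) (v0 :* v1 :+ v2 :* (v0 :* v3)) refl))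
  (≈-trans (op-⊕ o _ _) (⊕-cong (op-psum o c M) (op-c o (c M) _)))

-- `e n` bounds the valuation of the coefficient of y^(n+1) in f, and `r n j` that of y^(j+1) in the
-- image of y^(n+1). Precision 5M is requested from f because U reads every fifth coefficient.
Mem-operator : ∀ {T e e'} (r : ℕ → ℕ → ℕ) → Operator T → (∀ n → Mem (r n) (T (y · y ^S n))) →
  (∀ n j → e' j ≤ e n + r n j) → ∀ {f} → Mem e f → Mem e' (T f)
Mem-operator {T} {e} {e'} r o rows le (mem a) = Mem-limit λ M → let (c , d , h) = a (M * 5) in
  tsum T c (M * 5) , finite c d (M * 5) , ≋-trans (op-≋ o M h) (≈⇒≋ (op-psum o c (M * 5)))
  where
  finite : ∀ c → (∀ m → Div (e m) (c m)) → ∀ M → Mem e' (tsum T c M)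
  finite c d zero    = Mem-0S
  finite c d (suc M) = Mem-⊕ (finite c d M) (Mem-constant (c M) (e M) (d M) (le M) (rows M))

operator-from : ∀ {T : Series → Series} g → (∀ f → T f ≈ inv κν · U (g · f)) → Operator T
operator-from {T} g h = record
  { op-⊕ = λ f f' → ≈-trans (h (f ⊕ f')) (≈-trans (·-congˡ (≈-trans (U-cong (·-distribˡ g f f')) (U-⊕ _ _)))
      (≈-trans (·-distribˡ (inv κν) _ _) (⊕-cong (≈-sym (h f)) (≈-sym (h f')))))
  ; op-c = λ z f → ≈-trans (h (constant z · f)) (≈-trans (·-congˡ (≈-trans (U-cong (decide (g ∷ constant z ∷ f ∷ []) (v0 :* (v1 :* v2)) (v1 :* (v0 :* v2)) refl))
      (U-poly (con z) (g · f)))) (≈-trans (decide (inv κν ∷ constant z ∷ U (g · f) ∷ []) (v0 :* (v1 :* v2)) (v1 :* (v0 :* v2)) refl) (·-congˡ (≈-sym (h f)))))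
  ; op-≋ = λ {f} {f'} M r → ≋-trans (≈⇒≋ (h f)) (≋-trans (≋-· ≋-refl (comp-≋ 0 0<5 (≋-· ≋-refl r))) (≈⇒≋ (≈-sym (h f')))) }

V₀-operator : Operator V₀
V₀-operator = operator-from (Φ · κν) (λ f → ·-congˡ (U-cong (≈-sym (·-assoc Φ κν f))))

V₁-operator : Operator V₁
V₁-operator = operator-from κν (λ f → ≈-refl)

⌊+/2⌋ : ∀ a b → ⌊ a + b /2⌋ ≤ ⌊ a /2⌋ + ⌈ b /2⌉
⌊+/2⌋ zero          b = ℕₚ.⌊n/2⌋≤⌈n/2⌉ b
⌊+/2⌋ (suc zero)    b = ℕₚ.≤-refl
⌊+/2⌋ (suc (suc a)) b = s≤s (⌊+/2⌋ a b)

-- The bound proved for the 5-adic valuation of the coefficient of y^{j+1} in V₀ (y^{n+1}) for c = 1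
-- and in V₁ (y^{n+1}) for c = 3.
rowBound : ℕ → ℕ → ℕ → ℕ
rowBound c n j = ⌊ (j + c) ∸ n /2⌋

rowBound-step : ∀ c n m → rowBound c n (suc m) ≤ suc (rowBound c n m)
rowBound-step c n m = ℕₚ.≤-trans (ℕₚ.⌊n/2⌋-mono (ℕₚ.≤-trans (suc-∸ (m + c) n) (ℕₚ.≤-reflexive (ℕₚ.+-comm 1 _)))) (ℕₚ.≤-trans (⌊+/2⌋ ((m + c) ∸ n) 1) (ℕₚ.≤-reflexive (ℕₚ.+-comm _ 1)))
  where
  suc-∸ : ∀ a n → suc a ∸ n ≤ suc (a ∸ n)
  suc-∸ a       zero    = ℕₚ.≤-refl
  suc-∸ zero    (suc n) = ℕₚ.≤-trans (ℕₚ.m∸n≤m 0 n) z≤n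
  suc-∸ (suc a) (suc n) = suc-∸ a n

-- (l + m + c) - (j + n) is at most ((m + c) - n) + (l - j), also with truncated subtraction;
-- halving a sum costs at most rounding one part up.
rowBound-recurrence : ∀ c j n l m → rowBound c (j + n) (l + m) ≤ ⌈ l ∸ j /2⌉ + rowBound c n m
rowBound-recurrence c j n l m = ℕₚ.≤-trans (ℕₚ.⌊n/2⌋-mono bound')
  (ℕₚ.≤-trans (⌊+/2⌋ ((m + c) ∸ n) (l ∸ j)) (ℕₚ.≤-reflexive (ℕₚ.+-comm ⌊ (m + c) ∸ n /2⌋ _)))
  where
  bound' : (l + m + c) ∸ (j + n) ≤ ((m + c) ∸ n) + (l ∸ j)
  bound' = ℕₚ.m≤n+o⇒m∸n≤o (l + m + c) (j + n) (ℕₚ.≤-trans (ℕₚ.≤-reflexive (ℕₚ.+-assoc l m c))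
    (ℕₚ.≤-trans (ℕₚ.+-mono-≤ (ℕₚ.m≤n+m∸n l j) (ℕₚ.m≤n+m∸n (m + c) n)) (ℕₚ.≤-reflexive (rearrange j (l ∸ j) n ((m + c) ∸ n)))))
    where
    rearrange : ∀ j a n b → j + a + (n + b) ≡ j + n + (b + a)
    rearrange = ℕSolver.solve-∀

-- In the recurrence row n + 5 receives row n + 5 - j with factor c₍₅₋ⱼ₎, whose coefficient of yˡ
-- has valuation at least ⌈(l - j)/2⌉. This is what `rowBound-recurrence` allows for; the
-- divisibilities are checked by `refl`.
rows-from-five : ∀ {T : Series → Series} g c → (∀ f → T f ≈ inv κν · U (g · f)) →
  Mem (rowBound c 0) (T (y · y ^S 0)) → Mem (rowBound c 1) (T (y · y ^S 1)) → Mem (rowBound c 2) (T (y · y ^S 2)) →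
  Mem (rowBound c 3) (T (y · y ^S 3)) → Mem (rowBound c 4) (T (y · y ^S 4)) → ∀ n → Mem (rowBound c n) (T (y · y ^S n))
rows-from-five {T} g c h m₀ m₁ m₂ m₃ m₄ = λ n → proj₁ (go n)
  where
  Row : ℕ → Set
  Row n = Mem (rowBound c n) (T (y · y ^S n))
  recurrence : ∀ n → T (y · y ^S (5 + n)) ≈ eval c₀ (y ∷ []) · T (y · y ^S n) ⊕ (eval c₁ (y ∷ []) · T (y · y ^S (1 + n))
    ⊕ (eval c₂ (y ∷ []) · T (y · y ^S (2 + n)) ⊕ (eval c₃ (y ∷ []) · T (y · y ^S (3 + n)) ⊕ eval c₄ (y ∷ []) · T (y · y ^S (4 + n)))))
  recurrence n = ≈-trans (h _) (≈-trans (·-congˡ (≈-trans (U-cong (≈-sym (·-assoc g y _))) (≈-trans (quintic-recurrence (g · y) n)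
      (⊕-cong (·-congˡ (back n)) (⊕-cong (·-congˡ (back (1 + n))) (⊕-cong (·-congˡ (back (2 + n))) (⊕-cong (·-congˡ (back (3 + n))) (·-congˡ (back (4 + n))))))))))
    (≈-trans (decide (inv κν ∷ eval c₀ (y ∷ []) ∷ eval c₁ (y ∷ []) ∷ eval c₂ (y ∷ []) ∷ eval c₃ (y ∷ []) ∷ eval c₄ (y ∷ [])
        ∷ Un n ∷ Un (1 + n) ∷ Un (2 + n) ∷ Un (3 + n) ∷ Un (4 + n) ∷ [])
      (v0 :* (v1 :* v6 :+ (v2 :* v7 :+ (v3 :* v8 :+ (v4 :* v9 :+ v5 :* v10)))))
      (v1 :* (v0 :* v6) :+ (v2 :* (v0 :* v7) :+ (v3 :* (v0 :* v8) :+ (v4 :* (v0 :* v9) :+ v5 :* (v0 :* v10))))) refl)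
    (≈-sym (⊕-cong (·-congˡ (h _)) (⊕-cong (·-congˡ (h _)) (⊕-cong (·-congˡ (h _)) (⊕-cong (·-congˡ (h _)) (·-congˡ (h _)))))))))
    where
    Un : ℕ → Series
    Un n = U (g · (y · y ^S n))
    back : ∀ n → U (g · y · y ^S n) ≈ Un n
    back n = U-cong (·-assoc g y (y ^S n))
  term : ∀ (e : Expr 1) j n {i} → allDiv (λ l → ⌈ l ∸ j /2⌉) (normal e) ≡ true → i ≡ j + n → Row n → Mem (rowBound c i) (eval e (y ∷ []) · T (y · y ^S n))
  term e j n d refl r = Mem-cong (·-congʳ (normal-sound e (y ∷ []))) (Mem-poly· (λ l → ⌈ l ∸ j /2⌉) (normal e) d (rowBound-recurrence c j n) r)
  step : ∀ n → Row n → Row (1 + n) → Row (2 + n) → Row (3 + n) → Row (4 + n) → Row (5 + n)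
  step n a₀ a₁ a₂ a₃ a₄ = Mem-cong (≈-sym (recurrence n)) (Mem-⊕ (term c₀ 5 n refl refl a₀) (Mem-⊕ (term c₁ 4 (1 + n) refl refl a₁)
    (Mem-⊕ (term c₂ 3 (2 + n) refl refl a₂) (Mem-⊕ (term c₃ 2 (3 + n) refl refl a₃) (term c₄ 1 (4 + n) refl refl a₄)))))
  go : ∀ n → Row n × Row (1 + n) × Row (2 + n) × Row (3 + n) × Row (4 + n)
  go zero    = m₀ , m₁ , m₂ , m₃ , m₄
  go (suc n) = let (a₀ , a₁ , a₂ , a₃ , a₄) = go n in a₁ , a₂ , a₃ , a₄ , step n a₀ a₁ a₂ a₃ a₄

V₀-rows : ∀ n → Mem (rowBound 1 n) (V₀ (y · y ^S n))
V₀-rows = rows-from-five (Φ · κν) 1 (λ f → ·-congˡ (U-cong (≈-sym (·-assoc Φ κν f)))) (row 0 refl refl) (row 1 refl refl) (row 2 refl refl) (row 3 refl refl) (row 4 refl refl)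
  where
  row : ∀ n → takeZero 6 (V₀-poly (suc n)) ≡ true → allDiv (rowBound 1 n) (dropP 6 (V₀-poly (suc n))) ≡ true →
    Mem (rowBound 1 n) (V₀ (y · y ^S n))
  row n = Mem-row 5 (rowBound 1 n) (V₀-poly (suc n)) (rowBound-step 1 n) (V₀-row (suc n))

V₁-rows : ∀ n → Mem (rowBound 3 n) (V₁ (y · y ^S n))
V₁-rows = rows-from-five κν 3 (λ f → ≈-refl) (row 0 refl refl) (row 1 refl refl) (row 2 refl refl) (row 3 refl refl) (row 4 refl refl)
  where
  row : ∀ n → takeZero 7 (V₁-poly (suc n)) ≡ true → allDiv (rowBound 3 n) (dropP 7 (V₁-poly (suc n))) ≡ true →
    Mem (rowBound 3 n) (V₁ (y · y ^S n))
  row n = Mem-row 6 (rowBound 3 n) (V₁-poly (suc n)) (rowBound-step 3 n) (V₁-row (suc n))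

L₁ : Series
L₁ = inv κν · U Φ

L₁-Mem : Mem ⌊_/2⌋ L₁
L₁-Mem = Mem-row 5 ⌊_/2⌋ (normal N *P gp 6) half-step V₀-start refl refl
  where
  half-step : ∀ m → ⌊ suc m /2⌋ ≤ suc ⌊ m /2⌋
  half-step zero          = z≤n
  half-step (suc zero)    = s≤s z≤n
  half-step (suc (suc m)) = s≤s (half-step m)

-- ⌊j/2⌋ ≤ ⌊n/2⌋ + ⌊(j + 1 - n)/2⌋, so `V₀` loses nothing. With 3 instead of 1 the right side grows
-- by one in `V₁-bound`, and that is the factor 5 gained at each round.
V₀-bound : ∀ α n j → α + ⌊ j /2⌋ ≤ α + ⌊ n /2⌋ + rowBound 1 n j
V₀-bound α n j = ℕₚ.≤-trans (ℕₚ.+-monoʳ-≤ α (subst (λ x → ⌊ j /2⌋ ≤ ⌊ n /2⌋ + ⌊ x ∸ n /2⌋) (ℕₚ.+-comm 1 j) (go n j))) (ℕₚ.≤-reflexive (sym (ℕₚ.+-assoc α _ _)))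
  where
  go : ∀ n j → ⌊ j /2⌋ ≤ ⌊ n /2⌋ + ⌊ suc j ∸ n /2⌋
  go zero          j             = ℕₚ.⌊n/2⌋-mono (ℕₚ.n≤1+n j)
  go (suc zero)    j             = ℕₚ.≤-refl
  go (suc (suc n)) zero          = z≤n
  go (suc (suc n)) (suc zero)    = z≤n
  go (suc (suc n)) (suc (suc j)) = s≤s (go n j)

V₁-bound : ∀ α n j → suc α + ⌊ j /2⌋ ≤ α + ⌊ n /2⌋ + rowBound 3 n j
V₁-bound α n j = ℕₚ.≤-trans (ℕₚ.≤-reflexive (sym (ℕₚ.+-suc α ⌊ j /2⌋)))
  (ℕₚ.≤-trans (ℕₚ.+-monoʳ-≤ α (subst (λ x → suc ⌊ j /2⌋ ≤ ⌊ n /2⌋ + ⌊ x ∸ n /2⌋) (ℕₚ.+-comm 3 j) (go n j))) (ℕₚ.≤-reflexive (sym (ℕₚ.+-assoc α _ _))))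
  where
  go : ∀ n j → suc ⌊ j /2⌋ ≤ ⌊ n /2⌋ + ⌊ 3 + j ∸ n /2⌋
  go zero          j             = s≤s (ℕₚ.⌊n/2⌋-mono (ℕₚ.n≤1+n j))
  go (suc zero)    j             = ℕₚ.≤-refl
  go (suc (suc n)) zero          = s≤s z≤n
  go (suc (suc n)) (suc zero)    = s≤s z≤n
  go (suc (suc n)) (suc (suc j)) = s≤s (go n j)

Lattice : ℕ → Series → Set
Lattice α = Mem (λ m → α + ⌊ m /2⌋)

V₀-Lattice : ∀ α {f} → Lattice α f → Lattice α (V₀ f)
V₀-Lattice α = Mem-operator (rowBound 1) V₀-operator V₀-rows (V₀-bound α)

V₁-Lattice : ∀ α {f} → Lattice α f → Lattice (suc α) (V₁ f)
V₁-Lattice α = Mem-operator (rowBound 3) V₁-operator V₁-rows (V₁-bound α)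

-- The generating function and its iterated sections

A A₅ : Series
A  = PDN1-series
A₅ = D A

A-equation : A · J 1 ^S 5 ≈ J 2 · J 2
A-equation = ≈-trans (·-congʳ (≈-trans (≈-sym (·≈⋆ _ _)) (·-congʳ (≈-sym (·≈⋆ (J 2) (J 2))))))
  (solveWith (J 2 · J 2 ∷ inv P ∷ J 1 ∷ P ∷ []) (v0 :* v1 :* v2 :^ 5) v0
    (hyp (:- (v0 :* v1)) v3 (v2 :* v2 :* v2 :* v2 :* v2) P≈ (hyp v0 (v3 :* v1) :one (inv-inverse P refl) done)) refl)
  where
  P : Series
  P = J 1 ⋆ J 1 ⋆ J 1 ⋆ J 1 ⋆ J 1
  P≈ : P ≈ J 1 · J 1 · J 1 · J 1 · J 1
  P≈ = ≈-trans (≈-sym (·≈⋆ _ _)) (·-congʳ (≈-trans (≈-sym (·≈⋆ _ _)) (·-congʳ (≈-trans (≈-sym (·≈⋆ _ _)) (·-congʳ (≈-sym (·≈⋆ _ _)))))))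

-- A J₁⁵ = J₂² divided by the same identity at q²⁵.
A-factor : A · â ^S 5 ≈ D A₅ · b̂ ^S 2
A-factor = unit-cancel (J₂₅ ^S 5) (^S-0 5 {J₂₅} refl) (solveWith (A ∷ D A₅ ∷ J 1 ∷ J 2 ∷ J₂₅ ∷ J₅₀ ∷ â ∷ b̂ ∷ [])
  (v4 :^ 5 :* (v0 :* v6 :^ 5)) (v4 :^ 5 :* (v1 :* v7 :^ 2))
  (hyp (:- v0) (v2 :^ 5) ((v4 :* v6) :^ 5) (^S-cong 5 J1-factor)
  (hyp :one (v0 :* v2 :^ 5) (v3 :* v3) A-equation
  (hyp (v3 :+ v5 :* v7) v3 (v5 :* v7) J2-factor
  (hyp (:- (v7 :^ 2)) (v1 :* v4 :^ 5) (v5 :* v5) A-equation₂₅ done)))) refl)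
  where
  A-equation₂₅ : D A₅ · J₂₅ ^S 5 ≈ J₅₀ · J₅₀
  A-equation₂₅ = ≈-trans (≈-sym (≈-trans (D-cong (D-eval (v0 :* v1 :^ 5) (A ∷ J 1 ∷ []))) (D-eval (v0 :* v1 :^ 5) (A₅ ∷ J₅ ∷ []))))
    (≈-trans (D-cong (D-cong A-equation)) (≈-trans (D-cong (D-· (J 2) (J 2))) (D-· J₁₀ J₁₀)))

qA : q · A ≈ D A₅ · Φ
qA = unit-cancel (â ^S 5) (^S-0 5 â-0) (solveWith (q ∷ A ∷ D A₅ ∷ â ∷ b̂ ∷ inv (â ^S 5) ∷ []) (v3 :^ 5 :* (v0 :* v1)) (v3 :^ 5 :* (v2 :* (v0 :* (v4 :^ 2 :* v5))))
  (hyp v0 (v1 :* v3 :^ 5) (v2 :* v4 :^ 2) A-factor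
  (hyp (:- (v2 :* v0 :* v4 :^ 2)) (v3 :^ 5 :* v5) :one (inv-inverse (â ^S 5) (^S-0 5 â-0)) done)) refl)

-- B α = Σ_n PDN1 (25^{α+1} n + δ) q^{n+1}

B : ℕ → Series
B zero    = U (U (q · A))
B (suc α) = U (U (q · B α))

-- Coefficient n + 1 of U (U (q f)) is coefficient 25(n + 1) - 1 = 25n + 24 of f. Since `B` itself
-- is numbered by n + 1, the step on n is 25n + 23.
index : ℕ → ℕ → ℕ
index zero    n = 24 + n * 5 * 5
index (suc α) n = index α (23 + n * 5 * 5)

B-coeff : ∀ α n → B α (suc n) ≡ PDN1 (index α n)
B-coeff zero    n = q·-suc A (24 + n * 5 * 5)
B-coeff (suc α) n = trans (q·-suc (B α) (24 + n * 5 * 5)) (B-coeff α (23 + n * 5 * 5))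

odd-to-even : ∀ f → U (A₅ · (κν · f)) ≈ A · (κν · V₁ f)
odd-to-even f = ≈-trans (U-D· A (κν · f)) (·-congˡ (≈-sym (κνV₁ f)))

-- By `qA` the factor q A is A(q²⁵) Φ, and A(q²⁵) leaves U as A(q⁵).
even-to-odd : ∀ f → U (q · (A · (κν · f))) ≈ A₅ · (κν · V₀ f)
even-to-odd f = ≈-trans (U-cong (≈-trans (≈-sym (·-assoc q A _)) (≈-trans (·-congʳ qA) (·-assoc (D A₅) Φ _))))
  (≈-trans (U-D· A₅ (Φ · (κν · f))) (·-congˡ (≈-sym (κνV₀ f))))

first-odd : U (q · A) ≈ A₅ · (κν · L₁)
first-odd = ≈-trans (U-cong qA) (≈-trans (U-D· A₅ Φ) (·-congˡ (solveWith (κν ∷ inv κν ∷ U Φ ∷ []) v2 (v0 :* (v1 :* v2))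
  (hyp (:- v2) (v0 :* v1) :one (inv-inverse κν κν-0) done) refl)))

-- `L₁` starts with exponent 0, and each round passes through `V₁` once.
B-Lattice : ∀ α → Σ Series λ f → Lattice (suc α) f × B α ≈ A · (κν · f)
B-Lattice zero    = V₁ L₁ , V₁-Lattice 0 L₁-Mem , ≈-trans (U-cong first-odd) (odd-to-even L₁)
B-Lattice (suc α) = let (f , Lf , h) = B-Lattice α in
  V₁ (V₀ f) , V₁-Lattice (suc α) (V₀-Lattice (suc α) Lf) ,
  ≈-trans (U-cong (≈-trans (U-cong (·-congˡ h)) (even-to-odd f))) (odd-to-even (V₀ f))

record DivS (a : ℕ) (f : Series) : Set where
  constructor divS
  field at : ∀ n → Div a (f n)
open DivS

DivS-cong : ∀ {a f g} → f ≈ g → DivS a f → DivS a g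
DivS-cong {a} h (divS d) = divS λ n → subst (Div a) (coeff h n) (d n)

DivS-⊕ : ∀ {a f g} → DivS a f → DivS a g → DivS a (f ⊕ g)
DivS-⊕ {a} {f} {g} (divS p) (divS r) = divS λ n → subst (Div a) (sym (⊕-coeff f g n)) (Div-+ (p n) (r n))

DivS-· : ∀ {a g} f → DivS a g → DivS a (f · g)
DivS-· {a} {g} f (divS d) = divS λ n → subst (Div a) (sym (·-coeff f g n)) (sum n)
  where
  sum-Div : ∀ n (h : ℕ → ℤ) → (∀ i → Div a (h i)) → Div a (sumTo n h)
  sum-Div zero    h d = d 0
  sum-Div (suc n) h d = Div-+ (sum-Div n h d) (d (suc n))
  sum : ∀ n → Div a ((f ⋆ g) n)
  sum n = sum-Div n _ (λ i → Div-*ˡ (f i) (d (n ∸ i)))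

DivS-0S : ∀ a → DivS a 0S
DivS-0S a = divS λ n → Div-zero a

DivS-constant : ∀ {a b z g} → Div a z → DivS b g → DivS (a + b) (constant z · g)
DivS-constant {a} {b} {z} {g} p (divS d) = divS λ n → subst (Div (a + b)) (sym (constant-· z g n)) (Div-* p (d n))

Div-5 : Div 1 (+ 5)
Div-5 = div (divides 1ℤ refl)

-- Modulo 5, A ν y and A ν y² are series in q⁵ times q â³ and q² b̂, because â⁵ and b̂⁵ are series in q⁵.

private
  Na Nb : Series
  Na = ρ⁻ ^S 5 ⊖ q ⊖ q ^S 2 · ρ ^S 5
  Nb = σ⁻ ^S 5 ⊖ q ^S 2 ⊖ q ^S 4 · σ ^S 5

  Na-0 : Na 0 ≡ 1ℤ
  Na-0 = trans (⊖-coeff _ _ 0) (cong₂ _-ℤ_ (trans (⊖-coeff _ q 0) (cong (_-ℤ 0ℤ) (^S-0 5 {ρ⁻} (·-constantTerm P₀ ι₅))))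
    (trans (·-constantTerm (q ^S 2) _) (cong (_*ℤ (ρ ^S 5) 0) (q·-zero (q ^S 1)))))

  -- One fifth of (x - s - t)⁵ - (x⁵ - s⁵ - t⁵).
  fifth : Expr 3 → Expr 3 → Expr 3 → Expr 3
  fifth x s t = :- (x :^ 4 :* (s :+ t)) :+ # 2 :* x :^ 3 :* (s :+ t) :^ 2 :- # 2 :* x :^ 2 :* (s :+ t) :^ 3 :+ x :* (s :+ t) :^ 4
    :- (s :^ 4 :* t :+ # 2 :* s :^ 3 :* t :^ 2 :+ # 2 :* s :^ 2 :* t :^ 3 :+ s :* t :^ 4)

  â⁵-rest b̂⁵-rest : Series
  â⁵-rest = eval (fifth v2 v0 (v0 :^ 2 :* v1)) (q ∷ R ∷ R⁻ ∷ [])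
  b̂⁵-rest = eval (fifth v2 (v0 :^ 2) (v0 :^ 4 :* v1)) (q ∷ S ∷ S⁻ ∷ [])

  D-q^ : ∀ n → D (q ^S n) ≈ (q ^S 5) ^S n
  D-q^ n = ≈-trans (D-^ q n) (^S-cong n D-q)

  â⁵ : â ^S 5 ≈ D Na ⊕ constant (+ 5) · â⁵-rest
  â⁵ = ≈-trans (decide (q ∷ R ∷ R⁻ ∷ []) ((v2 :- v0 :- v0 :^ 2 :* v1) :^ 5) ((v2 :^ 5 :- v0 :^ 5 :- (v0 :^ 5) :^ 2 :* v1 :^ 5) :+ # 5 :* fifth v2 v0 (v0 :^ 2 :* v1)) refl)
    (⊕-cong (≈-sym (≈-trans (D-⊖ _ _) (⊖-cong (≈-trans (D-⊖ _ _) (⊖-cong (D-^ ρ⁻ 5) D-q)) (≈-trans (D-· _ _) (·-cong (D-q^ 2) (D-^ ρ 5)))))) ≈-refl)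

  b̂⁵ : b̂ ^S 5 ≈ D Nb ⊕ constant (+ 5) · b̂⁵-rest
  b̂⁵ = ≈-trans (decide (q ∷ S ∷ S⁻ ∷ []) ((v2 :- v0 :^ 2 :- v0 :^ 4 :* v1) :^ 5) ((v2 :^ 5 :- (v0 :^ 5) :^ 2 :- (v0 :^ 5) :^ 4 :* v1 :^ 5) :+ # 5 :* fifth v2 (v0 :^ 2) (v0 :^ 4 :* v1)) refl)
    (⊕-cong (≈-sym (≈-trans (D-⊖ _ _) (⊖-cong (≈-trans (D-⊖ _ _) (⊖-cong (D-^ σ⁻ 5) (D-q^ 2))) (≈-trans (D-· _ _) (·-cong (D-q^ 4) (D-^ σ 5)))))) ≈-refl)

  Aνy : A · (ν · y) · (â ^S 15 · ν₅ ^S 2) ≈ D A₅ · κ₅ · (b̂ ^S 5 · (q · â ^S 3))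
  Aνy = solveWith (q ∷ A ∷ ν ∷ y ∷ â ∷ b̂ ∷ D A₅ ∷ κ₅ ∷ ν₅ ∷ []) (v1 :* (v2 :* v3) :* (v4 :^ 15 :* v8 :^ 2)) (v6 :* v7 :* (v5 :^ 5 :* (v0 :* v4 :^ 3)))
    (hyp (v2 :* v3 :* v4 :^ 10 :* v8 :^ 2) (v1 :* v4 :^ 5) (v6 :* v5 :^ 2) A-factor
    (hyp (:- (v6 :* v5 :^ 2 :* v3 :* v4 :^ 6 :* v8)) (v5 :^ 2) (v4 :^ 4 :* (v2 :* v8)) relation-ν
    (hyp (v6 :* v5 :^ 4 :* v4 :^ 3) (v3 :* (v8 :* v4 :^ 3)) (v0 :* (v7 :* v5)) relation-y done))) refl

  Aνy² : A · (ν · y ^S 2) · (â ^S 15 · ν₅ ^S 3) ≈ D A₅ · κ₅ ^S 2 · (b̂ ^S 5 · (q ^S 2 · b̂))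
  Aνy² = solveWith (q ∷ A ∷ ν ∷ y ∷ â ∷ b̂ ∷ D A₅ ∷ κ₅ ∷ ν₅ ∷ []) (v1 :* (v2 :* v3 :^ 2) :* (v4 :^ 15 :* v8 :^ 3)) (v6 :* v7 :^ 2 :* (v5 :^ 5 :* (v0 :^ 2 :* v5)))
    (hyp (v2 :* v3 :^ 2 :* v4 :^ 10 :* v8 :^ 3) (v1 :* v4 :^ 5) (v6 :* v5 :^ 2) A-factor
    (hyp (:- (v6 :* v5 :^ 2 :* v3 :^ 2 :* v4 :^ 6 :* v8 :^ 2)) (v5 :^ 2) (v4 :^ 4 :* (v2 :* v8)) relation-ν
    (hyp (v6 :* v5 :^ 4 :* (v3 :* v8 :* v4 :^ 3 :+ v0 :* v7 :* v5)) (v3 :* (v8 :* v4 :^ 3)) (v0 :* (v7 :* v5)) relation-y done))) refl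

  -- Replacing â⁵ and b̂⁵ by the series `D Na` and `D Nb` costs multiples of 5. Modulo 5, a series
  -- in q⁵ times x is then a series in q⁵ times z, so the vanishing component of z carries over to
  -- x; the multiplier has constant term 1 and can be inverted.
  component-mod-5 : ∀ i → i < 5 → ∀ x n t z → n 0 ≡ 1ℤ → x · (â ^S 15 · D n) ≈ D t · (b̂ ^S 5 · z) → comp 5 i z ≈ 0S → DivS 1 (comp 5 i x)
  component-mod-5 i i<5 x n t z n0 h z0 = DivS-cong (≈-sym solved)
    (DivS-· (inv N') (DivS-constant Div-5 (divS λ m → Div-any (comp 5 i rest m))))
    where
    N' rest : Series
    N' = Na ^S 3 · n
    rest = eval (v2 :* v6 :* v3 :- v0 :* v1 :* v5 :* (v4 :^ 10 :+ v4 :^ 5 :* v7 :+ v7 :^ 2)) (x ∷ D n ∷ D t ∷ z ∷ â ∷ â⁵-rest ∷ b̂⁵-rest ∷ D Na ∷ [])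
    N'-0 : N' 0 ≡ 1ℤ
    N'-0 = trans (·-constantTerm (Na ^S 3) n) (cong₂ _*ℤ_ (^S-0 3 Na-0) n0)
    equation : D N' · x ≈ D (t · Nb) · z ⊕ constant (+ 5) · rest
    equation = ≈-trans (·-congʳ (D-eval (v0 :^ 3 :* v1) (Na ∷ n ∷ []))) (≈-trans
      (solveWith (x ∷ D n ∷ D t ∷ z ∷ â ∷ â⁵-rest ∷ b̂⁵-rest ∷ D Na ∷ D Nb ∷ b̂ ∷ [])
        (v7 :^ 3 :* v1 :* v0) (v2 :* v8 :* v3 :+ # 5 :* (v2 :* v6 :* v3 :- v0 :* v1 :* v5 :* (v4 :^ 10 :+ v4 :^ 5 :* v7 :+ v7 :^ 2)))
        (hyp (:- (v0 :* v1 :* (v4 :^ 10 :+ v4 :^ 5 :* v7 :+ v7 :^ 2))) (v4 :^ 5) (v7 :+ # 5 :* v5) â⁵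
        (hyp :one (v0 :* (v4 :^ 15 :* v1)) (v2 :* (v9 :^ 5 :* v3)) h
        (hyp (v2 :* v3) (v9 :^ 5) (v8 :+ # 5 :* v6) b̂⁵ done))) refl)
      (⊕-cong (·-congʳ (≈-sym (D-· t Nb))) ≈-refl))
    components : N' · comp 5 i x ≈ constant (+ 5) · comp 5 i rest
    components = ≈-trans (≈-sym (comp-dil· N' x i i<5)) (≈-trans (comp-cong i equation) (≈-trans (comp-⊕ i _ _)
      (≈-trans (⊕-cong (≈-trans (comp-dil· (t · Nb) z i i<5) (≈-trans (·-congˡ z0) (·-zeroʳ _)))
        (≈-trans (comp-cong i (·-congʳ (≈-sym (D-constant (+ 5))))) (comp-dil· (constant (+ 5)) rest i i<5))) (⊕-identityˡ _))))
    solved : comp 5 i x ≈ inv N' · (constant (+ 5) · comp 5 i rest)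
    solved = solveWith (N' ∷ inv N' ∷ comp 5 i x ∷ constant (+ 5) · comp 5 i rest ∷ []) v2 (v1 :* v3)
      (hyp (:- v2) (v0 :* v1) :one (inv-inverse N' N'-0) (hyp v1 (v0 :* v2) v3 components done)) refl

  -- Components 2 and 4 of â³ vanish because ρ ρ⁻ = 1. This mirrors Jacobi's series for J₁³, whose
  -- exponents are triangular numbers and so never ≡ 2, 4 modulo 5.
  qâ³-0 : comp 5 0 (q · â ^S 3) ≈ 0S
  qâ³-0 = ≈-trans (component 0 0<5 (ρ ∷ ρ⁻ ∷ []) (v0 :* (v2 :- v0 :- v0 :^ 2 :* v1) :^ 3) (# 3 :* v0 :* v1 :* (v1 :* v2 :- :one)) refl)
    (≈-trans (solveWith (q ∷ ρ ∷ ρ⁻ ∷ []) (# 3 :* v0 :* v1 :* (v1 :* v2 :- :one)) (con 0ℤ) (hyp (# 3 :* v0 :* v1) (v1 :* v2) :one ρ-inverse done) refl) constant-0)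

  qâ³-3 : comp 5 3 (q · â ^S 3) ≈ 0S
  qâ³-3 = ≈-trans (component 3 3<5 (ρ ∷ ρ⁻ ∷ []) (v0 :* (v2 :- v0 :- v0 :^ 2 :* v1) :^ 3) (# 3 :* v2 :* (:one :- v1 :* v2)) refl)
    (≈-trans (solveWith (q ∷ ρ ∷ ρ⁻ ∷ []) (# 3 :* v2 :* (:one :- v1 :* v2)) (con 0ℤ) (hyp (:- (# 3 :* v2)) (v1 :* v2) :one ρ-inverse done) refl) constant-0)

  -- The exponents in q² b̂ are 2, 4 and 6 modulo 5, so the residues 0 and 3 are missing.
  q²b̂-0 : comp 5 0 (q ^S 2 · b̂) ≈ 0S
  q²b̂-0 = ≈-trans (component 0 0<5 (σ ∷ σ⁻ ∷ []) (v0 :^ 2 :* (v2 :- v0 :^ 2 :- v0 :^ 4 :* v1)) (con 0ℤ) refl) constant-0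

  q²b̂-3 : comp 5 3 (q ^S 2 · b̂) ≈ 0S
  q²b̂-3 = ≈-trans (component 3 3<5 (σ ∷ σ⁻ ∷ []) (v0 :^ 2 :* (v2 :- v0 :^ 2 :- v0 :^ 4 :* v1)) (con 0ℤ) refl) constant-0

  -- κ = 1 + 5y is 1 modulo 5.
  drop-κ : ∀ i → i < 5 → ∀ f → DivS 1 (comp 5 i (A · (ν · f))) → DivS 1 (comp 5 i (A · (κν · f)))
  drop-κ i i<5 f d = DivS-cong (≈-sym (≈-trans (comp-cong i (decide (y ∷ A ∷ ν ∷ f ∷ []) (v1 :* ((:one :+ # 5 :* v0) :* v2 :* v3))
      (v1 :* (v2 :* v3) :+ # 5 :* (v0 :* v1 :* v2 :* v3)) refl))
    (≈-trans (comp-⊕ i _ _) (⊕-cong ≈-refl (≈-trans (comp-cong i (·-congʳ (≈-sym (D-constant (+ 5))))) (comp-dil· (constant (+ 5)) _ i i<5))))))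
    (DivS-⊕ d (DivS-constant Div-5 (divS λ m → Div-any _)))

  row₀ : ∀ i → i < 5 → comp 5 i (q · â ^S 3) ≈ 0S → DivS 1 (comp 5 i (A · (κν · (y · y ^S 0))))
  row₀ i i<5 z = DivS-cong (comp-cong i (·-congˡ (·-congˡ (≈-sym (·-identityʳ y))))) (drop-κ i i<5 y
    (component-mod-5 i i<5 (A · (ν · y)) (ν ^S 2) (A₅ · κ) (q · â ^S 3) (^S-0 2 ν-0)
      (≈-trans (·-congˡ (·-congˡ (D-^ ν 2))) (≈-trans Aνy (·-congʳ (≈-sym (D-· A₅ κ))))) z))

  row₁ : ∀ i → i < 5 → comp 5 i (q ^S 2 · b̂) ≈ 0S → DivS 1 (comp 5 i (A · (κν · (y · y ^S 1))))
  row₁ i i<5 z = drop-κ i i<5 (y ^S 2)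
    (component-mod-5 i i<5 (A · (ν · y ^S 2)) (ν ^S 3) (A₅ · κ ^S 2) (q ^S 2 · b̂) (^S-0 3 ν-0)
      (≈-trans (·-congˡ (·-congˡ (D-^ ν 3))) (≈-trans Aνy² (·-congʳ (≈-sym (≈-trans (D-· A₅ (κ ^S 2)) (·-congˡ (D-^ κ 2))))))) z)

module _ {α : ℕ} {f : Series} (Lf : Lattice α f) where

  Lattice-DivS : DivS α (A · (κν · f))
  Lattice-DivS = DivS-· A (DivS-· κν (divS λ n → let (c , d , r) = approximations Lf (suc n) in
    subst (Div α) (sym (below r n ℕₚ.≤-refl)) (at (DivS-· y (finite c d (suc n))) n)))
    where
    finite : ∀ c → (∀ m → Div (α + ⌊ m /2⌋) (c m)) → ∀ M → DivS α (psum c M)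
    finite c d zero    = DivS-0S α
    finite c d (suc M) = DivS-⊕ (finite c d M)
      (subst (λ a → DivS a (constant (c M) · y ^S M)) (ℕₚ.+-identityʳ α)
        (DivS-constant (Div-weaken (ℕₚ.m≤m+n α _) (d M)) (divS λ n → Div-any _)))

  -- From m = 2 on, ⌊m/2⌋ already supplies the additional factor 5. The terms in y and y² gain it
  -- from `row₀` and `row₁`.
  Lattice-components : ∀ i → i < 5 → comp 5 i (q · â ^S 3) ≈ 0S → comp 5 i (q ^S 2 · b̂) ≈ 0S → DivS (α + 1) (comp 5 i (A · (κν · f)))
  Lattice-components i i<5 z₀ z₁ = divS λ n → let (c , d , r) = approximations Lf (suc n * 5) in
    subst (Div (α + 1)) (sym (below (comp-≋ i {N = suc n} i<5 (≋-· (≋-refl {f = A}) (≋-· (≋-refl {f = κν}) r))) n ℕₚ.≤-refl))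
      (at (finite c d (suc n * 5)) n)
    where
    term : ∀ c → (∀ m → Div (α + ⌊ m /2⌋) (c m)) → ∀ m → DivS (α + 1) (constant (c m) · comp 5 i (A · (κν · (y · y ^S m))))
    term c d 0 = DivS-constant (subst (λ a → Div a (c 0)) (ℕₚ.+-identityʳ α) (d 0)) (row₀ i i<5 z₀)
    term c d 1 = DivS-constant (subst (λ a → Div a (c 1)) (ℕₚ.+-identityʳ α) (d 1)) (row₁ i i<5 z₁)
    term c d (suc (suc m)) = subst (λ a → DivS a (constant (c (suc (suc m))) · comp 5 i (A · (κν · (y · y ^S suc (suc m)))))) (ℕₚ.+-identityʳ (α + 1))
      (DivS-constant (Div-weaken (ℕₚ.+-monoʳ-≤ α (s≤s z≤n)) (d (suc (suc m)))) (divS λ n → Div-any _))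
    finite : ∀ c → (∀ m → Div (α + ⌊ m /2⌋) (c m)) → ∀ M → DivS (α + 1) (comp 5 i (A · (κν · (y · psum c M))))
    finite c d zero    = DivS-cong (≈-sym (≈-trans (comp-cong i zeros) (ext λ n → refl))) (DivS-0S (α + 1))
      where
      zeros : A · (κν · (y · 0S)) ≈ 0S
      zeros = ≈-trans (·-congˡ (≈-trans (·-congˡ (·-zeroʳ y)) (·-zeroʳ κν))) (·-zeroʳ A)
    finite c d (suc M) = DivS-cong (≈-sym (≈-trans (comp-cong i (decide (A ∷ κν ∷ y ∷ psum c M ∷ constant (c M) ∷ y ^S M ∷ [])
        (v0 :* (v1 :* (v2 :* (v3 :+ v4 :* v5)))) (v0 :* (v1 :* (v2 :* v3)) :+ v4 :* (v0 :* (v1 :* (v2 :* v5)))) refl))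
      (≈-trans (comp-⊕ i _ _) (⊕-cong ≈-refl (≈-trans (comp-cong i (·-congʳ (≈-sym (D-constant (c M))))) (comp-dil· (constant (c M)) _ i i<5))))))
      (DivS-⊕ (finite c d M) (term c d M))

-- Arithmetic of the indices and the congruences

index-formula : ∀ α n → 24 * index α n ≡ 24 * (5 ^ (2 * suc α) * n) + (23 * 5 ^ (2 * suc α) + 1)
index-formula zero    n = lemma n
  where
  lemma : ∀ n → 24 * (24 + n * 5 * 5) ≡ 24 * (25 * n) + (23 * 25 + 1)
  lemma = ℕSolver.solve-∀
index-formula (suc α) n = trans (index-formula α (23 + n * 5 * 5))
  (trans (lemma (5 ^ (2 * suc α)) n) (cong (λ x → 24 * (x * n) + (23 * x + 1)) (sym power)))
  where
  power : 5 ^ (2 * suc (suc α)) ≡ 25 * 5 ^ (2 * suc α)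
  power = trans (cong (5 ^_) (ℕₚ.*-suc 2 (suc α))) (ℕₚ.^-distribˡ-+-* 5 2 (2 * suc α))
  lemma : ∀ Q n → 24 * (Q * (23 + n * 5 * 5)) + (23 * Q + 1) ≡ 24 * (25 * Q * n) + (23 * (25 * Q) + 1)
  lemma = ℕSolver.solve-∀

-- With r = 23 + 24 s the numerator is exactly 24(s Q + δ). The cases 71 = 23 + 48 and 119 = 23 + 96
-- have s = 2 and s = 4.
quotient-24 : ∀ r s Q δ → 24 * δ ≡ 23 * Q + 1 → r ≡ 23 + 24 * s → (r * Q + 1) / 24 ≡ s * Q + δ
quotient-24 r s Q δ h refl = trans (cong (_/ 24) (trans (lemma s Q) (trans (cong (24 * (s * Q) ℕ.+_) (sym h)) (lemma' (s * Q) δ)))) (ℕₚ.m*n/n≡m (s * Q + δ) 24)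
  where
  lemma : ∀ s Q → (23 + 24 * s) * Q + 1 ≡ 24 * (s * Q) + (23 * Q + 1)
  lemma = ℕSolver.solve-∀
  lemma' : ∀ a b → 24 * a + 24 * b ≡ (a + b) * 24
  lemma' = ℕSolver.solve-∀

module _ (α : ℕ) where
  private
    Q δ : ℕ
    Q = 5 ^ (2 * suc α)
    δ = index α 0
    24δ : 24 * δ ≡ 23 * Q + 1
    24δ = trans (index-formula α 0) (cong (λ x → 24 * x + (23 * Q + 1)) (ℕₚ.*-zeroʳ Q))
    index-linear : ∀ n → index α n ≡ Q * n + δ
    index-linear n = ℕₚ.*-cancelˡ-≡ (index α n) (Q * n + δ) 24
      (trans (index-formula α n) (trans (cong (24 * (Q * n) ℕ.+_) (sym 24δ)) (sym (ℕₚ.*-distribˡ-+ 24 (Q * n) δ))))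

  index-main : ∀ n → 5 ^ (2 * suc α) * n + (23 * 5 ^ (2 * suc α) + 1) / 24 ≡ index α n
  index-main n = trans (cong (Q * n ℕ.+_) (quotient-24 23 0 Q δ 24δ refl)) (sym (index-linear n))

  index-residue : ∀ r s n → r ≡ 23 + 24 * s → 5 ^ (2 * suc α + 1) * n + (r * 5 ^ (2 * suc α) + 1) / 24 ≡ index α (s + n * 5)
  index-residue r s n e = trans (cong₂ (λ x z → x * n + z) (ℕₚ.^-distribˡ-+-* 5 (2 * suc α) 1) (quotient-24 r s Q δ 24δ e))
    (trans (lemma Q s n δ) (sym (index-linear (s + n * 5))))
    where
    lemma : ∀ Q s n δ → Q * 5 * n + (s * Q + δ) ≡ Q * (s + n * 5) + δ
    lemma = ℕSolver.solve-∀

congruence-main : ∀ α n → Div (suc α) (PDN1 (index α n))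
congruence-main α n = let (f , Lf , h) = B-Lattice α in
  subst (Div (suc α)) (B-coeff α n) (at (DivS-cong (≈-sym h) (Lattice-DivS Lf)) (suc n))

-- `B` stores index n at the exponent n + 1, so the residue 2 is found in component 3.
congruence-2 : ∀ α n → Div (suc α + 1) (PDN1 (index α (2 + n * 5)))
congruence-2 α n = let (f , Lf , h) = B-Lattice α in
  subst (Div (suc α + 1)) (B-coeff α (2 + n * 5)) (at (DivS-cong (comp-cong 3 (≈-sym h)) (Lattice-components Lf 3 3<5 qâ³-3 q²b̂-3)) n)

congruence-4 : ∀ α n → Div (suc α + 1) (PDN1 (index α (4 + n * 5)))
congruence-4 α n = let (f , Lf , h) = B-Lattice α in
  -- The exponent is 5 + 5n: the residue 4 lands in component 0 with a carry, hence `suc n`.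
  subst (Div (suc α + 1)) (B-coeff α (4 + n * 5)) (at (DivS-cong (comp-cong 0 (≈-sym h)) (Lattice-components Lf 0 0<5 qâ³-0 q²b̂-0)) (suc n))

theorem1p1 : (n α : ℕ) → 1 Data.Nat.≤ α →
    ((+ (5 ^ α)) ∣ PDN1 (5 ^ (2 * α) * n + (23 * 5 ^ (2 * α) + 1) / 24))
    × ((+ (5 ^ (α + 1))) ∣ PDN1 (5 ^ (2 * α + 1) * n + (71 * 5 ^ (2 * α) + 1) / 24))
    × ((+ (5 ^ (α + 1))) ∣ PDN1 (5 ^ (2 * α + 1) * n + (119 * 5 ^ (2 * α) + 1) / 24))
theorem1p1 n (suc α) _ =
  ∣⇒∣ᵤ (by (subst (λ i → Div (suc α) (PDN1 i)) (sym (index-main α n)) (congruence-main α n))) ,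
  ∣⇒∣ᵤ (by (subst (λ i → Div (suc α + 1) (PDN1 i)) (sym (index-residue α 71 2 n refl)) (congruence-2 α n))) ,
  ∣⇒∣ᵤ (by (subst (λ i → Div (suc α + 1) (PDN1 i)) (sym (index-residue α 119 4 n refl)) (congruence-4 α n)))
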